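{- Let the strings $e'$ and $e''$ composed of the characters $\mathtt f$, $\mathtt g$, and $\mathtt h$ be flips of each other. Then the fundamental direction cycle $\Phi(e')$ of descent $e'$ and the two second fundamental direction cycles $\Phi^{\mathrm{II}}_{\mathtt g}(e'')$ and $\Phi^{\mathrm{II}}_{\mathtt h}(e'')$ of descent $e''$ are equivalent.
   Context: Flip. Let $\overline{\mathtt f}=\mathtt g$, $\overline{\mathtt g}=\mathtt f$, $\overline{\mathtt h}=\mathtt h$. The flip of a string $e_1e_2\ldots e_l$ is $\overline{e_l}\,\overline{e_{l-1}}\ldots\overline{e_1}$. Leapers. A square is a unit square of the infinite chessboard. A $(p,q)$-leaper is a piece that moves from a square $a$ to any of $a+(\pm p,\pm q)$, $a+(\pm q,\pm p)$. The leaper graph of $L$ over a set of squares $B$ has the squares of $B$ as vertices, two being adjacent when a move of $L$ joins them; a cycle of $L$ within $B$ is a simple cycle in this graph. The leaper is basic if $p+q$ is odd and $\gcd(p,q)=1$, and skew if $p,q$ are nonzero and distinct. Frames. Let $m<n$ be coprime positive integers with $m+n$ odd. Identify squares with their centers, the centers being the points of $\mathbb Z^2$. The $(m,n)$-frame $F$ is the set of squares $(x,y)$ with $\frac{n-m}2<\max(|x|,|y|)<\frac{m+n}2$, i.e. an $(m+n)\times(m+n)$ board with an $(n-m)\times(n-m)$ central hole. Its section $F_{\mathtt E}$ consists of the squares with $\frac{n-m}2<x<\frac{m+n}2$, $|y|<\frac{n-m}2$; its section $F_{\mathtt{NE}}$ of those with $\frac{n-m}2<x,y<\frac{m+n}2$;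 the sections $F_{\mathtt N},F_{\mathtt{NW}},F_{\mathtt W},F_{\mathtt{SW}},F_{\mathtt S},F_{\mathtt{SE}}$ are obtained by counterclockwise rotations by multiples of $90^\circ$ about the origin. In the leaper graph of the $(m,n)$-leaper over the $(m+n)\times(m+n)$ board the squares of the hole are isolated and all squares of $F$ have degree two, so a cycle is determined by its vertex set. Lifting. The lifting transformations $\mathtt f,\mathtt g,\mathtt h$ take $S\subseteq F$ to the disjoint union of $(S+v_i)\cap H_i$ over the eight directions $i$, where $H$ is respectively the $(m,2m+n)$-, $(n,2n-m)$-, $(n,m+2n)$-frame, and for $\mathtt f$: $v_{\mathtt E}=(m+n,0)$, $v_{\mathtt{NE}}=(m,m)$; for $\mathtt g$: $v_{\mathtt E}=(n-m,0)$, $v_{\mathtt{NE}}=(n,n)$; for $\mathtt h$: $v_{\mathtt E}=(m+n,0)$, $v_{\mathtt{NE}}=(n,n)$; the other $v_i$ are obtained by $90^\circ$ rotations. Each maps the vertex set of a cycle of the $(m,n)$-leaper within $F$ to the vertex set of a cycle of the leaper with the proportions of $H$ within $H$; this defines the lift of a cycle. Shell. Let $n\le3m$. If $2m\ge n$, the shell of $F$ is the union of eight $(n-m)\times(n-m)$ subboards: the four corners of $F$ and the four adjacent by side to the central hole. If $2m\le n\le3m$, it is the union of eight $(3m-n)\times(3m-n)$ subboards: one in the middle of each outer side and four adjacent by corner to the central hole. (When $n=2m$ both give all of $F$.) The shell is a union of eight-square cycles of the $(m,n)$-leaper, called shell cycles; each visits exactly one square in each section. Descents. The descent of a skew basic $(p,q)$-leaper,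 $p<q$, is the unique string $e_1\ldots e_l$ of characters $\mathtt f,\mathtt g,\mathtt h$ such that successively applying lifting transformations of types $e_l,\ldots,e_1$ to a $(1,2)$-frame gives a $(p,q)$-frame. The descent of a cycle $C$ of $L$ within a $(p+q)\times(p+q)$ board is the prefix $e_1\ldots e_j$ of the descent of $L$ such that $C$ is obtained from a shell cycle $C'$ of the frame $F'$ whose leaper has descent $e_{j+1}\ldots e_l$ by successively applying lifting transformations of types $e_j,\ldots,e_1$. Either $j=l$ and $F'$ is a $(1,2)$-frame, or $j<l$ and $e_{j+1}\in\{\mathtt g,\mathtt h\}$. Canonical second leaper cycles. Let $L$ be a skew basic $(p,q)$-leaper, $p<q$, of descent $e_1\ldots e_l$, let $C$ be a cycle of $L$ of descent $e_1\ldots e_j$ within a $(p+q)\times(p+q)$ board, let $F'$ be the frame whose leaper has descent $e_{j+1}\ldots e_l$, and let $C'$ be the shell cycle of $F'$ from which $C$ is obtained by successively applying lifting transformations of types $e_j,\ldots,e_1$. The canonical second leaper $M$ associated with $C$ is the $(0,1)$-leaper if $j=l$, and the skew basic leaper of descent $e_{j+2}\ldots e_l$ if $j<l$. The canonical second leaper cycle over the squares of $C'$ is the cycle of $M$ visiting the eight squares of $C'$ in the order of their sections $\mathtt E,\mathtt{NE},\mathtt N,\mathtt{NW},\mathtt W,\mathtt{SW},\mathtt S,\mathtt{SE}$, written as a concatenation $a_0a_1\ldots a_7$ of eight one-square paths. Number the directions $\mathtt E,\mathtt{NE},\ldots,\mathtt{SE}$ by $0,\ldots,7$ modulo $8$,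 let $u_0=(1,0)$, $u_1=(1,1)$, $u_2=(0,1)$, $u_3=(-1,1)$, $u_{i+4}=-u_i$, and let $-w$ be the path $w$ traversed backwards. A cycle $a_0a_1\ldots a_7$ of $M$ within an $(m,n)$-frame, split into eight paths with $a_i$ in the section of direction $i$, is lifted to $b_0b_1\ldots b_7$ within the larger frame by the rules: $\mathtt f$: $b_i=(-a_{i+5})(-a_{i+4})(-a_{i+3})+(m+n)u_i$ for $i$ even, $b_i=a_i+mu_i$ for $i$ odd; $\mathtt g$: $b_i=a_i+(n-m)u_i$ for $i$ even, $b_i=(-a_{i+5})(-a_{i+4})(-a_{i+3})+nu_i$ for $i$ odd; $\mathtt h$: $b_i=(-a_{i+6})(-a_{i+5})(-a_{i+4})(-a_{i+3})(-a_{i+2})+(m+n)u_i$ for $i$ even, $b_i=a_{i-1}a_ia_{i+1}+nu_i$ for $i$ odd. The canonical second leaper cycle $D$ over the squares of $C$ is obtained from the one over the squares of $C'$ by successively applying the lifts of types $e_j,\ldots,e_1$; it is a Hamiltonian cycle of $M$ over the squares of $C$. When $M$ is skew (so $j<l$), the descent of $D$ is $e_1\ldots e_j$ and the origin of $D$ is $e_{j+1}\in\{\mathtt g,\mathtt h\}$. Direction graphs. Let $A_1=\begin{pmatrix}0&1\\1&0\end{pmatrix}$, $A_2=\begin{pmatrix}1&0\\0&1\end{pmatrix}$, $A_3=\begin{pmatrix}-1&0\\0&1\end{pmatrix}$, $A_4=\begin{pmatrix}0&-1\\1&0\end{pmatrix}$, and $A_{i+4}=-A_i$ for $i=1,\ldots,4$.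 A move of a skew $(r,s)$-leaper, $r<s$, by a translation $v$ has (skew) direction $i\in\{1,\ldots,8\}$ and direction matrix $A_i$ if $v^T=A_i\binom rs$. A direction graph is a symmetric directed graph whose arcs are labeled with skew directions so that the sum of the associated direction matrices over every simple directed cycle (including two-cycles) is zero. Two direction graphs are the same if there is a label-preserving isomorphism between them. The direction graph extracted from a cycle of a skew leaper whose direction matrices sum to zero has the squares of the cycle as vertices and, for each pair of consecutive squares $a,b$, an arc from $a$ to $b$ and an arc from $b$ to $a$, each labeled with the direction of the corresponding move. Fundamental direction cycles. $\Phi(e)$ is the direction graph extracted from a cycle of descent $e$ of a skew basic $(p,q)$-leaper within a $(p+q)\times(p+q)$ chessboard; it exists and depends only on $e$. For $o\in\{\mathtt g,\mathtt h\}$, $\Phi^{\mathrm{II}}_o(e)$ is the direction graph extracted from a canonical second leaper cycle of descent $e$ and origin $o$ of a skew basic canonical second leaper; it exists and depends only on $e$ and $o$. Equivalence. A permutation $\pi$ of the eight skew directions is an equivalence permutation if there are real $2\times2$ matrices $P,Q$ with $A_{\pi(i)}=PA_iQ$ for all $i$. $\pi(\Phi)$ is obtained from $\Phi$ by applying $\pi$ to every arc label. Two direction graphs $\Phi_1,\Phi_2$ are equivalent if $\pi(\Phi_1)=\Phi_2$ for some equivalence permutation $\pi$. -}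

module Defs where

open import Data.Fin.Base using (Fin; toℕ; splitAt)
open import Data.Fin.Patterns using (0F; 1F; 2F; 3F)
open import Data.Fin.Permutation using (Permutation′; _⟨$⟩ʳ_)
open import Data.Integer.Base as ℤ using (ℤ; +_; -[1+_]; 0ℤ; 1ℤ)
open import Data.List.Base
  using (List; []; _∷_; [_]; _++_; _∷ʳ_; concat; foldr; length; map; reverse; tabulate; zip)
open import Data.List.Membership.Propositional using (_∈_)
open import Data.List.Relation.Unary.All using (All)
open import Data.List.Relation.Unary.Unique.Propositional using (Unique)
open import Data.Nat.Base as ℕ using (ℕ; zero; suc; parity)
open import Data.Nat.DivMod using (_mod_)
open import Data.Nat.GCD using (gcd)
import Data.Nat.Properties as ℕₚ
open import Data.Parity.Base using (Parity; 0ℙ; 1ℙ)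
open import Data.Product.Base using (Σ; ∃; _×_; _,_; proj₁; proj₂; uncurry)
open import Data.Rational.Base as ℚ using (ℚ; 0ℚ; 1ℚ; ½; Positive)
import Data.Rational.Properties as ℚₚ
open import Data.Rational.Solver using (module +-*-Solver)
open import Data.Sum.Base using (_⊎_; [_,_]′)
open import Function.Base using (_∘_)
open import Function.Bundles using (_↔_; _⇔_; Inverse)
open import Level using (0ℓ)
open import Relation.Binary.PropositionalEquality using (_≡_; _≢_; refl; sym; cong; subst)
open import Relation.Unary using (Pred; _≐_)

-- Real numbers: Cauchy sequences of rationals, with equality _≈ᴿ_.

record ℝ : Set where
  constructor cauchySeq
  field
    seq    : ℕ → ℚ
    cauchy : ∀ ε .{{_ : Positive ε}} →
             ∃ λ N → ∀ {j k} → N ℕ.≤ j → N ℕ.≤ k → ℚ.∣ seq j ℚ.- seq k ∣ ℚ.< ε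

open ℝ public

infix 4 _≈ᴿ_
_≈ᴿ_ : ℝ → ℝ → Set
x ≈ᴿ y = ∀ ε .{{_ : Positive ε}} →
         ∃ λ N → ∀ {k} → N ℕ.≤ k → ℚ.∣ seq x k ℚ.- seq y k ∣ ℚ.< ε

fromℚ : ℚ → ℝ
fromℚ q = cauchySeq (λ _ → q) λ ε → 0 , λ _ _ →
  subst (ℚ._< ε) (sym (cong ℚ.∣_∣ (ℚₚ.+-inverseʳ q))) (ℚₚ.positive⁻¹ ε)

fromℤ : ℤ → ℝ
fromℤ z = fromℚ (z ℚ./ 1)

private
  half⁺ : ∀ ε .{{_ : Positive ε}} → Positive (½ ℚ.* ε)
  half⁺ ε = ℚₚ.pos*pos⇒pos ½ ε

  halves : ∀ ε → ½ ℚ.* ε ℚ.+ ½ ℚ.* ε ≡ ε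
  halves ε = begin
    ½ ℚ.* ε ℚ.+ ½ ℚ.* ε ≡⟨ ℚₚ.*-distribʳ-+ ε ½ ½ ⟨
    1ℚ ℚ.* ε            ≡⟨ ℚₚ.*-identityˡ ε ⟩
    ε                   ∎
    where open Relation.Binary.PropositionalEquality.≡-Reasoning

  add-< : ∀ ε {a b} → ℚ.∣ a ∣ ℚ.< ½ ℚ.* ε → ℚ.∣ b ∣ ℚ.< ½ ℚ.* ε → ℚ.∣ a ℚ.+ b ∣ ℚ.< ε
  add-< ε {a} {b} a< b< = begin-strict
    ℚ.∣ a ℚ.+ b ∣         ≤⟨ ℚₚ.∣p+q∣≤∣p∣+∣q∣ a b ⟩
    ℚ.∣ a ∣ ℚ.+ ℚ.∣ b ∣   <⟨ ℚₚ.+-mono-< a< b< ⟩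
    ½ ℚ.* ε ℚ.+ ½ ℚ.* ε   ≡⟨ halves ε ⟩
    ε                     ∎
    where open ℚₚ.≤-Reasoning

  -- an upper bound for the terms of x from some index on
  module Bound (x : ℝ) where
    N₀ : ℕ
    N₀ = proj₁ (cauchy x 1ℚ)

    bound : ℚ
    bound = 1ℚ ℚ.+ ℚ.∣ seq x N₀ ∣

    instance
      bound⁺ : Positive bound
      bound⁺ = ℚₚ.pos+nonNeg⇒pos 1ℚ ℚ.∣ seq x N₀ ∣ {{ℚₚ.∣-∣-nonNeg (seq x N₀)}}

    bounded : ∀ {k} → N₀ ℕ.≤ k → ℚ.∣ seq x k ∣ ℚ.≤ bound
    bounded {k} s≤k = begin
      ℚ.∣ seq x k ∣
        ≡⟨ cong ℚ.∣_∣ (solve 2 (λ a b → a := (a :- b) :+ b) refl (seq x k) (seq x N₀)) ⟩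
      ℚ.∣ (seq x k ℚ.- seq x N₀) ℚ.+ seq x N₀ ∣
        ≤⟨ ℚₚ.∣p+q∣≤∣p∣+∣q∣ (seq x k ℚ.- seq x N₀) (seq x N₀) ⟩
      ℚ.∣ seq x k ℚ.- seq x N₀ ∣ ℚ.+ ℚ.∣ seq x N₀ ∣
        ≤⟨ ℚₚ.+-monoˡ-≤ ℚ.∣ seq x N₀ ∣
             (ℚₚ.<⇒≤ (proj₂ (cauchy x 1ℚ) s≤k ℕₚ.≤-refl)) ⟩
      bound ∎
      where open ℚₚ.≤-Reasoning
            open +-*-Solver

  module Scale (K : ℚ) .{{K⁺ : Positive K}} where
    instance
      K≠0 : ℚ.NonZero K
      K≠0 = ℚₚ.pos⇒nonZero K

      1/K⁺ : Positive (ℚ.1/ K)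
      1/K⁺ = ℚₚ.1/pos⇒pos K

    scaled⁺ : ∀ ε .{{_ : Positive ε}} → Positive (ℚ.1/ K ℚ.* ε)
    scaled⁺ ε = ℚₚ.pos*pos⇒pos (ℚ.1/ K) ε

    mul-< : ∀ ε {a b} → ℚ.∣ a ∣ ℚ.≤ K → ℚ.∣ b ∣ ℚ.< ℚ.1/ K ℚ.* ε → ℚ.∣ a ℚ.* b ∣ ℚ.< ε
    mul-< ε {a} {b} a≤ b< = begin-strict
      ℚ.∣ a ℚ.* b ∣           ≡⟨ ℚₚ.∣p*q∣≡∣p∣*∣q∣ a b ⟩
      ℚ.∣ a ∣ ℚ.* ℚ.∣ b ∣     ≤⟨ ℚₚ.*-monoʳ-≤-nonNeg ℚ.∣ b ∣ {{ℚₚ.∣-∣-nonNeg b}} a≤ ⟩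
      K ℚ.* ℚ.∣ b ∣           <⟨ ℚₚ.*-monoʳ-<-pos K b< ⟩
      K ℚ.* (ℚ.1/ K ℚ.* ε)    ≡⟨ ℚₚ.*-assoc K (ℚ.1/ K) ε ⟨
      K ℚ.* ℚ.1/ K ℚ.* ε      ≡⟨ cong (ℚ._* ε) (ℚₚ.*-inverseʳ K) ⟩
      1ℚ ℚ.* ε                ≡⟨ ℚₚ.*-identityˡ ε ⟩
      ε                       ∎
      where open ℚₚ.≤-Reasoning

infixl 6 _+ᴿ_
_+ᴿ_ : ℝ → ℝ → ℝ
x +ᴿ y = cauchySeq (λ k → seq x k ℚ.+ seq y k) λ ε →
  let instance _ = half⁺ ε
      Nx , x< = cauchy x (½ ℚ.* ε)
      Ny , y< = cauchy y (½ ℚ.* ε)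
  in Nx ℕ.⊔ Ny , λ {j} {k} N≤j N≤k →
     subst (λ d → ℚ.∣ d ∣ ℚ.< ε)
       (solve 4 (λ a b c d → (a :- c) :+ (b :- d) := (a :+ b) :- (c :+ d)) refl
          (seq x j) (seq y j) (seq x k) (seq y k))
       (add-< ε (x< (ℕₚ.m⊔n≤o⇒m≤o Nx Ny N≤j) (ℕₚ.m⊔n≤o⇒m≤o Nx Ny N≤k))
                (y< (ℕₚ.m⊔n≤o⇒n≤o Nx Ny N≤j) (ℕₚ.m⊔n≤o⇒n≤o Nx Ny N≤k)))
  where open +-*-Solver

infixl 7 _*ᴿ_
_*ᴿ_ : ℝ → ℝ → ℝ
x *ᴿ y = cauchySeq (λ k → seq x k ℚ.* seq y k) λ ε →
  let instance _ = half⁺ ε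
      Nx , x< = cauchy x (ℚ.1/ By ℚ.* (½ ℚ.* ε)) {{Sy.scaled⁺ (½ ℚ.* ε)}}
      Ny , y< = cauchy y (ℚ.1/ Bx ℚ.* (½ ℚ.* ε)) {{Sx.scaled⁺ (½ ℚ.* ε)}}
      N₁ = Nx ℕ.⊔ Ny
      N₂ = X.N₀ ℕ.⊔ Y.N₀
  in N₁ ℕ.⊔ N₂ , λ {j} {k} N≤j N≤k →
     let j₁ = ℕₚ.m⊔n≤o⇒m≤o N₁ N₂ N≤j
         j₂ = ℕₚ.m⊔n≤o⇒n≤o N₁ N₂ N≤j
         k₁ = ℕₚ.m⊔n≤o⇒m≤o N₁ N₂ N≤k
         k₂ = ℕₚ.m⊔n≤o⇒n≤o N₁ N₂ N≤k
     in subst (λ d → ℚ.∣ d ∣ ℚ.< ε)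
          (solve 4 (λ a b c d → a :* (b :- d) :+ d :* (a :- c) := a :* b :- c :* d) refl
             (seq x j) (seq y j) (seq x k) (seq y k))
          (add-< ε
            (Sx.mul-< (½ ℚ.* ε) (X.bounded (ℕₚ.m⊔n≤o⇒m≤o X.N₀ Y.N₀ j₂))
              (y< (ℕₚ.m⊔n≤o⇒n≤o Nx Ny j₁) (ℕₚ.m⊔n≤o⇒n≤o Nx Ny k₁)))
            (Sy.mul-< (½ ℚ.* ε) (Y.bounded (ℕₚ.m⊔n≤o⇒n≤o X.N₀ Y.N₀ k₂))
              (x< (ℕₚ.m⊔n≤o⇒m≤o Nx Ny j₁) (ℕₚ.m⊔n≤o⇒m≤o Nx Ny k₁))))
  where
  open +-*-Solver
  module X = Bound x
  module Y = Bound y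
  Bx By : ℚ
  Bx = X.bound
  By = Y.bound
  module Sx = Scale Bx {{X.bound⁺}}
  module Sy = Scale By {{Y.bound⁺}}
  instance
    _ : ℚ.NonZero Bx
    _ = Sx.K≠0
    _ : ℚ.NonZero By
    _ = Sy.K≠0

-- 2×2 matrices, entries listed row by row.

record Mat (X : Set) : Set where
  constructor mat
  field
    e₁₁ e₁₂ e₂₁ e₂₂ : X

mapMat : {X Y : Set} → (X → Y) → Mat X → Mat Y
mapMat f (mat a b c d) = mat (f a) (f b) (f c) (f d)

infixl 6 _+ᴹ_
_+ᴹ_ : Mat ℤ → Mat ℤ → Mat ℤ
mat a b c d +ᴹ mat a′ b′ c′ d′ = mat (a ℤ.+ a′) (b ℤ.+ b′) (c ℤ.+ c′) (d ℤ.+ d′)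

0ᴹ : Mat ℤ
0ᴹ = mat 0ℤ 0ℤ 0ℤ 0ℤ

infixl 7 _*ᴹ_
_*ᴹ_ : Mat ℝ → Mat ℝ → Mat ℝ
mat a b c d *ᴹ mat a′ b′ c′ d′ =
  mat (a *ᴿ a′ +ᴿ b *ᴿ c′) (a *ᴿ b′ +ᴿ b *ᴿ d′)
      (c *ᴿ a′ +ᴿ d *ᴿ c′) (c *ᴿ b′ +ᴿ d *ᴿ d′)

infix 4 _≈ᴹ_
_≈ᴹ_ : Mat ℝ → Mat ℝ → Set
mat a b c d ≈ᴹ mat a′ b′ c′ d′ = a ≈ᴿ a′ × b ≈ᴿ b′ × c ≈ᴿ c′ × d ≈ᴿ d′

data Op : Set where
  f g h : Op

bar : Op → Op
bar f = g
bar g = f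
bar h = h

flipString : List Op → List Op
flipString e = reverse (map bar e)

Square : Set
Square = ℤ × ℤ

infixl 6 _⊞_ _⊟_
_⊞_ _⊟_ : Square → Square → Square
(x , y) ⊞ (x′ , y′) = x ℤ.+ x′ , y ℤ.+ y′
(x , y) ⊟ (x′ , y′) = x ℤ.- x′ , y ℤ.- y′

infixr 7 _·_
_·_ : ℤ → Square → Square
k · (x , y) = k ℤ.* x , k ℤ.* y

-- The pair (p , q) stands for the (p,q)-leaper; (m , n) also for the (m,n)-frame.
Proportions : Set
Proportions = ℕ × ℕ

IsMove : Proportions → Square → Set
IsMove (p , q) (x , y) =
  (ℤ.∣ x ∣ ≡ p × ℤ.∣ y ∣ ≡ q) ⊎ (ℤ.∣ x ∣ ≡ q × ℤ.∣ y ∣ ≡ p)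

Adjacent : Proportions → Square → Square → Set
Adjacent L a b = IsMove L (b ⊟ a)

Basic Skew : Proportions → Set
Basic (p , q) = parity (p ℕ.+ q) ≡ 1ℙ × gcd p q ≡ 1
Skew  (p , q) = p ≢ 0 × q ≢ 0 × p ≢ q

Ascending : Proportions → Set
Ascending (p , q) = p ℕ.< q

-- A cycle is written as the list of its squares in cyclic order.
cyclicPairs : {X : Set} → List X → List (X × X)
cyclicPairs []       = []
cyclicPairs (x ∷ xs) = zip (x ∷ xs) (xs ∷ʳ x)

record IsCycle (L : Proportions) (B : Pred Square 0ℓ) (zs : List Square) : Set where
  field
    long   : 3 ℕ.≤ length zs
    simple : Unique zs
    within : All B zs
    moves  : All (uncurry (Adjacent L)) (cyclicPairs zs)

-- The open box a < 2x < b, c < 2y < d. All bounds of boards and subboards are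
-- half-integers, so that they are given doubled.
Box : (a b c d : ℤ) → Pred Square 0ℓ
Box a b c d (x , y) =
  (a ℤ.< + 2 ℤ.* x × + 2 ℤ.* x ℤ.< b) × (c ℤ.< + 2 ℤ.* y × + 2 ℤ.* y ℤ.< d)

Board : Proportions → Pred Square 0ℓ
Board (p , q) = Box (ℤ.- s) s (ℤ.- s) s
  where s = + (p ℕ.+ q)

-- Directions E, NE, …, SE.
Dir : Set
Dir = Fin 8

infixl 6 _⊕_
_⊕_ : Dir → ℕ → Dir
i ⊕ k = (toℕ i ℕ.+ k) mod 8

-- Counterclockwise rotation by 90°, and its inverse.
ρ ρ⁻¹ : Square → Square
ρ   (x , y) = ℤ.- y , x
ρ⁻¹ (x , y) = y , ℤ.- x

-- The family of eight sets obtained by rotation from those of directions E and NE.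
rotations : (E NE : Pred Square 0ℓ) → ℕ → Pred Square 0ℓ
rotations E NE 0             = E
rotations E NE 1             = NE
rotations E NE (suc (suc i)) = rotations E NE i ∘ ρ⁻¹

Section : Proportions → Dir → Pred Square 0ℓ
Section (m , n) i = rotations
  (Box d s (ℤ.- d) d)
  (Box d s d s)
  (toℕ i)
  where
  d = + n ℤ.- + m
  s = + n ℤ.+ + m

unitVec : ℕ → Square
unitVec 0             = 1ℤ , 0ℤ
unitVec 1             = 1ℤ , 1ℤ
unitVec (suc (suc i)) = ρ (unitVec i)

-- Truncated subtraction is harmless: m < n throughout.
grow : Op → Proportions → Proportions
grow f (m , n) = m , 2 ℕ.* m ℕ.+ n
grow g (m , n) = n , 2 ℕ.* n ℕ.∸ m
grow h (m , n) = n , m ℕ.+ 2 ℕ.* n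

-- Successive growth of the types in e, the last one first.
growAll : List Op → Proportions → Proportions
growAll e F = foldr grow F e

-- The proportions of the leaper and of the frame of descent e.
proportions : List Op → Proportions
proportions e = growAll e (1 , 2)

offset : Op → Proportions → Parity → ℤ
offset f (m , n) 0ℙ = + m ℤ.+ + n
offset f (m , n) 1ℙ = + m
offset g (m , n) 0ℙ = + n ℤ.- + m
offset g (m , n) 1ℙ = + n
offset h (m , n) 0ℙ = + m ℤ.+ + n
offset h (m , n) 1ℙ = + n

shift : Op → Proportions → Dir → Square
shift t F i = offset t F (parity (toℕ i)) · unitVec (toℕ i)

lift : Op → Proportions → Pred Square 0ℓ → Pred Square 0ℓ
lift t F S z = ∃ λ i → S (z ⊟ shift t F i) × Section (grow t F) i z

liftAll : List Op → Proportions → Pred Square 0ℓ → Pred Square 0ℓ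
liftAll []      F S = S
liftAll (t ∷ e) F S = lift t (growAll e F) (liftAll e F S)

-- For n > 3m the shell is undefined; here it is then empty.
Shell : Proportions → Pred Square 0ℓ
Shell (m , n) z =
  (n ℕ.≤ 2 ℕ.* m × ∃ λ (i : Dir) → rotations
    (Box d (d ℤ.+ + 2 ℤ.* d) (ℤ.- d) d)
    (Box (s ℤ.- + 2 ℤ.* d) s (s ℤ.- + 2 ℤ.* d) s)
    (toℕ i) z)
  ⊎ (2 ℕ.* m ℕ.≤ n × n ℕ.≤ 3 ℕ.* m × ∃ λ (i : Dir) → rotations
    (Box (s ℤ.- + 2 ℤ.* k) s (ℤ.- k) k)
    (Box d (d ℤ.+ + 2 ℤ.* k) d (d ℤ.+ + 2 ℤ.* k))
    (toℕ i) z)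
  where
  d = + n ℤ.- + m
  s = + n ℤ.+ + m
  k = + (3 ℕ.* m) ℤ.- + n

record IsShellCycle (F : Proportions) (zs : List Square) : Set where
  field
    isCycle  : IsCycle F (Board F) zs
    eight    : length zs ≡ 8
    inShell  : All (Shell F) zs

-- A cycle of descent e; the descent of its leaper is e ++ rest.
record CycleOfDescent (e : List Op) : Set where
  field
    leaper    : Proportions
    basic     : Basic leaper
    skew      : Skew leaper
    ascending : Ascending leaper
    rest      : List Op
    descent   : proportions (e ++ rest) ≡ leaper
    squares   : List Square
    isCycle   : IsCycle leaper (Board leaper) squares
    -- the shell cycle C′ from which the cycle is lifted
    core      : List Square
    isShell   : IsShellCycle (proportions rest) core
    -- a cycle within the board is determined by its vertex set
    lifted    : (_∈ squares) ≐ liftAll e (proportions rest) (_∈ core)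

-- The eight paths a₀, …, a₇ of a cycle, the i-th one within section i.
Paths : Set
Paths = Dir → List Square

backwards : Paths → Dir → List ℕ → List Square
backwards a i ks = concat (map (λ k → reverse (a (i ⊕ k))) ks)

pieces : Op → Parity → Paths → Paths
pieces f 0ℙ a i = backwards a i (5 ∷ 4 ∷ 3 ∷ [])
pieces f 1ℙ a i = a i
pieces g 0ℙ a i = a i
pieces g 1ℙ a i = backwards a i (5 ∷ 4 ∷ 3 ∷ [])
pieces h 0ℙ a i = backwards a i (6 ∷ 5 ∷ 4 ∷ 3 ∷ 2 ∷ [])
-- i ⊕ 7 is i - 1 modulo 8
pieces h 1ℙ a i = a (i ⊕ 7) ++ a i ++ a (i ⊕ 1)

liftPaths : Op → Proportions → Paths → Paths
liftPaths t F a i = map (_⊞ shift t F i) (pieces t (parity (toℕ i)) a i)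

liftAllPaths : List Op → Proportions → Paths → Paths
liftAllPaths []      F a = a
liftAllPaths (t ∷ e) F a = liftPaths t (growAll e F) (liftAllPaths e F a)

-- The canonical second leaper, in terms of the string left after the descent of a cycle.
secondLeaper : List Op → Proportions
secondLeaper []      = 0 , 1
secondLeaper (_ ∷ e) = proportions e

record CanonicalSecondCycle {e : List Op} (C : CycleOfDescent e) : Set where
  open CycleOfDescent C
  second : Proportions
  second = secondLeaper rest
  field
    base        : Dir → Square
    base∈core   : ∀ i → base i ∈ core
    inSection   : ∀ i → Section (proportions rest) i (base i)
    baseIsCycle : IsCycle second (_∈ core) (tabulate base)
  path : List Square
  path = concat (tabulate (liftAllPaths e (proportions rest) (λ i → [ base i ])))
  field
    isCycle     : IsCycle second (_∈ squares) path

-- The skew directions 1, …, 8, numbered from 0.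
Label : Set
Label = Fin 8

A₁₋₄ : Fin 4 → Mat ℤ
A₁₋₄ 0F = mat 0ℤ 1ℤ
              1ℤ 0ℤ
A₁₋₄ 1F = mat 1ℤ 0ℤ
              0ℤ 1ℤ
A₁₋₄ 2F = mat (ℤ.- 1ℤ) 0ℤ
              0ℤ       1ℤ
A₁₋₄ 3F = mat 0ℤ (ℤ.- 1ℤ)
              1ℤ 0ℤ

A : Label → Mat ℤ
A i = [ A₁₋₄ , mapMat ℤ.-_ ∘ A₁₋₄ ]′ (splitAt 4 i)

apply : Mat ℤ → Proportions → Square
apply (mat a b c d) (r , s) = a ℤ.* + r ℤ.+ b ℤ.* + s , c ℤ.* + r ℤ.+ d ℤ.* + s

HasDirection : Proportions → Square → Label → Set
HasDirection M v i = v ≡ apply (A i) M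

record LabelledDigraph : Set₁ where
  field
    Vertex : Set
    Arc    : Vertex → Label → Vertex → Set

open LabelledDigraph public

-- Walk Φ a vs is b: a walk from a to b along arcs labelled is; vs lists its vertices
-- except the last one.
data Walk (Φ : LabelledDigraph) : Vertex Φ → List (Vertex Φ) → List Label → Vertex Φ → Set where
  []  : ∀ {a} → Walk Φ a [] [] a
  _∷_ : ∀ {a b c i vs is} → Arc Φ a i b → Walk Φ b vs is c → Walk Φ a (a ∷ vs) (i ∷ is) c

record IsDirectionGraph (Φ : LabelledDigraph) : Set where
  field
    symmetric : ∀ {a i b} → Arc Φ a i b → ∃ λ j → Arc Φ b j a
    zeroSum   : ∀ {a vs is} → Walk Φ a vs is a → Unique vs →
                foldr _+ᴹ_ 0ᴹ (map A is) ≡ 0ᴹ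

-- Sameness of direction graphs.
infix 4 _≅_
record _≅_ (Φ Ψ : LabelledDigraph) : Set where
  field
    bijection : Vertex Φ ↔ Vertex Ψ
  open Inverse bijection using (to)
  field
    arcs      : ∀ a i b → Arc Φ a i b ⇔ Arc Ψ (to a) i (to b)

extract : Proportions → List Square → LabelledDigraph
extract M zs = record
  { Vertex = Σ Square (_∈ zs)
  ; Arc    = λ (a , _) i (b , _) →
      ((a , b) ∈ cyclicPairs zs ⊎ (b , a) ∈ cyclicPairs zs) × HasDirection M (b ⊟ a) i
  }

-- Φ is Φ(e).
record IsFundamental (e : List Op) (Φ : LabelledDigraph) : Set where
  field
    cycle            : CycleOfDescent e
  open CycleOfDescent cycle
  field
    isDirectionGraph : IsDirectionGraph Φ
    extracted        : Φ ≅ extract leaper squares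

-- Φ is Φᴵᴵ of origin o and descent e.
record IsSecondFundamental (o : Op) (e : List Op) (Φ : LabelledDigraph) : Set where
  field
    cycle            : CycleOfDescent e
    secondCycle      : CanonicalSecondCycle cycle
  open CycleOfDescent cycle
  open CanonicalSecondCycle secondCycle
  field
    t                : List Op
    origin           : rest ≡ o ∷ t
    basic₂           : Basic second
    skew₂            : Skew second
    isDirectionGraph : IsDirectionGraph Φ
    extracted        : Φ ≅ extract second path

relabel : Permutation′ 8 → LabelledDigraph → LabelledDigraph
relabel π Φ = record
  { Vertex = Vertex Φ
  ; Arc    = λ a j b → ∃ λ i → π ⟨$⟩ʳ i ≡ j × Arc Φ a i b
  }

Aᴿ : Label → Mat ℝ
Aᴿ = mapMat fromℤ ∘ A

IsEquivalencePermutation : Permutation′ 8 → Set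
IsEquivalencePermutation π = ∃ λ P → ∃ λ Q → ∀ i → Aᴿ (π ⟨$⟩ʳ i) ≈ᴹ P *ᴹ Aᴿ i *ᴹ Q

Equivalent : LabelledDigraph → LabelledDigraph → Set
Equivalent Φ Ψ = ∃ λ π → IsEquivalencePermutation π × relabel π Φ ≅ Ψ

module Submission where

-- Both cycles are walks on an octagon. From a square in a given section of a frame exactly two
-- moves of the leaper of the frame lead to squares in sections (degree-two), and the eight moves
-- can be labelled by the integers modulo 8 in such a way that consecutive moves along a cycle
-- have labels that differ by one. The same is true of the moves of the second leaper along a
-- canonical second leaper cycle. A cycle is then known, up to its position, from the label of
-- one move and the cyclic word of its turns ↑ and ↓ (label increased, label decreased), and two
-- cycles of the same word give direction graphs that differ by a relabelling (Assemble.iso).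
--
-- Lifting a cycle within a frame replaces each turn by a block of turns. Which block depends on
-- the kind, u or v, of the turn, and the replacement is the substitution Γ (copyFacts,
-- siteFacts, liftFirst). So the word of a cycle of descent e′ is obtained from that of a shell
-- cycle, (uv)⁴, by the substitutions for the characters of e′, the last one first. Splitting off
-- the substitution that is applied first, one gets a recursion for the images of u and v: they
-- are built by concatenation and negation from those for the string without its last character
-- (u-f, …, v-h). On the other hand, the eight paths that make up a canonical second leaper cycle of
-- descent e″ have only two different words, U₀ and U₁, depending on the parity of the section,
-- and the rules for lifting are a recursion for these on the first character of e″. As e″ is the
-- flip of e′, the two recursions run in parallel. They do not have the same form: the
-- first one negates whole words, the second one all but the two end turns of a product. Still,
-- the words they produce are conjugate. This is the heart of the proof: there is a word y such that,
-- for one of the two assignments of a, b to u, v (with X, Y the corresponding U's),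
--   a = y X ỹ,   Y = ỹ b y,
-- where ỹ is y reversed, and X ỹ is ỹ b with all turns but the first negated. These conditions
-- (Conjugated) reproduce themselves under all steps of the recursions (aligned), and they imply
-- that (u v)⁴ and (U₀ U₁)⁴ are rotations of each other, the labels being in agreement (Align).
--
-- That the squares are where the words say is a matter of identities and inequalities between
-- linear forms in the proportions m < n of a frame, and there are finitely many of them. They
-- are checked by evaluation: a form is nonnegative as soon as its coefficients in terms of m and
-- n - m are. The equivalence permutations that relate the labels of the three graphs are finally
-- given by explicit matrices; they involve multiplication by a multiple of the matrix of a reflection
-- in a line at 22.5° to an axis.

open import Defs
open import Data.Bool.Base using (Bool; true; false; not)
open import Data.Empty using (⊥; ⊥-elim)
open import Data.Fin.Base using (toℕ)
open import Data.Fin.Patterns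
open import Data.Fin.Permutation
  using (Permutation′; permutation; _⟨$⟩ʳ_; _⟨$⟩ˡ_; inverseʳ; inverseˡ; _∘ₚ_; flip)
open import Data.Fin.Properties using (all?) renaming (_≟_ to _≟ᶠ_)
open import Data.Integer.Base as ℤ using (ℤ; +_; 0ℤ; 1ℤ; -1ℤ)
import Data.Integer.Properties as ℤₚ
open import Data.Integer.Tactic.RingSolver using (solve-∀)
open import Data.List.Base
  using (List; []; _∷_; [_]; _++_; _∷ʳ_; concat; concatMap; foldr; length; map; reverse; tabulate; zip)
open import Data.List.Membership.DecPropositional (_≟ᶠ_ {8}) using (_∈?_)
open import Data.List.Membership.Propositional using (_∈_; find; lose)
open import Data.List.Membership.Propositional.Properties
  using (∈-map⁺; ∈-map⁻; ∈-++⁺ˡ; ∈-++⁺ʳ; ∈-++⁻; ∈-∃++; ∈-concatMap⁺; ∈-concatMap⁻)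
open import Data.List.Membership.Propositional.Properties.WithK using (unique⇒irrelevant)
open import Data.List.Properties
  using (++-assoc; ++-identityʳ; ++-monoid; concatMap-++; foldr-++; length-++; length-map; map-++;
         map-∘; map-id; map-cong; reverse-++; reverse-map; reverse-involutive; unfold-reverse;
         ∷-injective; ∷-injectiveʳ)
open import Data.List.Relation.Binary.Disjoint.Propositional using (Disjoint)
open import Data.List.Relation.Unary.All as All using (All; []; _∷_)
import Data.List.Relation.Unary.All.Properties as Allₚ
open import Data.List.Relation.Unary.AllPairs using ([]; _∷_)
open import Data.List.Relation.Unary.Any using (here; there)
open import Data.List.Relation.Unary.Unique.DecPropositional (_≟ᶠ_ {8}) using (unique?)
open import Data.List.Relation.Unary.Unique.Propositional using (Unique)
import Data.List.Relation.Unary.Unique.Propositional.Properties as Uniqueₚ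
open import Data.Nat.Base as ℕ using (ℕ; suc; parity; s≤s)
open import Data.Nat.DivMod using (_mod_)
import Data.Nat.Properties as ℕₚ
open import Data.Parity.Base using (Parity; 0ℙ; 1ℙ)
open import Data.Product.Base as Product using (Σ; ∃; ∃₂; _×_; _,_; proj₁; proj₂)
open import Data.Rational.Base as ℚ using (ℚ; 0ℚ; 1ℚ; ½)
import Data.Rational.Properties as ℚₚ
open import Data.Sum.Base as Sum using (_⊎_; inj₁; inj₂; [_,_]′)
open import Data.Unit.Base using (⊤; tt)
open import Function.Bundles using (_↔_; _⇔_; Inverse; Equivalence; mk↔ₛ′; mk⇔)
open import Function.Construct.Composition using (_↔-∘_)
open import Function.Construct.Symmetry using (↔-sym)
open import Level using (0ℓ)
open import Relation.Binary.PropositionalEquality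
  using (_≡_; _≢_; refl; sym; trans; cong; cong₂; subst; subst₂; module ≡-Reasoning)
open import Relation.Nullary.Decidable using (Dec; yes; no; _×-dec_; _⊎-dec_)
open import Relation.Nullary.Decidable.Core using (from-yes)
open import Relation.Unary using (Pred)
open import Tactic.MonoidSolver using (solve)

-- A statement about all labels, or about all directions, from its eight instances.
∀₈ : {P : Label → Set} → P 0F → P 1F → P 2F → P 3F → P 4F → P 5F → P 6F → P 7F → ∀ i → P i
∀₈ p₀ p₁ p₂ p₃ p₄ p₅ p₆ p₇ = λ where
  0F → p₀
  1F → p₁
  2F → p₂
  3F → p₃
  4F → p₄
  5F → p₅
  6F → p₆
  7F → p₇

-- Words of turns

-- A turn of a walk on the octagon: ↑ increases the label by one, ↓ decreases it by one.
data Turn : Set where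
  ↑ ↓ : Turn

neg : Turn → Turn
neg ↑ = ↓
neg ↓ = ↑

neg-involutive : ∀ ε → neg (neg ε) ≡ ε
neg-involutive ↑ = refl
neg-involutive ↓ = refl

Word : Set
Word = List Turn

negs : Word → Word
negs = map neg

negs-involutive : ∀ w → negs (negs w) ≡ w
negs-involutive w = begin
  negs (negs w)                 ≡⟨ map-∘ w ⟨
  map (λ ε → neg (neg ε)) w     ≡⟨ map-cong neg-involutive w ⟩
  map (λ ε → ε) w               ≡⟨ map-id w ⟩
  w                             ∎
  where open ≡-Reasoning

reverse-negs : ∀ w → reverse (negs w) ≡ negs (reverse w)
reverse-negs w = sym (reverse-map neg w)

Palindrome : Word → Set
Palindrome w = reverse w ≡ w

rev₃ : ∀ (a b c : Word) → reverse (a ++ b ++ c) ≡ reverse c ++ reverse b ++ reverse a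
rev₃ a b c = begin
  reverse (a ++ b ++ c)                 ≡⟨ reverse-++ a (b ++ c) ⟩
  reverse (b ++ c) ++ reverse a         ≡⟨ cong (_++ reverse a) (reverse-++ b c) ⟩
  (reverse c ++ reverse b) ++ reverse a ≡⟨ ++-assoc (reverse c) (reverse b) (reverse a) ⟩
  reverse c ++ reverse b ++ reverse a   ∎
  where open ≡-Reasoning

negs₃ : ∀ a b c → negs (a ++ b ++ c) ≡ negs a ++ negs b ++ negs c
negs₃ a b c = trans (map-++ neg a (b ++ c)) (cong (negs a ++_) (map-++ neg b c))

assoc₃ : ∀ (a b c d : Word) → (a ++ b ++ c) ++ d ≡ a ++ b ++ c ++ d
assoc₃ a b c d = trans (++-assoc a (b ++ c) d) (cong (a ++_) (++-assoc b c d))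

infix 8 _◃_
-- a ◃ b is the word aba.
_◃_ : Word → Word → Word
a ◃ b = a ++ b ++ a

palindrome-◃ : ∀ {a b} → Palindrome a → Palindrome b → Palindrome (a ◃ b)
palindrome-◃ {a} {b} pa pb = trans (rev₃ a b a) (cong₂ (λ x y → x ++ y ++ x) pa pb)

palindrome-negs : ∀ {a} → Palindrome a → Palindrome (negs a)
palindrome-negs {a} pa = trans (reverse-negs a) (cong negs pa)

palindrome-around : ∀ y {b} → Palindrome b → Palindrome (y ++ b ++ reverse y)
palindrome-around y {b} pb =
  trans (rev₃ y b (reverse y)) (cong₂ (λ x z → x ++ z ++ reverse y) (reverse-involutive y) pb)

palindrome-around′ : ∀ y {b} → Palindrome b → Palindrome (reverse y ++ b ++ y)
palindrome-around′ y {b} pb =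
  trans (rev₃ (reverse y) b y) (cong₂ (λ x z → reverse y ++ x ++ z) pb (reverse-involutive y))

-- With V = ↑ ∷ S a palindrome, ↑ ∷ sandwich S M is the word V M V with all turns but the first
-- and the last one negated. Words that begin with ↑ are handled through their tails.
sandwich : Word → Word → Word
sandwich S M = negs (S ++ M ++ reverse S) ++ [ ↑ ]

-- The words ab and XY, where X = ↑ ∷ S and Y = ↑ ∷ T, are conjugate by the word y, in such a
-- way that X ỹ and ỹ b agree in their first turn, ↑, and are opposite in all others.
record Conjugated (a b S T : Word) : Set where
  constructor conjugated
  field
    y n : Word
    a≡  : a ≡ y ++ (↑ ∷ S) ++ reverse y
    Y≡  : ↑ ∷ T ≡ reverse y ++ b ++ y
    S≡  : S ++ reverse y ≡ negs n
    b≡  : reverse y ++ b ≡ ↑ ∷ n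
    palX : Palindrome (↑ ∷ S)
    palb : Palindrome b

module Steps {a b S T : Word} (R : Conjugated a b S T) where
  open Conjugated R public
  private
    X Y ỹ : Word
    X = ↑ ∷ S
    Y = ↑ ∷ T
    ỹ = reverse y
    open ≡-Reasoning
    M = ++-monoid Turn

  pal-a : Palindrome a
  pal-a = subst Palindrome (sym a≡) (palindrome-around y palX)

  pal-Y : Palindrome Y
  pal-Y = subst Palindrome (sym Y≡) (palindrome-around′ y palb)

  -- As Y = (ỹ b) y and ỹ b = ↑ n.
  T≡ : T ≡ n ++ y
  T≡ = ∷-injectiveʳ (begin
    ↑ ∷ T          ≡⟨ Y≡ ⟩
    ỹ ++ b ++ y    ≡⟨ ++-assoc ỹ b y ⟨
    (ỹ ++ b) ++ y  ≡⟨ cong (_++ y) b≡ ⟩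
    ↑ ∷ n ++ y     ∎)

  Xỹ : X ++ ỹ ≡ ↑ ∷ negs n
  Xỹ = cong (↑ ∷_) S≡

  by : b ++ y ≡ reverse n ++ [ ↑ ]
  by = begin
    b ++ y                  ≡⟨ cong₂ _++_ palb (reverse-involutive y) ⟨
    reverse b ++ reverse ỹ  ≡⟨ reverse-++ ỹ b ⟨
    reverse (ỹ ++ b)        ≡⟨ cong reverse b≡ ⟩
    reverse (↑ ∷ n)         ≡⟨ unfold-reverse ↑ n ⟩
    reverse n ++ [ ↑ ]      ∎

  yX : y ++ X ≡ negs (reverse n) ++ [ ↑ ]
  yX = begin
    y ++ X                      ≡⟨ cong₂ _++_ (reverse-involutive y) palX ⟨
    reverse ỹ ++ reverse X      ≡⟨ reverse-++ X ỹ ⟨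
    reverse (X ++ ỹ)            ≡⟨ cong reverse Xỹ ⟩
    reverse (↑ ∷ negs n)        ≡⟨ unfold-reverse ↑ (negs n) ⟩
    reverse (negs n) ++ [ ↑ ]   ≡⟨ cong (_++ [ ↑ ]) (reverse-negs n) ⟩
    negs (reverse n) ++ [ ↑ ]   ∎

  -- The lemma behind the two steps in which yX takes the place of y.
  viaY : ∀ {a′ S′} w Z → w ≡ y ++ Z ++ ỹ → Palindrome w → Palindrome (↑ ∷ S′) →
         a′ ≡ (y ++ X) ++ (↑ ∷ S′) ++ (X ++ ỹ) → S′ ++ (X ++ ỹ) ≡ n ++ w →
         Conjugated a′ (negs w) S′ (sandwich T Z)
  viaY {a′} {S′} w Z w≡ palw palX′ a′≡ S′≡ =
    conjugated (y ++ X) (negs n ++ negs w)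
      (trans a′≡ (cong (λ t → (y ++ X) ++ (↑ ∷ S′) ++ t) (sym r))) eq₂ eq₃ eq₄
      palX′ (palindrome-negs palw)
    where
    r : reverse (y ++ X) ≡ X ++ ỹ
    r = trans (reverse-++ y X) (cong (_++ ỹ) palX)
    core≡ : T ++ Z ++ reverse T ≡ n ++ w ++ reverse n
    core≡ = begin
      T ++ Z ++ reverse T                   ≡⟨ cong (λ t → t ++ Z ++ reverse t) T≡ ⟩
      (n ++ y) ++ Z ++ reverse (n ++ y)     ≡⟨ cong (λ t → (n ++ y) ++ Z ++ t) (reverse-++ n y) ⟩
      (n ++ y) ++ Z ++ (ỹ ++ reverse n)     ≡⟨ lem n y Z ỹ (reverse n) ⟩
      n ++ (y ++ Z ++ ỹ) ++ reverse n       ≡⟨ cong (λ t → n ++ t ++ reverse n) w≡ ⟨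
      n ++ w ++ reverse n                   ∎
      where
      lem : ∀ n y X z m → (n ++ y) ++ X ++ (z ++ m) ≡ n ++ (y ++ X ++ z) ++ m
      lem n y X z m = solve M
    eq₂ : ↑ ∷ sandwich T Z ≡ reverse (y ++ X) ++ negs w ++ (y ++ X)
    eq₂ = begin
      ↑ ∷ negs (T ++ Z ++ reverse T) ++ [ ↑ ]
        ≡⟨ cong (λ t → ↑ ∷ negs t ++ [ ↑ ]) core≡ ⟩
      ↑ ∷ negs (n ++ w ++ reverse n) ++ [ ↑ ]
        ≡⟨ cong (λ t → ↑ ∷ t ++ [ ↑ ]) (negs₃ n w (reverse n)) ⟩
      ↑ ∷ (negs n ++ negs w ++ negs (reverse n)) ++ [ ↑ ]
        ≡⟨ cong (↑ ∷_) (assoc₃ (negs n) (negs w) (negs (reverse n)) [ ↑ ]) ⟩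
      (↑ ∷ negs n) ++ negs w ++ (negs (reverse n) ++ [ ↑ ])
        ≡⟨ cong₂ (λ p q → p ++ negs w ++ q) Xỹ yX ⟨
      (X ++ ỹ) ++ negs w ++ (y ++ X)
        ≡⟨ cong (λ p → p ++ negs w ++ (y ++ X)) r ⟨
      reverse (y ++ X) ++ negs w ++ (y ++ X) ∎
    eq₃ : S′ ++ reverse (y ++ X) ≡ negs (negs n ++ negs w)
    eq₃ = begin
      S′ ++ reverse (y ++ X)           ≡⟨ cong (S′ ++_) r ⟩
      S′ ++ (X ++ ỹ)                   ≡⟨ S′≡ ⟩
      n ++ w                           ≡⟨ negs-involutive (n ++ w) ⟨
      negs (negs (n ++ w))             ≡⟨ cong negs (map-++ neg n w) ⟩
      negs (negs n ++ negs w)          ∎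
    eq₄ : reverse (y ++ X) ++ negs w ≡ ↑ ∷ (negs n ++ negs w)
    eq₄ = cong (_++ negs w) (trans r Xỹ)

  -- The lemma behind the two steps in which b y takes the place of y.
  viaX : ∀ {a′ S′} w Z → Z ≡ ỹ ++ w ++ y → Palindrome w → Palindrome (↑ ∷ S′) →
         a′ ≡ (b ++ y) ++ (↑ ∷ S′) ++ (ỹ ++ b) → S′ ++ (ỹ ++ b) ≡ negs n ++ w →
         Conjugated a′ (negs w) S′ (sandwich S Z)
  viaX {a′} {S′} w Z Z≡ palw palX′ a′≡ S′≡ =
    conjugated (b ++ y) (n ++ negs w)
      (trans a′≡ (cong (λ t → (b ++ y) ++ (↑ ∷ S′) ++ t) (sym r))) eq₂ eq₃ eq₄
      palX′ (palindrome-negs palw)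
    where
    r : reverse (b ++ y) ≡ ỹ ++ b
    r = trans (reverse-++ b y) (cong (ỹ ++_) palb)
    y-revS : y ++ reverse S ≡ negs (reverse n)
    y-revS = begin
      y ++ reverse S               ≡⟨ cong (_++ reverse S) (reverse-involutive y) ⟨
      reverse ỹ ++ reverse S       ≡⟨ reverse-++ S ỹ ⟨
      reverse (S ++ ỹ)             ≡⟨ cong reverse S≡ ⟩
      reverse (negs n)             ≡⟨ reverse-negs n ⟩
      negs (reverse n)             ∎
    core≡ : S ++ Z ++ reverse S ≡ negs n ++ w ++ negs (reverse n)
    core≡ = begin
      S ++ Z ++ reverse S                   ≡⟨ cong (λ t → S ++ t ++ reverse S) Z≡ ⟩
      S ++ (ỹ ++ w ++ y) ++ reverse S       ≡⟨ lem S ỹ w y (reverse S) ⟩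
      (S ++ ỹ) ++ w ++ (y ++ reverse S)     ≡⟨ cong₂ (λ p q → p ++ w ++ q) S≡ y-revS ⟩
      negs n ++ w ++ negs (reverse n)       ∎
      where
      lem : ∀ n y X z m → n ++ (y ++ X ++ z) ++ m ≡ (n ++ y) ++ X ++ (z ++ m)
      lem n y X z m = solve M
    eq₂ : ↑ ∷ sandwich S Z ≡ reverse (b ++ y) ++ negs w ++ (b ++ y)
    eq₂ = begin
      ↑ ∷ negs (S ++ Z ++ reverse S) ++ [ ↑ ]
        ≡⟨ cong (λ t → ↑ ∷ negs t ++ [ ↑ ]) core≡ ⟩
      ↑ ∷ negs (negs n ++ w ++ negs (reverse n)) ++ [ ↑ ]
        ≡⟨ cong (λ t → ↑ ∷ t ++ [ ↑ ]) (negs₃ (negs n) w (negs (reverse n))) ⟩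
      ↑ ∷ (negs (negs n) ++ negs w ++ negs (negs (reverse n))) ++ [ ↑ ]
        ≡⟨ cong₂ (λ p q → ↑ ∷ (p ++ negs w ++ q) ++ [ ↑ ])
             (negs-involutive n) (negs-involutive (reverse n)) ⟩
      ↑ ∷ (n ++ negs w ++ reverse n) ++ [ ↑ ]
        ≡⟨ cong (↑ ∷_) (assoc₃ n (negs w) (reverse n) [ ↑ ]) ⟩
      (↑ ∷ n) ++ negs w ++ (reverse n ++ [ ↑ ])
        ≡⟨ cong₂ (λ p q → p ++ negs w ++ q) b≡ by ⟨
      (ỹ ++ b) ++ negs w ++ (b ++ y)
        ≡⟨ cong (λ p → p ++ negs w ++ (b ++ y)) r ⟨
      reverse (b ++ y) ++ negs w ++ (b ++ y) ∎
    eq₃ : S′ ++ reverse (b ++ y) ≡ negs (n ++ negs w)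
    eq₃ = begin
      S′ ++ reverse (b ++ y)           ≡⟨ cong (S′ ++_) r ⟩
      S′ ++ (ỹ ++ b)                   ≡⟨ S′≡ ⟩
      negs n ++ w                      ≡⟨ cong (negs n ++_) (negs-involutive w) ⟨
      negs n ++ negs (negs w)          ≡⟨ map-++ neg n (negs w) ⟨
      negs (n ++ negs w)               ∎
    eq₄ : reverse (b ++ y) ++ negs w ≡ ↑ ∷ (n ++ negs w)
    eq₄ = cong (_++ negs w) (trans r b≡)

  bab≡ : b ◃ a ≡ (b ++ y) ++ X ++ (ỹ ++ b)
  bab≡ = trans (cong (b ◃_) a≡) (lem b y X ỹ)
    where
    lem : ∀ b y X z → b ++ (y ++ X ++ z) ++ b ≡ (b ++ y) ++ X ++ (z ++ b)
    lem b y X z = solve M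

  aba≡ : a ◃ b ≡ (y ++ X) ++ Y ++ (X ++ ỹ)
  aba≡ = begin
    a ◃ b                                   ≡⟨ cong (_◃ b) a≡ ⟩
    (y ++ X ++ ỹ) ++ b ++ (y ++ X ++ ỹ)     ≡⟨ lem y X ỹ b ⟩
    (y ++ X) ++ (ỹ ++ b ++ y) ++ (X ++ ỹ)   ≡⟨ cong (λ p → (y ++ X) ++ p ++ (X ++ ỹ)) Y≡ ⟨
    (y ++ X) ++ Y ++ (X ++ ỹ)               ∎
    where
    lem : ∀ y X z b → (y ++ X ++ z) ++ b ++ (y ++ X ++ z) ≡ (y ++ X) ++ (z ++ b ++ y) ++ (X ++ z)
    lem y X z b = solve M

  n-yXỹ : T ++ (X ++ ỹ) ≡ n ++ a
  n-yXỹ = begin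
    T ++ (X ++ ỹ)          ≡⟨ cong (_++ (X ++ ỹ)) T≡ ⟩
    (n ++ y) ++ (X ++ ỹ)   ≡⟨ ++-assoc n y (X ++ ỹ) ⟩
    n ++ (y ++ X ++ ỹ)     ≡⟨ cong (n ++_) a≡ ⟨
    n ++ a                 ∎

  -- The four steps of the recursions. In each of them the new b is the negative of a word or of a
  -- product, and the new Y a product with all but its end turns negated.
  conjugated-aba : Conjugated (a ◃ b) (negs a) T (sandwich T X)
  conjugated-aba = viaY a X a≡ pal-a pal-Y aba≡ n-yXỹ

  conjugated-bab : Conjugated (b ◃ a) (negs b) S (sandwich S Y)
  conjugated-bab = viaX b Y Y≡ palb palX bab≡
    (trans (sym (++-assoc S ỹ b)) (cong (_++ b) S≡))

  conjugated-babab : Conjugated (b ◃ (a ◃ b)) (negs (b ◃ a)) (S ++ Y ++ X) (sandwich S (Y ◃ X))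
  conjugated-babab = viaX (b ◃ a) (Y ◃ X) eq₁ (palindrome-◃ palb pal-a) (palindrome-◃ {X} {Y} palX pal-Y) eq₂ eq₃
    where
    eq₁ : Y ◃ X ≡ ỹ ++ b ◃ a ++ y
    eq₁ = begin
      Y ◃ X                                   ≡⟨ cong (_◃ X) Y≡ ⟩
      (ỹ ++ b ++ y) ++ X ++ (ỹ ++ b ++ y)     ≡⟨ lem ỹ b y X ⟩
      ỹ ++ b ◃ (y ++ X ++ ỹ) ++ y             ≡⟨ cong (λ p → ỹ ++ b ◃ p ++ y) a≡ ⟨
      ỹ ++ b ◃ a ++ y                         ∎
      where
      lem : ∀ z b y X → (z ++ b ++ y) ++ X ++ (z ++ b ++ y) ≡ z ++ (b ++ (y ++ X ++ z) ++ b) ++ y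
      lem z b y X = solve M
    eq₂ : b ◃ (a ◃ b) ≡ (b ++ y) ++ X ◃ Y ++ (ỹ ++ b)
    eq₂ = begin
      b ◃ (a ◃ b)                                     ≡⟨ cong (b ◃_) aba≡ ⟩
      b ◃ ((y ++ X) ++ Y ++ (X ++ ỹ))                 ≡⟨ lem b y X Y ỹ ⟩
      (b ++ y) ++ X ◃ Y ++ (ỹ ++ b)                   ∎
      where
      lem : ∀ b y X Y z → b ++ ((y ++ X) ++ Y ++ (X ++ z)) ++ b ≡ (b ++ y) ++ (X ++ Y ++ X) ++ (z ++ b)
      lem b y X Y z = solve M
    eq₃ : (S ++ Y ++ X) ++ (ỹ ++ b) ≡ negs n ++ b ◃ a
    eq₃ = begin
      (S ++ Y ++ X) ++ (ỹ ++ b)               ≡⟨ cong (λ p → (S ++ p ++ X) ++ (ỹ ++ b)) Y≡ ⟩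
      (S ++ (ỹ ++ b ++ y) ++ X) ++ (ỹ ++ b)   ≡⟨ lem S ỹ b y X ⟩
      (S ++ ỹ) ++ b ◃ (y ++ X ++ ỹ)           ≡⟨ cong₂ (λ p q → p ++ b ◃ q) (sym S≡) a≡ ⟨
      negs n ++ b ◃ a                         ∎
      where
      lem : ∀ S z b y X → (S ++ (z ++ b ++ y) ++ X) ++ (z ++ b) ≡ (S ++ z) ++ (b ++ (y ++ X ++ z) ++ b)
      lem S z b y X = solve M

  conjugated-ababa : Conjugated (a ◃ (b ◃ a)) (negs (a ◃ b)) (T ++ X ++ Y) (sandwich T (X ◃ Y))
  conjugated-ababa = viaY (a ◃ b) (X ◃ Y) eq₁ (palindrome-◃ pal-a palb) (palindrome-◃ {Y} {X} pal-Y palX) eq₂ eq₃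
    where
    eq₁ : a ◃ b ≡ y ++ X ◃ Y ++ ỹ
    eq₁ = trans aba≡ (lem y X Y ỹ)
      where
      lem : ∀ y X Y z → (y ++ X) ++ Y ++ (X ++ z) ≡ y ++ (X ++ Y ++ X) ++ z
      lem y X Y z = solve M
    eq₂ : a ◃ (b ◃ a) ≡ (y ++ X) ++ Y ◃ X ++ (X ++ ỹ)
    eq₂ = begin
      a ◃ (b ◃ a)                                     ≡⟨ cong₂ (λ p q → p ++ (b ++ p ++ b) ++ q) a≡ a≡ ⟩
      (y ++ X ++ ỹ) ++ (b ++ (y ++ X ++ ỹ) ++ b) ++ (y ++ X ++ ỹ) ≡⟨ lem y X ỹ b ⟩
      (y ++ X) ++ (ỹ ++ b ++ y) ◃ X ++ (X ++ ỹ)       ≡⟨ cong (λ p → (y ++ X) ++ p ◃ X ++ (X ++ ỹ)) Y≡ ⟨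
      (y ++ X) ++ Y ◃ X ++ (X ++ ỹ)                   ∎
      where
      lem : ∀ y X z b → (y ++ X ++ z) ++ (b ++ (y ++ X ++ z) ++ b) ++ (y ++ X ++ z)
                        ≡ (y ++ X) ++ ((z ++ b ++ y) ++ X ++ (z ++ b ++ y)) ++ (X ++ z)
      lem y X z b = solve M
    eq₃ : (T ++ X ++ Y) ++ (X ++ ỹ) ≡ n ++ a ◃ b
    eq₃ = begin
      (T ++ X ++ Y) ++ (X ++ ỹ)           ≡⟨ cong (λ t → (t ++ X ++ Y) ++ (X ++ ỹ)) T≡ ⟩
      ((n ++ y) ++ X ++ Y) ++ (X ++ ỹ)    ≡⟨ lem n y X Y ỹ ⟩
      n ++ ((y ++ X) ++ Y ++ (X ++ ỹ))    ≡⟨ cong (n ++_) aba≡ ⟨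
      n ++ a ◃ b                          ∎
      where
      lem : ∀ n y X Y z → ((n ++ y) ++ X ++ Y) ++ (X ++ z) ≡ n ++ ((y ++ X) ++ Y ++ (X ++ z))
      lem n y X Y z = solve M

-- Walks on the octagon and their substitutions

turn : Turn → Label → Label
turn ↑ c = c ⊕ 1
turn ↓ c = c ⊕ 7

-- The label of the opposite move.
opp : Label → Label
opp c = c ⊕ 4

turns : Word → Label → Label
turns []      c = c
turns (ε ∷ w) c = turns w (turn ε c)

turns-++ : ∀ w w′ c → turns (w ++ w′) c ≡ turns w′ (turns w c)
turns-++ []      w′ c = refl
turns-++ (ε ∷ w) w′ c = turns-++ w w′ (turn ε c)

turn-opp : ∀ ε c → turn ε (opp c) ≡ opp (turn ε c)
turn-opp ↑ = ∀₈ refl refl refl refl refl refl refl refl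
turn-opp ↓ = ∀₈ refl refl refl refl refl refl refl refl

turns-opp : ∀ w c → turns w (opp c) ≡ opp (turns w c)
turns-opp []      c = refl
turns-opp (ε ∷ w) c = trans (cong (turns w) (turn-opp ε c)) (turns-opp w (turn ε c))

-- A turn joins two neighbouring vertices of the octagon. It is of kind u if it runs along one of
-- the edges from an odd vertex c to c + 1, in either direction, and of kind v otherwise.
data Kind : Set where
  u v : Kind

_≟ᵏ_ : ∀ (k k′ : Kind) → Dec (k ≡ k′)
u ≟ᵏ u = yes refl
u ≟ᵏ v = no λ ()
v ≟ᵏ u = no λ ()
v ≟ᵏ v = yes refl

-- A turn together with its kind.
Letter : Set
Letter = Kind × Turn

negL : Letter → Letter
negL (k , ε) = k , neg ε

-- What lifting does to the turns of a cycle within a frame. For each of the squares obtained from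
-- one square of the cycle there is one letter.
Γ : Op → Letter → List Letter
Γ f (u , ε) = (v , ε) ∷ (u , ε) ∷ (v , ε) ∷ []
Γ f (v , ε) = [ v , neg ε ]
Γ g (u , ε) = [ u , neg ε ]
Γ g (v , ε) = (u , ε) ∷ (v , ε) ∷ (u , ε) ∷ []
Γ h (u , ε) = (v , neg ε) ∷ (u , neg ε) ∷ (v , neg ε) ∷ []
Γ h (v , ε) = (v , ε) ∷ (u , ε) ∷ (v , ε) ∷ (u , ε) ∷ (v , ε) ∷ []

-- The substitutions for the characters of a string, that of the last character first.
expand : List Op → List Letter → List Letter
expand e w = foldr (λ t → concatMap (Γ t)) w e

expand-∷ʳ : ∀ e t w → expand (e ∷ʳ t) w ≡ expand e (concatMap (Γ t) w)
expand-∷ʳ e t w = foldr-++ (λ t → concatMap (Γ t)) w e [ t ]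

expand-++ : ∀ e w w′ → expand e (w ++ w′) ≡ expand e w ++ expand e w′
expand-++ []      w w′ = refl
expand-++ (t ∷ e) w w′ = trans (cong (concatMap (Γ t)) (expand-++ e w w′))
                               (concatMap-++ (Γ t) (expand e w) (expand e w′))

Γ-negL : ∀ t x → Γ t (negL x) ≡ map negL (Γ t x)
Γ-negL f (u , ε) = refl
Γ-negL f (v , ε) = refl
Γ-negL g (u , ε) = refl
Γ-negL g (v , ε) = refl
Γ-negL h (u , ε) = refl
Γ-negL h (v , ε) = refl

concatMap-negL : ∀ t w → concatMap (Γ t) (map negL w) ≡ map negL (concatMap (Γ t) w)
concatMap-negL t []      = refl
concatMap-negL t (x ∷ w) = begin
  Γ t (negL x) ++ concatMap (Γ t) (map negL w)      ≡⟨ cong₂ _++_ (Γ-negL t x) (concatMap-negL t w) ⟩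
  map negL (Γ t x) ++ map negL (concatMap (Γ t) w)  ≡⟨ map-++ negL (Γ t x) _ ⟨
  map negL (Γ t x ++ concatMap (Γ t) w)             ∎
  where open ≡-Reasoning

expand-negL : ∀ e w → expand e (map negL w) ≡ map negL (expand e w)
expand-negL []      w = refl
expand-negL (t ∷ e) w = trans (cong (concatMap (Γ t)) (expand-negL e w)) (concatMap-negL t (expand e w))

turnsOf : List Letter → Word
turnsOf = map proj₂

-- The word of turns that results from one letter.
image : List Op → Letter → Word
image e x = turnsOf (expand e [ x ])

images : List Op → List Letter → Word
images e w = turnsOf (expand e w)

images-∷ : ∀ e x w → images e (x ∷ w) ≡ image e x ++ images e w
images-∷ e x w = trans (cong turnsOf (expand-++ e [ x ] w)) (map-++ proj₂ (expand e [ x ]) (expand e w))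

image-neg : ∀ e k ε → image e (k , neg ε) ≡ negs (image e (k , ε))
image-neg e k ε = begin
  turnsOf (expand e (map negL [ k , ε ]))   ≡⟨ cong turnsOf (expand-negL e [ k , ε ]) ⟩
  turnsOf (map negL (expand e [ k , ε ]))   ≡⟨ map-∘ (expand e [ k , ε ]) ⟨
  map (λ x → neg (proj₂ x)) (expand e [ k , ε ]) ≡⟨ map-∘ (expand e [ k , ε ]) ⟩
  negs (image e (k , ε))                    ∎
  where open ≡-Reasoning

-- The kind of a turn that begins at the vertex c.
kind : Label → Turn → Kind
kind c ↑ = upKind (parity (toℕ c))
  where
  upKind : Parity → Kind
  upKind 0ℙ = v
  upKind 1ℙ = u
kind c ↓ = kind (turn ↓ c) ↑

-- The kinds of the letters are those of the turns of the walk from c.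
Fits : Label → List Letter → Set
Fits c []            = ⊤
Fits c ((k , ε) ∷ w) = k ≡ kind c ε × Fits (turn ε c) w

Fits-++ : ∀ c w w′ → Fits c w → Fits (turns (turnsOf w) c) w′ → Fits c (w ++ w′)
Fits-++ c []      w′ _        fw′ = fw′
Fits-++ c ((k , ε) ∷ w) w′ (p , fw) fw′ = p , Fits-++ (turn ε c) w w′ fw fw′

-- Lifting takes a move labelled c to a move labelled relabelEdge t c.
relabelEdge : Op → Label → Label
relabelEdge t c = c ⊕ amount t (kind c ↑)
  where
  amount : Op → Kind → ℕ
  amount f u = 7
  amount f v = 1
  amount g u = 1
  amount g v = 7
  amount h u = 6
  amount h v = 2

relabelEdges : List Op → Label → Label
relabelEdges e c = foldr relabelEdge c e

relabelEdges-∷ʳ : ∀ e t c → relabelEdges (e ∷ʳ t) c ≡ relabelEdges e (relabelEdge t c)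
relabelEdges-∷ʳ e t c = foldr-++ relabelEdge c e [ t ]

-- The block that replaces a turn leads from the new label of its beginning to that of its end.
turns-Γ₁ : ∀ t ε c → turns (turnsOf (Γ t (kind c ε , ε))) (relabelEdge t c) ≡ relabelEdge t (turn ε c)
turns-Γ₁ f ↑ = ∀₈ refl refl refl refl refl refl refl refl
turns-Γ₁ f ↓ = ∀₈ refl refl refl refl refl refl refl refl
turns-Γ₁ g ↑ = ∀₈ refl refl refl refl refl refl refl refl
turns-Γ₁ g ↓ = ∀₈ refl refl refl refl refl refl refl refl
turns-Γ₁ h ↑ = ∀₈ refl refl refl refl refl refl refl refl
turns-Γ₁ h ↓ = ∀₈ refl refl refl refl refl refl refl refl

fits? : ∀ c w → Dec (Fits c w)
fits? c []            = yes tt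
fits? c ((k , ε) ∷ w) = (k ≟ᵏ kind c ε) ×-dec fits? (turn ε c) w

fits-Γ₁ : ∀ t ε c → Fits (relabelEdge t c) (Γ t (kind c ε , ε))
fits-Γ₁ t ε = all t ε
  where
  check : ∀ t ε → Dec (∀ c → Fits (relabelEdge t c) (Γ t (kind c ε , ε)))
  check t ε = all? λ c → fits? _ _
  all : ∀ t ε c → Fits (relabelEdge t c) (Γ t (kind c ε , ε))
  all f ↑ = from-yes (check f ↑)
  all f ↓ = from-yes (check f ↓)
  all g ↑ = from-yes (check g ↑)
  all g ↓ = from-yes (check g ↓)
  all h ↑ = from-yes (check h ↑)
  all h ↓ = from-yes (check h ↓)

turnsOf-++ : ∀ w w′ → turnsOf (w ++ w′) ≡ turnsOf w ++ turnsOf w′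
turnsOf-++ = map-++ proj₂

turns-Γ : ∀ t c w → Fits c w →
          turns (turnsOf (concatMap (Γ t) w)) (relabelEdge t c) ≡ relabelEdge t (turns (turnsOf w) c)
turns-Γ t c []            _           = refl
turns-Γ t c ((k , ε) ∷ w) (refl , fw) = begin
  turns (turnsOf (Γ t x ++ concatMap (Γ t) w)) (relabelEdge t c)
    ≡⟨ cong (λ z → turns z (relabelEdge t c)) (turnsOf-++ (Γ t x) (concatMap (Γ t) w)) ⟩
  turns (turnsOf (Γ t x) ++ turnsOf (concatMap (Γ t) w)) (relabelEdge t c)
    ≡⟨ turns-++ (turnsOf (Γ t x)) _ (relabelEdge t c) ⟩
  turns (turnsOf (concatMap (Γ t) w)) (turns (turnsOf (Γ t x)) (relabelEdge t c))
    ≡⟨ cong (turns (turnsOf (concatMap (Γ t) w))) (turns-Γ₁ t ε c) ⟩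
  turns (turnsOf (concatMap (Γ t) w)) (relabelEdge t (turn ε c))
    ≡⟨ turns-Γ t (turn ε c) w fw ⟩
  relabelEdge t (turns (turnsOf w) (turn ε c)) ∎
  where
  open ≡-Reasoning
  x : Letter
  x = k , ε

fits-Γ : ∀ t c w → Fits c w → Fits (relabelEdge t c) (concatMap (Γ t) w)
fits-Γ t c []            _           = tt
fits-Γ t c ((k , ε) ∷ w) (refl , fw) =
  Fits-++ (relabelEdge t c) (Γ t (k , ε)) (concatMap (Γ t) w) (fits-Γ₁ t ε c)
    (subst (λ d → Fits d (concatMap (Γ t) w)) (sym (turns-Γ₁ t ε c)) (fits-Γ t (turn ε c) w fw))

fits-expand : ∀ e c w → Fits c w → Fits (relabelEdges e c) (expand e w)
fits-expand []      c w fw = fw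
fits-expand (t ∷ e) c w fw = fits-Γ t (relabelEdges e c) (expand e w) (fits-expand e c w fw)

turns-expand : ∀ e c w → Fits c w → turns (images e w) (relabelEdges e c) ≡ relabelEdges e (turns (turnsOf w) c)
turns-expand []      c w fw = refl
turns-expand (t ∷ e) c w fw =
  trans (turns-Γ t (relabelEdges e c) (expand e w) (fits-expand e c w fw))
        (cong (relabelEdge t) (turns-expand e c w fw))

-- The tails of the words of turns of the paths of a canonical second leaper cycle of descent e;
-- the first component is for the sections of even direction.
tails : List Op → Word × Word
tails [] = [] , []
tails (f ∷ e) = let S , T = tails e in sandwich T (↑ ∷ S) , T
tails (g ∷ e) = let S , T = tails e in S , sandwich S (↑ ∷ T)
tails (h ∷ e) = let S , T = tails e in
  sandwich S ((↑ ∷ T) ◃ (↑ ∷ S)) , S ++ (↑ ∷ T) ++ (↑ ∷ S)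

U₀ U₁ : List Op → Word
U₀ e = ↑ ∷ proj₁ (tails e)
U₁ e = ↑ ∷ proj₂ (tails e)

flipString-∷ : ∀ t e → flipString (t ∷ e) ≡ flipString e ∷ʳ bar t
flipString-∷ t e = unfold-reverse (bar t) (map bar e)

bar-involutive : ∀ t → bar (bar t) ≡ t
bar-involutive f = refl
bar-involutive g = refl
bar-involutive h = refl

flipString-involutive : ∀ e → flipString (flipString e) ≡ e
flipString-involutive e = begin
  reverse (map bar (reverse (map bar e)))  ≡⟨ cong reverse (reverse-map bar (map bar e)) ⟩
  reverse (reverse (map bar (map bar e)))  ≡⟨ reverse-involutive _ ⟩
  map bar (map bar e)                      ≡⟨ map-∘ e ⟨
  map (λ t → bar (bar t)) e                ≡⟨ map-cong bar-involutive e ⟩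
  map (λ t → t) e                          ≡⟨ map-id e ⟩
  e                                        ∎
  where open ≡-Reasoning

-- The images of u and v for the flip of e.
uʷ vʷ : List Op → Word
uʷ e = image (flipString e) (u , ↑)
vʷ e = image (flipString e) (v , ↑)

-- The flip of t ∷ e ends in bar t, whose substitution is applied first, so that the images of
-- letters for t ∷ e are products of images for e.
image-snoc : ∀ t e x → image (flipString (t ∷ e)) x ≡ images (flipString e) (Γ (bar t) x)
image-snoc t e x = trans (cong (λ s → image s x) (flipString-∷ t e))
  (cong turnsOf (trans (expand-∷ʳ (flipString e) (bar t) [ x ])
    (cong (expand (flipString e)) (++-identityʳ (Γ (bar t) x)))))

image-↓ : ∀ e k → image e (k , ↓) ≡ negs (image e (k , ↑))
image-↓ e k = image-neg e k ↑

images₃ : ∀ e x y z → images e (x ∷ y ∷ z ∷ []) ≡ image e x ++ image e y ++ image e z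
images₃ e x y z = trans (images-∷ e x (y ∷ z ∷ [])) (cong (image e x ++_) (images-∷ e y [ z ]))

images₅ : ∀ e x y z p q → images e (x ∷ y ∷ z ∷ p ∷ q ∷ []) ≡ image e x ++ image e y ++ image e z ++ image e p ++ image e q
images₅ e x y z p q = trans (images-∷ e x (y ∷ z ∷ p ∷ q ∷ []))
  (cong (image e x ++_) (trans (images-∷ e y (z ∷ p ∷ q ∷ [])) (cong (image e y ++_) (images₃ e z p q))))

u-f : ∀ e → uʷ (f ∷ e) ≡ negs (uʷ e)
u-f e = trans (image-snoc f e (u , ↑)) (image-↓ (flipString e) u)

v-f : ∀ e → vʷ (f ∷ e) ≡ uʷ e ◃ vʷ e
v-f e = trans (image-snoc f e (v , ↑)) (images₃ (flipString e) (u , ↑) (v , ↑) (u , ↑))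

u-g : ∀ e → uʷ (g ∷ e) ≡ vʷ e ◃ uʷ e
u-g e = trans (image-snoc g e (u , ↑)) (images₃ (flipString e) (v , ↑) (u , ↑) (v , ↑))

v-g : ∀ e → vʷ (g ∷ e) ≡ negs (vʷ e)
v-g e = trans (image-snoc g e (v , ↑)) (image-↓ (flipString e) v)

u-h : ∀ e → uʷ (h ∷ e) ≡ negs (vʷ e ◃ uʷ e)
u-h e = begin
  uʷ (h ∷ e)
    ≡⟨ image-snoc h e (u , ↑) ⟩
  images E (map negL ((v , ↑) ∷ (u , ↑) ∷ (v , ↑) ∷ []))
    ≡⟨ cong turnsOf (expand-negL E ((v , ↑) ∷ (u , ↑) ∷ (v , ↑) ∷ [])) ⟩
  turnsOf (map negL X)          ≡⟨ map-∘ X ⟨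
  map (λ x → neg (proj₂ x)) X   ≡⟨ map-∘ X ⟩
  negs (turnsOf X)              ≡⟨ cong negs (images₃ E (v , ↑) (u , ↑) (v , ↑)) ⟩
  negs (vʷ e ◃ uʷ e)            ∎
  where
  open ≡-Reasoning
  E = flipString e
  X = expand E ((v , ↑) ∷ (u , ↑) ∷ (v , ↑) ∷ [])

v-h : ∀ e → vʷ (h ∷ e) ≡ vʷ e ◃ (uʷ e ◃ vʷ e)
v-h e = trans (trans (image-snoc h e (v , ↑)) (images₅ E (v , ↑) (u , ↑) (v , ↑) (u , ↑) (v , ↑)))
              (cong (vʷ e ++_) (lem (uʷ e) (vʷ e)))
  where
  E = flipString e
  lem : ∀ (p q : Word) → p ++ q ++ p ++ q ≡ (p ++ q ++ p) ++ q
  lem p q = solve (++-monoid Turn)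

-- Whether the number of lifts of type h is odd. Each of them exchanges in pairs the labels of the
-- moves between the eight paths of a second leaper cycle.
Twist : Set
Twist = Bool

twist : List Op → Twist
twist [] = false
twist (f ∷ e) = twist e
twist (g ∷ e) = twist e
twist (h ∷ e) = not (twist e)

-- The label of the move from the path in section i of a second leaper cycle to the next path.
connect : Twist → Dir → Label
connect false i = i
connect true  i = i ⊕ amount (kind i ↑)
  where
  amount : Kind → ℕ
  amount u = 1
  amount v = 7

-- The label at the corresponding point of the walk of the first cycle. It is the opposite label
-- if the lifts of type h are odd in number; this does no harm, as the walks are invariant under
-- rotation of the octagon by two steps.
target : Twist → Label → Label
target false c = c
target true  c = opp (connect true c)

-- The words of the two cycles are conjugate

-- The word of the path in a section of the given parity.
U : List Op → Parity → Word
U e 0ℙ = U₀ e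
U e 1ℙ = U₁ e

-- The path in section i of a second leaper cycle leads from the label of the move into it to the
-- label of the move out of it.
Connected : List Op → Set
Connected e = ∀ i → turns (U e (parity (toℕ i))) (connect (twist e) (i ⊕ 7)) ≡ connect (twist e) i

parity-kind : ∀ c → kind c ↑ ≡ u → parity (toℕ (turn ↑ c)) ≡ 0ℙ
parity-kind = ∀₈ (λ ()) (λ _ → refl) (λ ()) (λ _ → refl) (λ ()) (λ _ → refl) (λ ()) (λ _ → refl)

parity-kind′ : ∀ c → kind c ↑ ≡ v → parity (toℕ (turn ↑ c)) ≡ 1ℙ
parity-kind′ = ∀₈ (λ _ → refl) (λ ()) (λ _ → refl) (λ ()) (λ _ → refl) (λ ()) (λ _ → refl) (λ ())

↑-↓ : ∀ c → turn ↑ c ⊕ 7 ≡ c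
↑-↓ = ∀₈ refl refl refl refl refl refl refl refl

turns-target : ∀ e → Connected e → ∀ c →
  turns (U e (parity (toℕ (turn ↑ c)))) (target (twist e) c) ≡ target (twist e) (turn ↑ c)
turns-target e con c = lem (twist e) (trans (cong (λ d → turns w (connect (twist e) d)) (sym (↑-↓ c))) (con (turn ↑ c)))
  where
  w = U e (parity (toℕ (turn ↑ c)))
  lem : ∀ b → turns w (connect b c) ≡ connect b (turn ↑ c) → turns w (target b c) ≡ target b (turn ↑ c)
  lem false p = p
  lem true  p = trans (turns-opp w (connect true c)) (cong opp p)

turns-target₀ : ∀ e → Connected e → ∀ c → kind c ↑ ≡ u →
  turns (U₀ e) (target (twist e) c) ≡ target (twist e) (turn ↑ c)
turns-target₀ e con c odd =
  subst (λ p → turns (U e p) (target (twist e) c) ≡ target (twist e) (turn ↑ c)) (parity-kind c odd) (turns-target e con c)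

turns-target₁ : ∀ e → Connected e → ∀ c → kind c ↑ ≡ v →
  turns (U₁ e) (target (twist e) c) ≡ target (twist e) (turn ↑ c)
turns-target₁ e con c even =
  subst (λ p → turns (U e p) (target (twist e) c) ≡ target (twist e) (turn ↑ c)) (parity-kind′ c even) (turns-target e con c)

-- The label that a move of a shell cycle labelled c has after the lifts for the flip of e.
edges : List Op → Label → Label
edges e = relabelEdges (flipString e)

edges-∷ : ∀ t e c → edges (t ∷ e) c ≡ edges e (relabelEdge (bar t) c)
edges-∷ t e c = trans (cong (λ s → relabelEdges s c) (flipString-∷ t e)) (relabelEdges-∷ʳ (flipString e) (bar t) c)

turns-u : ∀ e c → kind c ↑ ≡ u → turns (uʷ e) (edges e c) ≡ edges e (turn ↑ c)
turns-u e c odd = turns-expand (flipString e) c ((u , ↑) ∷ []) (sym odd , tt)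

turns-v : ∀ e c → kind c ↑ ≡ v → turns (vʷ e) (edges e c) ≡ edges e (turn ↑ c)
turns-v e c even = turns-expand (flipString e) c ((v , ↑) ∷ []) (sym even , tt)

-- The words of the two cycles are conjugate, by a word y that leads from labels of the first walk
-- to the corresponding labels of the second one.
data Aligned (e : List Op) : Set where
  case₀ : ∀ {a b} → uʷ e ≡ a → vʷ e ≡ b →
          (R : Conjugated a b (proj₁ (tails e)) (proj₂ (tails e))) →
          (∀ c → kind c ↑ ≡ u → turns (Conjugated.y R) (edges e c) ≡ target (twist e) c) →
          Aligned e
  case₁ : ∀ {a b} → vʷ e ≡ a → uʷ e ≡ b →
          (R : Conjugated a b (proj₂ (tails e)) (proj₁ (tails e))) →
          (∀ c → kind c ↑ ≡ v → turns (Conjugated.y R) (edges e c) ≡ target (twist e) c) →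
          Aligned e

edge-g-odd : ∀ c → kind c ↑ ≡ v → kind (relabelEdge g c) ↑ ≡ u
edge-g-odd = ∀₈ (λ _ → refl) (λ ()) (λ _ → refl) (λ ()) (λ _ → refl) (λ ()) (λ _ → refl) (λ ())
edge-g-next : ∀ c → kind c ↑ ≡ v → turn ↑ (relabelEdge g c) ≡ c
edge-g-next = ∀₈ (λ _ → refl) (λ ()) (λ _ → refl) (λ ()) (λ _ → refl) (λ ()) (λ _ → refl) (λ ())
edge-f-even : ∀ c → kind c ↑ ≡ u → kind (relabelEdge f c) ↑ ≡ v
edge-f-even = ∀₈ (λ ()) (λ _ → refl) (λ ()) (λ _ → refl) (λ ()) (λ _ → refl) (λ ()) (λ _ → refl)
edge-f-next : ∀ c → kind c ↑ ≡ u → turn ↑ (relabelEdge f c) ≡ c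
edge-f-next = ∀₈ (λ ()) (λ _ → refl) (λ ()) (λ _ → refl) (λ ()) (λ _ → refl) (λ ()) (λ _ → refl)
edge-h-even : ∀ c → kind c ↑ ≡ v → kind (relabelEdge h c) ↑ ≡ v
edge-h-even = ∀₈ (λ _ → refl) (λ ()) (λ _ → refl) (λ ()) (λ _ → refl) (λ ()) (λ _ → refl) (λ ())
edge-h-next : ∀ c → kind c ↑ ≡ v → kind (turn ↑ (relabelEdge h c)) ↑ ≡ u
edge-h-next = ∀₈ (λ _ → refl) (λ ()) (λ _ → refl) (λ ()) (λ _ → refl) (λ ()) (λ _ → refl) (λ ())
target-h : ∀ b c → kind c ↑ ≡ v → target b (turn ↑ (relabelEdge h c)) ≡ target (not b) c
target-h false = ∀₈ (λ _ → refl) (λ ()) (λ _ → refl) (λ ()) (λ _ → refl) (λ ()) (λ _ → refl) (λ ())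
target-h true  = ∀₈ (λ _ → refl) (λ ()) (λ _ → refl) (λ ()) (λ _ → refl) (λ ()) (λ _ → refl) (λ ())

module _ (e : List Op) (con : Connected e) where
  open ≡-Reasoning
  private
    b : Bool
    b = twist e

  open Steps

  -- A lift of type f of the second cycle goes with one of type g of the first one, and vice versa.
  aligned-f : Aligned e → Aligned (f ∷ e)
  aligned-f (case₀ refl refl R lab) = case₁ (v-f e) (u-f e) (conjugated-aba R) λ c even → begin
    turns (Conjugated.y R ++ U₀ e) (edges (f ∷ e) c)        ≡⟨ cong (turns (Conjugated.y R ++ U₀ e)) (edges-∷ f e c) ⟩
    turns (Conjugated.y R ++ U₀ e) (edges e (c′ c))         ≡⟨ turns-++ (Conjugated.y R) (U₀ e) _ ⟩
    turns (U₀ e) (turns (Conjugated.y R) (edges e (c′ c)))  ≡⟨ cong (turns (U₀ e)) (lab (c′ c) (edge-g-odd c even)) ⟩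
    turns (U₀ e) (target b (c′ c))                   ≡⟨ turns-target₀ e con (c′ c) (edge-g-odd c even) ⟩
    target b (turn ↑ (c′ c))                         ≡⟨ cong (target b) (edge-g-next c even) ⟩
    target b c                                       ∎
    where
    c′ = relabelEdge g
  aligned-f (case₁ refl refl R lab) = case₁ (v-f e) (u-f e) (conjugated-bab R) λ c even → begin
    turns (uʷ e ++ Conjugated.y R) (edges (f ∷ e) c)        ≡⟨ cong (turns (uʷ e ++ Conjugated.y R)) (edges-∷ f e c) ⟩
    turns (uʷ e ++ Conjugated.y R) (edges e (c′ c))         ≡⟨ turns-++ (uʷ e) (Conjugated.y R) _ ⟩
    turns (Conjugated.y R) (turns (uʷ e) (edges e (c′ c)))  ≡⟨ cong (turns (Conjugated.y R)) (turns-u e (c′ c) (edge-g-odd c even)) ⟩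
    turns (Conjugated.y R) (edges e (turn ↑ (c′ c)))        ≡⟨ cong (λ d → turns (Conjugated.y R) (edges e d)) (edge-g-next c even) ⟩
    turns (Conjugated.y R) (edges e c)                      ≡⟨ lab c even ⟩
    target b c                                       ∎
    where
    c′ = relabelEdge g

  aligned-g : Aligned e → Aligned (g ∷ e)
  aligned-g (case₁ refl refl R lab) = case₀ (u-g e) (v-g e) (conjugated-aba R) λ c odd → begin
    turns (Conjugated.y R ++ U₁ e) (edges (g ∷ e) c)        ≡⟨ cong (turns (Conjugated.y R ++ U₁ e)) (edges-∷ g e c) ⟩
    turns (Conjugated.y R ++ U₁ e) (edges e (c′ c))         ≡⟨ turns-++ (Conjugated.y R) (U₁ e) _ ⟩
    turns (U₁ e) (turns (Conjugated.y R) (edges e (c′ c)))  ≡⟨ cong (turns (U₁ e)) (lab (c′ c) (edge-f-even c odd)) ⟩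
    turns (U₁ e) (target b (c′ c))                   ≡⟨ turns-target₁ e con (c′ c) (edge-f-even c odd) ⟩
    target b (turn ↑ (c′ c))                         ≡⟨ cong (target b) (edge-f-next c odd) ⟩
    target b c                                       ∎
    where
    c′ = relabelEdge f
  aligned-g (case₀ refl refl R lab) = case₀ (u-g e) (v-g e) (conjugated-bab R) λ c odd → begin
    turns (vʷ e ++ Conjugated.y R) (edges (g ∷ e) c)        ≡⟨ cong (turns (vʷ e ++ Conjugated.y R)) (edges-∷ g e c) ⟩
    turns (vʷ e ++ Conjugated.y R) (edges e (c′ c))         ≡⟨ turns-++ (vʷ e) (Conjugated.y R) _ ⟩
    turns (Conjugated.y R) (turns (vʷ e) (edges e (c′ c)))  ≡⟨ cong (turns (Conjugated.y R)) (turns-v e (c′ c) (edge-f-even c odd)) ⟩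
    turns (Conjugated.y R) (edges e (turn ↑ (c′ c)))        ≡⟨ cong (λ d → turns (Conjugated.y R) (edges e d)) (edge-f-next c odd) ⟩
    turns (Conjugated.y R) (edges e c)                      ≡⟨ lab c odd ⟩
    target b c                                       ∎
    where
    c′ = relabelEdge f

  aligned-h : Aligned e → Aligned (h ∷ e)
  aligned-h (case₀ refl refl R lab) = case₁ (v-h e) (u-h e) (conjugated-babab R) λ c even → begin
    turns (vʷ e ++ Conjugated.y R) (edges (h ∷ e) c)        ≡⟨ cong (turns (vʷ e ++ Conjugated.y R)) (edges-∷ h e c) ⟩
    turns (vʷ e ++ Conjugated.y R) (edges e (c′ c))         ≡⟨ turns-++ (vʷ e) (Conjugated.y R) _ ⟩
    turns (Conjugated.y R) (turns (vʷ e) (edges e (c′ c)))  ≡⟨ cong (turns (Conjugated.y R)) (turns-v e (c′ c) (edge-h-even c even)) ⟩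
    turns (Conjugated.y R) (edges e (turn ↑ (c′ c)))        ≡⟨ lab (turn ↑ (c′ c)) (edge-h-next c even) ⟩
    target b (turn ↑ (c′ c))                         ≡⟨ target-h b c even ⟩
    target (not b) c                                 ∎
    where
    c′ = relabelEdge h
  aligned-h (case₁ refl refl R lab) = case₁ (v-h e) (u-h e) (conjugated-ababa R) λ c even → begin
    turns (Conjugated.y R ++ U₁ e) (edges (h ∷ e) c)        ≡⟨ cong (turns (Conjugated.y R ++ U₁ e)) (edges-∷ h e c) ⟩
    turns (Conjugated.y R ++ U₁ e) (edges e (c′ c))         ≡⟨ turns-++ (Conjugated.y R) (U₁ e) _ ⟩
    turns (U₁ e) (turns (Conjugated.y R) (edges e (c′ c)))  ≡⟨ cong (turns (U₁ e)) (lab (c′ c) (edge-h-even c even)) ⟩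
    turns (U₁ e) (target b (c′ c))                   ≡⟨ turns-target₁ e con (c′ c) (edge-h-even c even) ⟩
    target b (turn ↑ (c′ c))                         ≡⟨ target-h b c even ⟩
    target (not b) c                                 ∎
    where
    c′ = relabelEdge h

aligned : (∀ e → Connected e) → ∀ e → Aligned e
aligned con []      = case₀ refl refl (conjugated [] [] refl refl refl refl refl refl) λ c _ → refl
aligned con (f ∷ e) = aligned-f e (con e) (aligned con e)
aligned con (g ∷ e) = aligned-g e (con e) (aligned con e)
aligned con (h ∷ e) = aligned-h e (con e) (aligned con e)

-- Traces of walks on the chessboard

module _ {X : Set} (step : Label → X → X) where
  -- The positions visited by a walk of turns from x, where c is the label of the move into x and
  -- step takes a label and a position to the next position. The position at the end of the walk is
  -- not in the list.
  trace : Label → X → Word → List X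
  trace c x []      = []
  trace c x (ε ∷ w) = x ∷ trace (turn ε c) (step (turn ε c) x) w

  end : Label → X → Word → X
  end c x []      = x
  end c x (ε ∷ w) = end (turn ε c) (step (turn ε c) x) w

  trace-++ : ∀ c x w w′ → trace c x (w ++ w′) ≡ trace c x w ++ trace (turns w c) (end c x w) w′
  trace-++ c x []      w′ = refl
  trace-++ c x (ε ∷ w) w′ = cong (x ∷_) (trace-++ (turn ε c) (step (turn ε c) x) w w′)

  end-++ : ∀ c x w w′ → end c x (w ++ w′) ≡ end (turns w c) (end c x w) w′
  end-++ c x []      w′ = refl
  end-++ c x (ε ∷ w) w′ = end-++ (turn ε c) (step (turn ε c) x) w w′

module _ {X Y : Set} {stepX : Label → X → X} {stepY : Label → Y → Y} (φ : X → Y)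
         (nat : ∀ c x → φ (stepX c x) ≡ stepY c (φ x)) where

  trace-map : ∀ c x w → trace stepY c (φ x) w ≡ map φ (trace stepX c x w)
  trace-map c x []      = refl
  trace-map c x (ε ∷ w) = cong (φ x ∷_)
    (trans (cong (λ y → trace stepY (turn ε c) y w) (sym (nat (turn ε c) x)))
           (trace-map (turn ε c) (stepX (turn ε c) x) w))

  end-map : ∀ c x w → end stepY c (φ x) w ≡ φ (end stepX c x w)
  end-map c x []      = refl
  end-map c x (ε ∷ w) =
    trans (cong (λ y → end stepY (turn ε c) y w) (sym (nat (turn ε c) x)))
          (end-map (turn ε c) (stepX (turn ε c) x) w)

⊞-comm₃ : ∀ a b c → (a ⊞ b) ⊞ c ≡ (a ⊞ c) ⊞ b
⊞-comm₃ (a , a′) (b , b′) (c , c′) = cong₂ _,_ (lem a b c) (lem a′ b′ c′)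
  where
  lem : ∀ a b c → (a ℤ.+ b) ℤ.+ c ≡ (a ℤ.+ c) ℤ.+ b
  lem = solve-∀

⊞-assoc : ∀ a b c → (a ⊞ b) ⊞ c ≡ a ⊞ (b ⊞ c)
⊞-assoc (a , a′) (b , b′) (c , c′) = cong₂ _,_ (ℤₚ.+-assoc a b c) (ℤₚ.+-assoc a′ b′ c′)

⊟-⊞-comm : ∀ a b c → (a ⊞ b) ⊟ c ≡ (a ⊟ c) ⊞ b
⊟-⊞-comm (a , a′) (b , b′) (c , c′) = cong₂ _,_ (lem a b c) (lem a′ b′ c′)
  where
  lem : ∀ a b c → (a ℤ.+ b) ℤ.- c ≡ (a ℤ.- c) ℤ.+ b
  lem = solve-∀

⊞-⊟ : ∀ a b → (a ⊞ b) ⊟ b ≡ a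
⊞-⊟ (a , a′) (b , b′) = cong₂ _,_ (lem a b) (lem a′ b′)
  where
  lem : ∀ a b → (a ℤ.+ b) ℤ.- b ≡ a
  lem = solve-∀

⊟-⊞ : ∀ a b → (a ⊟ b) ⊞ b ≡ a
⊟-⊞ (a , a′) (b , b′) = cong₂ _,_ (lem a b) (lem a′ b′)
  where
  lem : ∀ a b → (a ℤ.- b) ℤ.+ b ≡ a
  lem = solve-∀

-- Going back along a turn.
turn-neg-opp : ∀ ε c → turn (neg ε) (opp (turn ε c)) ≡ opp c
turn-neg-opp ↑ = ∀₈ refl refl refl refl refl refl refl refl
turn-neg-opp ↓ = ∀₈ refl refl refl refl refl refl refl refl

turn↑⊕6 : ∀ c → turn ↑ (c ⊕ 6) ≡ turn ↓ c
turn↑⊕6 = ∀₈ refl refl refl refl refl refl refl refl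

turn↓⊕2 : ∀ c → turn ↓ c ⊕ 2 ≡ turn ↑ c
turn↓⊕2 = ∀₈ refl refl refl refl refl refl refl refl

walk : (Label → Square) → Label → Square → Square
walk V c a = a ⊞ V c

module Walks (V : Label → Square) (V-opp : ∀ c a → a ⊞ V (opp c) ≡ a ⊟ V c) where

  -- The walk of word w from the square a, entered by a move labelled c, visits the squares xs; the
  -- next move, labelled c′, leads to a′.
  record Seg (c : Label) (a : Square) (xs : List Square) (w : Word) (c′ : Label) (a′ : Square) : Set where
    constructor seg
    field
      squares≡ : trace (walk V) c a w ≡ xs
      label≡   : turns w c ≡ c′
      end≡     : end (walk V) c a w ≡ a′

  seg-cast : ∀ {c d a b xs w w₁ c′ d′ a′ b′} → c ≡ d → a ≡ b → w ≡ w₁ → c′ ≡ d′ → a′ ≡ b′ →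
             Seg c a xs w c′ a′ → Seg d b xs w₁ d′ b′
  seg-cast refl refl refl refl refl s = s

  seg-++ : ∀ {c a xs w c′ a′ ys w′ c″ a″} → Seg c a xs w c′ a′ → Seg c′ a′ ys w′ c″ a″ →
           Seg c a (xs ++ ys) (w ++ w′) c″ a″
  seg-++ {c} {a} {w = w} {w′ = w′} (seg refl refl refl) (seg refl refl refl) =
    seg (trace-++ (walk V) c a w w′) (turns-++ w w′ c) (end-++ (walk V) c a w w′)

  seg-[] : ∀ {c a xs w c′ a′} → Seg c a xs w c′ a′ → Seg c a (xs ++ []) w c′ a′
  seg-[] {c} {a} {xs} {w} {c′} {a′} s = subst (λ zs → Seg c a zs w c′ a′) (sym (++-identityʳ xs)) s

  seg-shift : ∀ {c a xs w c′ a′} s → Seg c a xs w c′ a′ → Seg c (a ⊞ s) (map (_⊞ s) xs) w c′ (a′ ⊞ s)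
  seg-shift {c} {a} {w = w} s (seg refl refl refl) =
    seg (trace-map {stepX = walk V} (_⊞ s) nat c a w) refl (end-map {stepX = walk V} (_⊞ s) nat c a w)
    where
    nat : ∀ c a → walk V c a ⊞ s ≡ walk V c (a ⊞ s)
    nat c a = ⊞-comm₃ a (V c) s

  -- The reversed walk begins at the last square of xs, with the label of the move back from a′.
  seg-reverse : ∀ {c a xs w c′ a′} → Seg c a xs w c′ a′ →
                Seg (opp c′) (a′ ⊟ V c′) (reverse xs) (negs (reverse w)) (opp c) (a ⊟ V c)
  seg-reverse {w = []} (seg refl refl refl) = seg refl refl refl
  seg-reverse {c} {a} {w = ε ∷ w} {c′} {a′} (seg refl refl refl) =
    subst₂ (λ xs w → Seg (opp c′) (a′ ⊟ V c′) xs w (opp c) (a ⊟ V c))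
      (sym (unfold-reverse a (trace (walk V) (turn ε c) (a ⊞ V (turn ε c)) w)))
      (sym (trans (cong negs (unfold-reverse ε w)) (map-++ neg (reverse w) [ ε ])))
      (seg-++ (seg-reverse {w = w} (seg refl refl refl)) last)
    where
    d = turn ε c
    last : Seg (opp d) ((a ⊞ V d) ⊟ V d) [ a ] [ neg ε ] (opp c) (a ⊟ V c)
    last = seg (cong [_] (⊞-⊟ a (V d))) (turn-neg-opp ε c)
      (trans (cong₂ (λ b d → b ⊞ V d) (⊞-⊟ a (V d)) (turn-neg-opp ε c)) (V-opp c a))

  -- The first turn matters only through the label that it leads to, so that it can be changed along
  -- with the label of the incoming move.
  seg-flipFirst : ∀ {c a xs w c′ a′} → Seg c a xs (↓ ∷ w) c′ a′ → Seg (c ⊕ 6) a xs (↑ ∷ w) c′ a′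
  seg-flipFirst {c} {a} {w = w} (seg refl refl refl) =
    seg (cong (λ d → a ∷ trace (walk V) d (a ⊞ V d) w) (turn↑⊕6 c))
        (cong (turns w) (turn↑⊕6 c))
        (cong (λ d → end (walk V) d (a ⊞ V d) w) (turn↑⊕6 c))

  seg-flipLast : ∀ {c a xs w c′ a′} → Seg c a xs (w ++ [ ↓ ]) c′ a′ →
                 Seg c a xs (w ++ [ ↑ ]) (c′ ⊕ 2) ((a′ ⊟ V c′) ⊞ V (c′ ⊕ 2))
  seg-flipLast {c} {a} {w = w} (seg refl refl refl) = seg
    (trans (trace-++ (walk V) c a w [ ↑ ]) (sym (trace-++ (walk V) c a w [ ↓ ])))
    (trans (turns-++ w [ ↑ ] c) (trans (sym (turn↓⊕2 d)) (cong (_⊕ 2) (sym (turns-++ w [ ↓ ] c)))))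
    (begin
      end (walk V) c a (w ++ [ ↑ ])             ≡⟨ end-++ (walk V) c a w [ ↑ ] ⟩
      b ⊞ V (turn ↑ d)                          ≡⟨ cong₂ (λ x d′ → x ⊞ V d′) (⊞-⊟ b (V (turn ↓ d))) (turn↓⊕2 d) ⟨
      ((b ⊞ V (turn ↓ d)) ⊟ V (turn ↓ d)) ⊞ V (turn ↓ d ⊕ 2)
        ≡⟨ cong₂ (λ x d′ → (x ⊟ V d′) ⊞ V (d′ ⊕ 2)) (end-++ (walk V) c a w [ ↓ ]) (turns-++ w [ ↓ ] c) ⟨
      (end (walk V) c a (w ++ [ ↓ ]) ⊟ V (turns (w ++ [ ↓ ]) c)) ⊞ V (turns (w ++ [ ↓ ]) c ⊕ 2) ∎)
    where
    open ≡-Reasoning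
    d = turns w c
    b = end (walk V) c a w

  seg-sandwich : ∀ {c a xs S M c′ a′} → Palindrome (↑ ∷ S) → Seg c a xs (negs ((↑ ∷ S) ◃ M)) c′ a′ →
                 Seg (c ⊕ 6) a xs (↑ ∷ sandwich S M) (c′ ⊕ 2) ((a′ ⊟ V c′) ⊞ V (c′ ⊕ 2))
  seg-sandwich {c} {a} {xs} {S} {M} {c′} {a′} pal s =
    seg-flipLast {w = ↑ ∷ negs (S ++ M ++ reverse S)}
      (seg-flipFirst (subst (λ w → Seg c a xs w c′ a′) eq s))
    where
    open ≡-Reasoning
    eq : negs ((↑ ∷ S) ◃ M) ≡ ↓ ∷ negs (S ++ M ++ reverse S) ++ [ ↓ ]
    eq = cong (↓ ∷_) (begin
      negs (S ++ M ++ ↑ ∷ S)                       ≡⟨ cong (λ x → negs (S ++ M ++ x)) (trans (sym pal) (unfold-reverse ↑ S)) ⟩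
      negs (S ++ M ++ reverse S ++ [ ↑ ])          ≡⟨ cong (λ x → negs (S ++ x)) (++-assoc M (reverse S) [ ↑ ]) ⟨
      negs (S ++ (M ++ reverse S) ++ [ ↑ ])        ≡⟨ cong negs (++-assoc S (M ++ reverse S) [ ↑ ]) ⟨
      negs ((S ++ M ++ reverse S) ++ [ ↑ ])        ≡⟨ map-++ neg (S ++ M ++ reverse S) [ ↑ ] ⟩
      negs (S ++ M ++ reverse S) ++ [ ↓ ]          ∎)

palindrome-sandwich : ∀ S M → Palindrome M → Palindrome (↑ ∷ sandwich S M)
palindrome-sandwich S M pM = begin
  reverse ((↑ ∷ W) ++ [ ↑ ])  ≡⟨ reverse-++ (↑ ∷ W) [ ↑ ] ⟩
  ↑ ∷ reverse (↑ ∷ W)         ≡⟨ cong (↑ ∷_) (unfold-reverse ↑ W) ⟩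
  ↑ ∷ reverse W ++ [ ↑ ]      ≡⟨ cong (λ x → ↑ ∷ x ++ [ ↑ ]) (palindrome-negs (palindrome-around S pM)) ⟩
  ↑ ∷ W ++ [ ↑ ]              ∎
  where
  open ≡-Reasoning
  W = negs (S ++ M ++ reverse S)

palindrome-U : ∀ e → Palindrome (U₀ e) × Palindrome (U₁ e)
palindrome-U []      = refl , refl
palindrome-U (f ∷ e) = let p , q = palindrome-U e in palindrome-sandwich (proj₂ (tails e)) (U₀ e) p , q
palindrome-U (g ∷ e) = let p , q = palindrome-U e in p , palindrome-sandwich (proj₁ (tails e)) (U₁ e) q
palindrome-U (h ∷ e) = let p , q = palindrome-U e in
  palindrome-sandwich (proj₁ (tails e)) (U₁ e ◃ U₀ e) (palindrome-◃ {U₁ e} {U₀ e} q p) ,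
  palindrome-◃ {U₀ e} {U₁ e} p q

-- Lifting of canonical second leaper cycles

-- Proportions of a frame: 0 < m < n.
record Proper (F : Proportions) : Set where
  constructor proper
  field
    positive : 0 ℕ.< proj₁ F
    ordered  : proj₁ F ℕ.< proj₂ F

+-2*∸ : ∀ {m n} → m ℕ.< n → + (2 ℕ.* n ℕ.∸ m) ≡ + 2 ℤ.* + n ℤ.- + m
+-2*∸ {m} {n} m<n = begin
  + (2 ℕ.* n ℕ.∸ m)        ≡⟨ ℤₚ.⊖-≥ (ℕₚ.≤-trans (ℕₚ.<⇒≤ m<n) (ℕₚ.m≤m+n n _)) ⟨
  (2 ℕ.* n) ℤ.⊖ m          ≡⟨ ℤₚ.m-n≡m⊖n (2 ℕ.* n) m ⟨
  + (2 ℕ.* n) ℤ.- + m      ≡⟨ cong (ℤ._- + m) (ℤₚ.pos-* 2 n) ⟩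
  + 2 ℤ.* + n ℤ.- + m      ∎
  where open ≡-Reasoning

proper-grow : ∀ t {F} → Proper F → Proper (grow t F)
proper-grow f {m , n} (proper 0<m m<n) =
  proper 0<m (ℕₚ.<-≤-trans m<n (ℕₚ.m≤n+m n (2 ℕ.* m)))
proper-grow g {m , n} (proper 0<m m<n) =
  proper (ℕₚ.<-trans 0<m m<n) (ℕₚ.+-cancelʳ-< m _ _ (subst (n ℕ.+ m ℕ.<_) (sym (ℕₚ.m∸n+n≡m m≤2n)) n+m<2n))
  where
  m≤2n : m ℕ.≤ 2 ℕ.* n
  m≤2n = ℕₚ.≤-trans (ℕₚ.<⇒≤ m<n) (ℕₚ.m≤m+n n _)
  n+m<2n : n ℕ.+ m ℕ.< 2 ℕ.* n
  n+m<2n = subst (n ℕ.+ m ℕ.<_) (cong (n ℕ.+_) (sym (ℕₚ.+-identityʳ n))) (ℕₚ.+-monoʳ-< n m<n)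
proper-grow h {m , n} (proper 0<m m<n) =
  proper (ℕₚ.<-trans 0<m m<n) (ℕₚ.<-≤-trans (ℕₚ.m<n+m n 0<m) (ℕₚ.+-monoʳ-≤ m (ℕₚ.m≤m+n n _)))

proper-growAll : ∀ e {F} → Proper F → Proper (growAll e F)
proper-growAll []      p = p
proper-growAll (t ∷ e) p = proper-grow t (proper-growAll e p)

apply-+ : ∀ K K′ F → apply K F ⊞ apply K′ F ≡ apply (K +ᴹ K′) F
apply-+ (mat a b c d) (mat a′ b′ c′ d′) (m , n) = cong₂ _,_ (lem a b a′ b′ (+ m) (+ n)) (lem c d c′ d′ (+ m) (+ n))
  where
  lem : ∀ a b a′ b′ m n → (a ℤ.* m ℤ.+ b ℤ.* n) ℤ.+ (a′ ℤ.* m ℤ.+ b′ ℤ.* n) ≡ (a ℤ.+ a′) ℤ.* m ℤ.+ (b ℤ.+ b′) ℤ.* n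
  lem = solve-∀

infixl 7 _∙ᴹ_
-- Composition of linear maps.
_∙ᴹ_ : Mat ℤ → Mat ℤ → Mat ℤ
mat a b c d ∙ᴹ mat p q r s = mat (a ℤ.* p ℤ.+ b ℤ.* r) (a ℤ.* q ℤ.+ b ℤ.* s)
                                 (c ℤ.* p ℤ.+ d ℤ.* r) (c ℤ.* q ℤ.+ d ℤ.* s)

-- The proportions of the larger frame as linear forms in those of the smaller one.
growth : Op → Mat ℤ
growth f = mat (+ 1) (+ 0) (+ 2) (+ 1)
growth g = mat (+ 0) (+ 1) -1ℤ   (+ 2)
growth h = mat (+ 0) (+ 1) (+ 1) (+ 2)

form-m : ∀ m n → m ≡ 1ℤ ℤ.* m ℤ.+ 0ℤ ℤ.* n
form-m = solve-∀
form-n : ∀ m n → n ≡ 0ℤ ℤ.* m ℤ.+ 1ℤ ℤ.* n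
form-n = solve-∀
form--m : ∀ m n → ℤ.- m ≡ -1ℤ ℤ.* m ℤ.+ 0ℤ ℤ.* n
form--m = solve-∀
form--n : ∀ m n → ℤ.- n ≡ 0ℤ ℤ.* m ℤ.+ -1ℤ ℤ.* n
form--n = solve-∀
form-m+n : ∀ m n → m ℤ.+ n ≡ 1ℤ ℤ.* m ℤ.+ 1ℤ ℤ.* n
form-m+n = solve-∀
form-n-m : ∀ m n → n ℤ.- m ≡ -1ℤ ℤ.* m ℤ.+ 1ℤ ℤ.* n
form-n-m = solve-∀

grow≡ : ∀ t {F} → Proper F → (+ proj₁ (grow t F) , + proj₂ (grow t F)) ≡ apply (growth t) F
grow≡ f {m , n} _ = cong₂ _,_ (form-m (+ m) (+ n)) (begin
  + (2 ℕ.* m ℕ.+ n)       ≡⟨ ℤₚ.pos-+ (2 ℕ.* m) n ⟩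
  + (2 ℕ.* m) ℤ.+ + n     ≡⟨ cong (ℤ._+ + n) (ℤₚ.pos-* 2 m) ⟩
  + 2 ℤ.* + m ℤ.+ + n     ≡⟨ lem (+ m) (+ n) ⟩
  + 2 ℤ.* + m ℤ.+ + 1 ℤ.* + n  ∎)
  where
  open ≡-Reasoning
  lem : ∀ m n → + 2 ℤ.* m ℤ.+ n ≡ + 2 ℤ.* m ℤ.+ + 1 ℤ.* n
  lem = solve-∀
grow≡ g {m , n} (proper _ m<n) = cong₂ _,_ (form-n (+ m) (+ n)) (trans (+-2*∸ m<n) (lem (+ m) (+ n)))
  where
  lem : ∀ m n → + 2 ℤ.* n ℤ.- m ≡ -1ℤ ℤ.* m ℤ.+ + 2 ℤ.* n
  lem = solve-∀
grow≡ h {m , n} _ = cong₂ _,_ (form-n (+ m) (+ n)) (begin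
  + (m ℕ.+ 2 ℕ.* n)       ≡⟨ ℤₚ.pos-+ m (2 ℕ.* n) ⟩
  + m ℤ.+ + (2 ℕ.* n)     ≡⟨ cong (λ x → + m ℤ.+ x) (ℤₚ.pos-* 2 n) ⟩
  + m ℤ.+ + 2 ℤ.* + n     ≡⟨ lem (+ m) (+ n) ⟩
  + 1 ℤ.* + m ℤ.+ + 2 ℤ.* + n  ∎)
  where
  open ≡-Reasoning
  lem : ∀ m n → m ℤ.+ + 2 ℤ.* n ≡ + 1 ℤ.* m ℤ.+ + 2 ℤ.* n
  lem = solve-∀

apply-grow : ∀ K t {F} → Proper F → apply K (grow t F) ≡ apply (K ∙ᴹ growth t) F
apply-grow K@(mat a b c d) t {m , n} p = trans (cong (appℤ K) (grow≡ t p)) (lem (growth t))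
  where
  appℤ : Mat ℤ → ℤ × ℤ → Square
  appℤ (mat a b c d) (r , s) = a ℤ.* r ℤ.+ b ℤ.* s , c ℤ.* r ℤ.+ d ℤ.* s
  eq : ∀ a b p q r s m n → a ℤ.* (p ℤ.* m ℤ.+ q ℤ.* n) ℤ.+ b ℤ.* (r ℤ.* m ℤ.+ s ℤ.* n)
       ≡ (a ℤ.* p ℤ.+ b ℤ.* r) ℤ.* m ℤ.+ (a ℤ.* q ℤ.+ b ℤ.* s) ℤ.* n
  eq = solve-∀
  lem : ∀ G → appℤ K (apply G (m , n)) ≡ apply (K ∙ᴹ G) (m , n)
  lem (mat p q r s) = cong₂ _,_ (eq a b p q r s (+ m) (+ n)) (eq c d p q r s (+ m) (+ n))

-- The coefficients of m and n in an offset.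
offsetForm : Op → Parity → ℤ × ℤ
offsetForm f 0ℙ = 1ℤ , 1ℤ
offsetForm f 1ℙ = 1ℤ , 0ℤ
offsetForm g 0ℙ = -1ℤ , 1ℤ
offsetForm g 1ℙ = 0ℤ , 1ℤ
offsetForm h 0ℙ = 1ℤ , 1ℤ
offsetForm h 1ℙ = 0ℤ , 1ℤ

offset≡ : ∀ t F p → offset t F p ≡ proj₁ (offsetForm t p) ℤ.* + proj₁ F ℤ.+ proj₂ (offsetForm t p) ℤ.* + proj₂ F
offset≡ f (m , n) 0ℙ = form-m+n (+ m) (+ n)
offset≡ f (m , n) 1ℙ = form-m (+ m) (+ n)
offset≡ g (m , n) 0ℙ = form-n-m (+ m) (+ n)
offset≡ g (m , n) 1ℙ = form-n (+ m) (+ n)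
offset≡ h (m , n) 0ℙ = form-m+n (+ m) (+ n)
offset≡ h (m , n) 1ℙ = form-n (+ m) (+ n)

-- The matrix of the map that takes (m , n) to (p m + q n) · (x , y).
outer : ℤ × ℤ → ℤ × ℤ → Mat ℤ
outer (p , q) (x , y) = mat (p ℤ.* x) (q ℤ.* x) (p ℤ.* y) (q ℤ.* y)

shiftMat : Op → Dir → Mat ℤ
shiftMat t i = outer (offsetForm t (parity (toℕ i))) (unitVec (toℕ i))

shift≡ : ∀ t F i → shift t F i ≡ apply (shiftMat t i) F
shift≡ t F i = trans (cong (_· unitVec (toℕ i)) (offset≡ t F (parity (toℕ i))))
                     (cong₂ _,_ (lem p q x (+ m) (+ n)) (lem p q y (+ m) (+ n)))
  where
  m n : ℕ
  m = proj₁ F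
  n = proj₂ F
  p q x y : ℤ
  p = proj₁ (offsetForm t (parity (toℕ i)))
  q = proj₂ (offsetForm t (parity (toℕ i)))
  x = proj₁ (unitVec (toℕ i))
  y = proj₂ (unitVec (toℕ i))
  lem : ∀ p q x m n → (p ℤ.* m ℤ.+ q ℤ.* n) ℤ.* x ≡ (p ℤ.* x) ℤ.* m ℤ.+ (q ℤ.* x) ℤ.* n
  lem = solve-∀

-- In a lift of type h, the labels of the moves into and out of a path of even direction are those of
-- a chain of reversed paths, changed by two on account of the two flipped end turns; those of a
-- path of odd direction are the labels of a chain that is not reversed.
connect-even : ∀ b i → kind i ↑ ≡ v →
  opp (connect b (i ⊕ 6)) ⊕ 6 ≡ connect (not b) (i ⊕ 7) × opp (connect b (i ⊕ 1)) ⊕ 2 ≡ connect (not b) i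
  × connect (not b) i ≡ connect b (i ⊕ 7)
connect-even false = ∀₈ (λ _ → refl , refl , refl) (λ ()) (λ _ → refl , refl , refl) (λ ()) (λ _ → refl , refl , refl) (λ ()) (λ _ → refl , refl , refl) (λ ())
connect-even true  = ∀₈ (λ _ → refl , refl , refl) (λ ()) (λ _ → refl , refl , refl) (λ ()) (λ _ → refl , refl , refl) (λ ()) (λ _ → refl , refl , refl) (λ ())

connect-odd : ∀ b i → kind i ↑ ≡ u →
  connect b (i ⊕ 7 ⊕ 7) ≡ connect (not b) (i ⊕ 7) × connect (not b) i ≡ connect b (i ⊕ 1)
connect-odd false = ∀₈ (λ ()) (λ _ → refl , refl) (λ ()) (λ _ → refl , refl) (λ ()) (λ _ → refl , refl) (λ ()) (λ _ → refl , refl)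
connect-odd true  = ∀₈ (λ ()) (λ _ → refl , refl) (λ ()) (λ _ → refl , refl) (λ ()) (λ _ → refl , refl) (λ ()) (λ _ → refl , refl)

opp-connect⊕6 : ∀ b i → opp (connect b (i ⊕ 5)) ⊕ 6 ≡ connect b (i ⊕ 7)
opp-connect⊕6 false = ∀₈ refl refl refl refl refl refl refl refl
opp-connect⊕6 true  = ∀₈ refl refl refl refl refl refl refl refl

opp-connect⊕2 : ∀ b i → opp (connect b (i ⊕ 2)) ⊕ 2 ≡ connect b i
opp-connect⊕2 false = ∀₈ refl refl refl refl refl refl refl refl
opp-connect⊕2 true  = ∀₈ refl refl refl refl refl refl refl refl

opp-involutive : ∀ c → opp (opp c) ≡ c
opp-involutive = ∀₈ refl refl refl refl refl refl refl refl

module SecondLift (V : Label → Square) (V-opp : ∀ c a → a ⊞ V (opp c) ≡ a ⊟ V c) where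
  open Walks V V-opp

  V-opp′ : ∀ c a → a ⊟ V (opp c) ≡ a ⊞ V c
  V-opp′ c a = trans (sym (V-opp (opp c) a)) (cong (λ d → a ⊞ V d) (opp-involutive c))

  -- A second leaper cycle cut into eight paths, within an F-frame. The node of direction i is the
  -- first square of the path in section i + 1, and its tail the last square of the path in section
  -- i. The tie says that a move of the leaper of the frame, in direction i + 3, leads from the last
  -- square of path i to the first one of path i + 3; the reverse move has direction i + 7. This is
  -- what makes the moves between the lifted paths moves of the second leaper again.
  record Invariant (e : List Op) (F : Proportions) (a : Paths) : Set where
    field
      node : Dir → Square
    C : Dir → Label
    C = connect (twist e)
    tail : Dir → Square
    tail i = node i ⊟ V (C i)
    field
      path : ∀ i → Seg (C (i ⊕ 7)) (node (i ⊕ 7)) (a i) (U e (parity (toℕ i))) (C i) (node i)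
      tie  : ∀ i → tail i ≡ node (i ⊕ 2) ⊞ apply (A (i ⊕ 7)) F

  module _ {e F a} (pr : Proper F) (I : Invariant e F a) where
    open Invariant I

    par : Dir → Parity
    par i = parity (toℕ i)

    tail-⊞ : ∀ i → tail i ⊞ V (C i) ≡ node i
    tail-⊞ i = ⊟-⊞ (node i) (V (C i))

    back : ∀ i j → i ⊕ 7 ≡ j → Seg (opp (C i)) (tail i) (reverse (a i)) (negs (U e (par i))) (opp (C j)) (tail j)
    back i _ refl = subst (λ w → Seg (opp (C i)) (tail i) (reverse (a i)) (negs w) (opp (C (i ⊕ 7))) (tail (i ⊕ 7)))
                      (pal (par i)) (seg-reverse (path i))
      where
      pal : ∀ p → Palindrome (U e p)
      pal 0ℙ = proj₁ (palindrome-U e)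
      pal 1ℙ = proj₂ (palindrome-U e)

    ⊕-prev : ∀ i → (i ⊕ 6 ⊕ 7 ≡ i ⊕ 5) × (i ⊕ 5 ⊕ 7 ≡ i ⊕ 4) × (i ⊕ 4 ⊕ 7 ≡ i ⊕ 3) × (i ⊕ 3 ⊕ 7 ≡ i ⊕ 2) × (i ⊕ 2 ⊕ 7 ≡ i ⊕ 1)
    ⊕-prev = λ where
      0F → refl , refl , refl , refl , refl
      1F → refl , refl , refl , refl , refl
      2F → refl , refl , refl , refl , refl
      3F → refl , refl , refl , refl , refl
      4F → refl , refl , refl , refl , refl
      5F → refl , refl , refl , refl , refl
      6F → refl , refl , refl , refl , refl
      7F → refl , refl , refl , refl , refl

    -- Translations by vectors that are linear in the proportions, from the corresponding identity of
    -- matrices.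
    vec : ∀ t K i j → K +ᴹ shiftMat t i ≡ shiftMat t j → ∀ b → (b ⊞ apply K F) ⊞ shift t F i ≡ b ⊞ shift t F j
    vec t K i j eq b = trans (⊞-assoc b (apply K F) (shift t F i)) (cong (b ⊞_) (begin
      apply K F ⊞ shift t F i              ≡⟨ cong (apply K F ⊞_) (shift≡ t F i) ⟩
      apply K F ⊞ apply (shiftMat t i) F   ≡⟨ apply-+ K (shiftMat t i) F ⟩
      apply (K +ᴹ shiftMat t i) F          ≡⟨ cong (λ M → apply M F) eq ⟩
      apply (shiftMat t j) F               ≡⟨ shift≡ t F j ⟨
      shift t F j                          ∎))
      where
      open ≡-Reasoning

    vec′ : ∀ t K i j k → K +ᴹ shiftMat t i ≡ shiftMat t j +ᴹ (A k ∙ᴹ growth t) →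
           ∀ b → (b ⊞ apply K F) ⊞ shift t F i ≡ (b ⊞ shift t F j) ⊞ apply (A k) (grow t F)
    vec′ t K i j k eq b = begin
      (b ⊞ apply K F) ⊞ shift t F i              ≡⟨ ⊞-assoc b (apply K F) (shift t F i) ⟩
      b ⊞ (apply K F ⊞ shift t F i)              ≡⟨ cong (λ x → b ⊞ (apply K F ⊞ x)) (shift≡ t F i) ⟩
      b ⊞ (apply K F ⊞ apply (shiftMat t i) F)   ≡⟨ cong (b ⊞_) (apply-+ K (shiftMat t i) F) ⟩
      b ⊞ apply (K +ᴹ shiftMat t i) F            ≡⟨ cong (λ M → b ⊞ apply M F) eq ⟩
      b ⊞ apply (shiftMat t j +ᴹ (A k ∙ᴹ growth t)) F
                                                 ≡⟨ cong (b ⊞_) (apply-+ (shiftMat t j) (A k ∙ᴹ growth t) F) ⟨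
      b ⊞ (apply (shiftMat t j) F ⊞ apply (A k ∙ᴹ growth t) F)
                                                 ≡⟨ cong₂ (λ x y → b ⊞ (x ⊞ y)) (shift≡ t F j) (apply-grow (A k) t pr) ⟨
      b ⊞ (shift t F j ⊞ apply (A k) (grow t F)) ≡⟨ ⊞-assoc b (shift t F j) (apply (A k) (grow t F)) ⟨
      (b ⊞ shift t F j) ⊞ apply (A k) (grow t F) ∎
      where
      open ≡-Reasoning

    open ≡-Reasoning

    -- A chain of reversed paths that is left by the reverse of the move from path k to path k + 1 has
    -- node k as its last square. A move labelled c instead leads from there to node k ⊞ V c.
    turned : ∀ k c s → ((tail k ⊞ s) ⊟ V (opp (C k))) ⊞ V c ≡ (node k ⊞ s) ⊞ V c
    turned k c s = cong (_⊞ V c) (begin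
      (tail k ⊞ s) ⊟ V (opp (C k))   ≡⟨ V-opp′ (C k) (tail k ⊞ s) ⟩
      (tail k ⊞ s) ⊞ V (C k)         ≡⟨ ⊞-comm₃ (tail k) s (V (C k)) ⟩
      (tail k ⊞ V (C k)) ⊞ s         ≡⟨ cong (_⊞ s) (tail-⊞ k) ⟩
      node k ⊞ s                     ∎)

    node≡ : ∀ i → (node (i ⊕ 2) ⊞ apply (A (i ⊕ 7)) F) ⊞ V (C i) ≡ node i
    node≡ i = trans (cong (_⊞ V (C i)) (sym (tie i))) (tail-⊞ i)

    negs-◃ : ∀ {w₁ w₂ w₃ S M} → w₁ ≡ ↑ ∷ S → w₂ ≡ M → w₃ ≡ ↑ ∷ S →
             negs w₁ ++ negs w₂ ++ negs w₃ ≡ negs ((↑ ∷ S) ◃ M)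
    negs-◃ {S = S} {M = M} refl refl refl =
      trans (cong (negs (↑ ∷ S) ++_) (sym (map-++ neg M (↑ ∷ S)))) (sym (map-++ neg (↑ ∷ S) (M ++ ↑ ∷ S)))

    -- A chain of reversed paths, in its new place. Only the moves into its first and out of its last
    -- square change direction, which amounts to changing the two end turns.
    backwards-lift : ∀ t i k l {xs S M c₀ c₁} → Palindrome (↑ ∷ S) →
      Seg (opp (C k)) (tail k) xs (negs ((↑ ∷ S) ◃ M)) (opp (C l)) (tail l) →
      opp (C k) ⊕ 6 ≡ c₀ → opp (C l) ⊕ 2 ≡ c₁ →
      Seg c₀ (tail k ⊞ shift t F i) (map (_⊞ shift t F i) xs) (↑ ∷ sandwich S M)
          c₁ ((node l ⊞ shift t F i) ⊞ V c₁)
    backwards-lift t i k l {M = M} pal chain refl refl =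
      seg-cast refl refl refl refl (turned l (opp (C l) ⊕ 2) (shift t F i))
        (seg-sandwich {M = M} pal (seg-shift (shift t F i) chain))

    -- The vector w of a tie makes up for the difference of the shifts of two neighbouring paths.
    join : ∀ b c s s′ w {x} → (b ⊞ w) ⊞ s′ ≡ b ⊞ s → (b ⊞ w) ⊞ c ≡ x → (b ⊞ s) ⊞ c ≡ x ⊞ s′
    join b c s s′ w eq refl = trans (cong (_⊞ c) (sym eq)) (⊞-comm₃ (b ⊞ w) s′ c)

    back₃ : ∀ t i {S M} → U e (par (i ⊕ 5)) ≡ ↑ ∷ S → U e (par (i ⊕ 4)) ≡ M → U e (par (i ⊕ 3)) ≡ ↑ ∷ S →
            Palindrome (↑ ∷ S) → A (i ⊕ 7) +ᴹ shiftMat t (i ⊕ 1) ≡ shiftMat t i →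
            Seg (C (i ⊕ 7)) (tail (i ⊕ 5) ⊞ shift t F i)
                (map (_⊞ shift t F i) (backwards a i (5 ∷ 4 ∷ 3 ∷ [])))
                (↑ ∷ sandwich S M) (C i) (node i ⊞ shift t F (i ⊕ 1))
    back₃ t i {S} {M} e₅ e₄ e₃ pal eq =
      seg-cast refl refl refl refl (join (node (i ⊕ 2)) (V (C i)) (shift t F i) (shift t F (i ⊕ 1)) (apply (A (i ⊕ 7)) F)
        (vec t (A (i ⊕ 7)) (i ⊕ 1) i eq (node (i ⊕ 2))) (node≡ i))
        (backwards-lift t i (i ⊕ 5) (i ⊕ 2) {M = M} pal
          (seg-cast refl refl (negs-◃ e₅ e₄ e₃) refl refl chain)
          (opp-connect⊕6 (twist e) i) (opp-connect⊕2 (twist e) i))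
      where
      j₅ = proj₁ (proj₂ (⊕-prev i))
      j₄ = proj₁ (proj₂ (proj₂ (⊕-prev i)))
      j₃ = proj₁ (proj₂ (proj₂ (proj₂ (⊕-prev i))))
      chain : Seg (opp (C (i ⊕ 5))) (tail (i ⊕ 5)) (backwards a i (5 ∷ 4 ∷ 3 ∷ []))
                (negs (U e (par (i ⊕ 5))) ++ negs (U e (par (i ⊕ 4))) ++ negs (U e (par (i ⊕ 3))))
                (opp (C (i ⊕ 2))) (tail (i ⊕ 2))
      chain = seg-++ (back (i ⊕ 5) (i ⊕ 4) j₅) (seg-++ (back (i ⊕ 4) (i ⊕ 3) j₄) (seg-[] (back (i ⊕ 3) (i ⊕ 2) j₃)))

    -- A path that is only translated keeps its connecting moves.
    same : ∀ t i → A (i ⊕ 6 ⊕ 7) +ᴹ shiftMat t (i ⊕ 1) ≡ shiftMat t i → i ⊕ 6 ⊕ 2 ≡ i →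
           Seg (C (i ⊕ 7)) (node (i ⊕ 7) ⊞ shift t F i) (map (_⊞ shift t F i) (a i)) (U e (par i))
               (C i) (tail (i ⊕ 6) ⊞ shift t F (i ⊕ 1))
    same t i eq eq′ = seg-cast refl refl refl refl
      (trans (sym (vec t (A (i ⊕ 6 ⊕ 7)) (i ⊕ 1) i eq (node i)))
        (cong (_⊞ shift t F (i ⊕ 1)) (sym (trans (tie (i ⊕ 6)) (cong (λ k → node k ⊞ apply (A (i ⊕ 6 ⊕ 7)) F) eq′)))))
      (seg-shift (shift t F i) (path i))

    -- The first squares of the new paths.
    node′ : Op → Dir → Square
    node′ t i = from t (par (i ⊕ 1)) ⊞ shift t F (i ⊕ 1)
      where
      from : Op → Parity → Square
      from f 0ℙ = tail (i ⊕ 6)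
      from f 1ℙ = node i
      from g 0ℙ = node i
      from g 1ℙ = tail (i ⊕ 6)
      from h 0ℙ = tail (i ⊕ 7)
      from h 1ℙ = node (i ⊕ 7)

    pal₀ : Palindrome (U₀ e)
    pal₀ = proj₁ (palindrome-U e)
    pal₁ : Palindrome (U₁ e)
    pal₁ = proj₂ (palindrome-U e)

    path-f : ∀ i → Seg (C (i ⊕ 7)) (node′ f (i ⊕ 7)) (liftPaths f F a i) (U (f ∷ e) (par i)) (C i) (node′ f i)
    path-f 0F = back₃ f 0F refl refl refl pal₁ refl
    path-f 1F = same f 1F refl refl
    path-f 2F = back₃ f 2F refl refl refl pal₁ refl
    path-f 3F = same f 3F refl refl
    path-f 4F = back₃ f 4F refl refl refl pal₁ refl
    path-f 5F = same f 5F refl refl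
    path-f 6F = back₃ f 6F refl refl refl pal₁ refl
    path-f 7F = same f 7F refl refl

    path-g : ∀ i → Seg (C (i ⊕ 7)) (node′ g (i ⊕ 7)) (liftPaths g F a i) (U (g ∷ e) (par i)) (C i) (node′ g i)
    path-g 0F = same g 0F refl refl
    path-g 1F = back₃ g 1F refl refl refl pal₀ refl
    path-g 2F = same g 2F refl refl
    path-g 3F = back₃ g 3F refl refl refl pal₀ refl
    path-g 4F = same g 4F refl refl
    path-g 5F = back₃ g 5F refl refl refl pal₀ refl
    path-g 6F = same g 6F refl refl
    path-g 7F = back₃ g 7F refl refl refl pal₀ refl

    C′ : Dir → Label
    C′ = connect (not (twist e))

    negs-◃◃ : negs (U₀ e) ++ negs (U₁ e) ++ negs (U₀ e) ++ negs (U₁ e) ++ negs (U₀ e) ≡ negs (U₀ e ◃ (U₁ e ◃ U₀ e))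
    negs-◃◃ = begin
      negs (U₀ e) ++ negs (U₁ e) ++ negs (U₀ e) ++ negs (U₁ e) ++ negs (U₀ e)
        ≡⟨ cong (λ w → negs (U₀ e) ++ w) (sym (assoc₃ (negs (U₁ e)) (negs (U₀ e)) (negs (U₁ e)) (negs (U₀ e)))) ⟩
      negs (U₀ e) ++ (negs (U₁ e) ++ negs (U₀ e) ++ negs (U₁ e)) ++ negs (U₀ e)
        ≡⟨ cong (λ w → negs (U₀ e) ++ w ++ negs (U₀ e)) (negs₃ (U₁ e) (U₀ e) (U₁ e)) ⟨
      negs (U₀ e) ++ negs (U₁ e ◃ U₀ e) ++ negs (U₀ e)
        ≡⟨ negs₃ (U₀ e) (U₁ e ◃ U₀ e) (U₀ e) ⟨
      negs (U₀ e ◃ (U₁ e ◃ U₀ e)) ∎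

    back₅ : ∀ i → kind i ↑ ≡ v → par (i ⊕ 6) ≡ 0ℙ → par (i ⊕ 5) ≡ 1ℙ → par (i ⊕ 4) ≡ 0ℙ → par (i ⊕ 3) ≡ 1ℙ → par (i ⊕ 2) ≡ 0ℙ →
            i ⊕ 7 ⊕ 2 ≡ i ⊕ 1 → A (i ⊕ 7 ⊕ 7) +ᴹ shiftMat h (i ⊕ 1) ≡ shiftMat h i →
            Seg (C′ (i ⊕ 7)) (tail (i ⊕ 6) ⊞ shift h F i)
                (map (_⊞ shift h F i) (backwards a i (6 ∷ 5 ∷ 4 ∷ 3 ∷ 2 ∷ [])))
                (U₀ (h ∷ e)) (C′ i) (node (i ⊕ 7) ⊞ shift h F (i ⊕ 1))
    back₅ i even p₆ p₅ p₄ p₃ p₂ i₁ eq =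
      seg-cast refl refl refl refl
        (trans (cong (λ c → (node (i ⊕ 1) ⊞ shift h F i) ⊞ V c) c₁≡)
          (join (node (i ⊕ 1)) (V (C (i ⊕ 7))) (shift h F i) (shift h F (i ⊕ 1)) (apply (A (i ⊕ 7 ⊕ 7)) F)
          (vec h (A (i ⊕ 7 ⊕ 7)) (i ⊕ 1) i eq (node (i ⊕ 1)))
          (trans (cong (λ k → (node k ⊞ apply (A (i ⊕ 7 ⊕ 7)) F) ⊞ V (C (i ⊕ 7))) (sym i₁)) (node≡ (i ⊕ 7)))))
        (backwards-lift h i (i ⊕ 6) (i ⊕ 1) {M = U₁ e ◃ U₀ e} pal₀ chain c₀≡ c₁′≡)
      where
      c₀≡ = proj₁ (connect-even (twist e) i even)
      c₁′≡ = proj₁ (proj₂ (connect-even (twist e) i even))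
      c₁≡ = proj₂ (proj₂ (connect-even (twist e) i even))
      backᵖ : ∀ k l {p} → k ⊕ 7 ≡ l → par k ≡ p →
              Seg (opp (C k)) (tail k) (reverse (a k)) (negs (U e p)) (opp (C l)) (tail l)
      backᵖ k l eq refl = back k l eq
      chain : Seg (opp (C (i ⊕ 6))) (tail (i ⊕ 6)) (backwards a i (6 ∷ 5 ∷ 4 ∷ 3 ∷ 2 ∷ []))
                (negs (U₀ e ◃ (U₁ e ◃ U₀ e))) (opp (C (i ⊕ 1))) (tail (i ⊕ 1))
      chain with ⊕-prev i
      ... | j₆ , j₅ , j₄ , j₃ , j₂ = seg-cast refl refl negs-◃◃ refl refl
        (seg-++ (backᵖ (i ⊕ 6) (i ⊕ 5) j₆ p₆) (seg-++ (backᵖ (i ⊕ 5) (i ⊕ 4) j₅ p₅) (seg-++ (backᵖ (i ⊕ 4) (i ⊕ 3) j₄ p₄)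
          (seg-++ (backᵖ (i ⊕ 3) (i ⊕ 2) j₃ p₃) (seg-[] (backᵖ (i ⊕ 2) (i ⊕ 1) j₂ p₂))))))

    forth₃ : ∀ i → kind i ↑ ≡ u → par (i ⊕ 7) ≡ 0ℙ → par i ≡ 1ℙ → par (i ⊕ 1) ≡ 0ℙ → i ⊕ 1 ⊕ 7 ≡ i → i ⊕ 7 ⊕ 2 ≡ i ⊕ 1 →
             A (i ⊕ 7 ⊕ 7) +ᴹ shiftMat h (i ⊕ 1) ≡ shiftMat h i →
             Seg (C′ (i ⊕ 7)) (node (i ⊕ 7 ⊕ 7) ⊞ shift h F i)
                 (map (_⊞ shift h F i) (a (i ⊕ 7) ++ a i ++ a (i ⊕ 1)))
                 (U₁ (h ∷ e)) (C′ i) (tail (i ⊕ 7) ⊞ shift h F (i ⊕ 1))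
    forth₃ i odd p₇ p₀ p₁ j₁ j₂ eq =
      seg-cast (proj₁ (connect-odd (twist e) i odd)) refl refl (sym (proj₂ (connect-odd (twist e) i odd)))
        (trans (sym (vec h (A (i ⊕ 7 ⊕ 7)) (i ⊕ 1) i eq (node (i ⊕ 1))))
          (cong (_⊞ shift h F (i ⊕ 1))
            (sym (trans (tie (i ⊕ 7)) (cong (λ k → node k ⊞ apply (A (i ⊕ 7 ⊕ 7)) F) j₂)))))
        (seg-shift (shift h F i)
          (seg-++ (pathᵖ (i ⊕ 7) refl p₇) (seg-++ (pathᵖ i refl p₀) (pathᵖ (i ⊕ 1) j₁ p₁))))
      where
      pathᵖ : ∀ k {l p} → k ⊕ 7 ≡ l → par k ≡ p → Seg (C l) (node l) (a k) (U e p) (C k) (node k)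
      pathᵖ k refl refl = path k

    path-h : ∀ i → Seg (C′ (i ⊕ 7)) (node′ h (i ⊕ 7)) (liftPaths h F a i) (U (h ∷ e) (par i)) (C′ i) (node′ h i)
    path-h 0F = back₅ 0F refl refl refl refl refl refl refl refl
    path-h 1F = forth₃ 1F refl refl refl refl refl refl refl
    path-h 2F = back₅ 2F refl refl refl refl refl refl refl refl
    path-h 3F = forth₃ 3F refl refl refl refl refl refl refl
    path-h 4F = back₅ 4F refl refl refl refl refl refl refl refl
    path-h 5F = forth₃ 5F refl refl refl refl refl refl refl
    path-h 6F = back₅ 6F refl refl refl refl refl refl refl refl
    path-h 7F = forth₃ 7F refl refl refl refl refl refl refl

    tie-node : ∀ t i j k → A (j ⊕ 7) +ᴹ shiftMat t (i ⊕ 1) ≡ shiftMat t (i ⊕ 2 ⊕ 1) +ᴹ (A (i ⊕ 7) ∙ᴹ growth t) → j ⊕ 2 ≡ k →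
      (node j ⊞ shift t F (i ⊕ 1)) ⊟ V (C j) ≡ (node k ⊞ shift t F (i ⊕ 2 ⊕ 1)) ⊞ apply (A (i ⊕ 7)) (grow t F)
    tie-node t i j _ eq refl = begin
      (node j ⊞ shift t F (i ⊕ 1)) ⊟ V (C j)   ≡⟨ ⊟-⊞-comm (node j) (shift t F (i ⊕ 1)) (V (C j)) ⟩
      tail j ⊞ shift t F (i ⊕ 1)               ≡⟨ cong (_⊞ shift t F (i ⊕ 1)) (tie j) ⟩
      (node (j ⊕ 2) ⊞ apply (A (j ⊕ 7)) F) ⊞ shift t F (i ⊕ 1)
        ≡⟨ vec′ t (A (j ⊕ 7)) (i ⊕ 1) (i ⊕ 2 ⊕ 1) (i ⊕ 7) eq (node (j ⊕ 2)) ⟩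
      (node (j ⊕ 2) ⊞ shift t F (i ⊕ 2 ⊕ 1)) ⊞ apply (A (i ⊕ 7)) (grow t F) ∎

    tie-tail : ∀ t i j k → A (j ⊕ 7) +ᴹ shiftMat t (i ⊕ 1) ≡ shiftMat t (i ⊕ 2 ⊕ 1) +ᴹ (A (i ⊕ 7) ∙ᴹ growth t) → j ⊕ 2 ≡ k →
      (tail j ⊞ shift t F (i ⊕ 1)) ⊟ V (C k) ≡ (tail k ⊞ shift t F (i ⊕ 2 ⊕ 1)) ⊞ apply (A (i ⊕ 7)) (grow t F)
    tie-tail t i j _ eq refl = begin
      (tail j ⊞ shift t F (i ⊕ 1)) ⊟ V (C (j ⊕ 2))
        ≡⟨ ⊟-⊞-comm (tail j) (shift t F (i ⊕ 1)) (V (C (j ⊕ 2))) ⟩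
      (tail j ⊟ V (C (j ⊕ 2))) ⊞ shift t F (i ⊕ 1)
        ≡⟨ cong (λ x → (x ⊟ V (C (j ⊕ 2))) ⊞ shift t F (i ⊕ 1)) (tie j) ⟩
      ((node (j ⊕ 2) ⊞ apply (A (j ⊕ 7)) F) ⊟ V (C (j ⊕ 2))) ⊞ shift t F (i ⊕ 1)
        ≡⟨ cong (_⊞ shift t F (i ⊕ 1)) (⊟-⊞-comm (node (j ⊕ 2)) (apply (A (j ⊕ 7)) F) (V (C (j ⊕ 2)))) ⟩
      (tail (j ⊕ 2) ⊞ apply (A (j ⊕ 7)) F) ⊞ shift t F (i ⊕ 1)
        ≡⟨ vec′ t (A (j ⊕ 7)) (i ⊕ 1) (i ⊕ 2 ⊕ 1) (i ⊕ 7) eq (tail (j ⊕ 2)) ⟩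
      (tail (j ⊕ 2) ⊞ shift t F (i ⊕ 2 ⊕ 1)) ⊞ apply (A (i ⊕ 7)) (grow t F) ∎

    tie-f : ∀ i → node′ f i ⊟ V (C i) ≡ node′ f (i ⊕ 2) ⊞ apply (A (i ⊕ 7)) (grow f F)
    tie-f 0F = tie-node f 0F 0F 2F refl refl
    tie-f 1F = tie-tail f 1F 7F 1F refl refl
    tie-f 2F = tie-node f 2F 2F 4F refl refl
    tie-f 3F = tie-tail f 3F 1F 3F refl refl
    tie-f 4F = tie-node f 4F 4F 6F refl refl
    tie-f 5F = tie-tail f 5F 3F 5F refl refl
    tie-f 6F = tie-node f 6F 6F 0F refl refl
    tie-f 7F = tie-tail f 7F 5F 7F refl refl

    tie-g : ∀ i → node′ g i ⊟ V (C i) ≡ node′ g (i ⊕ 2) ⊞ apply (A (i ⊕ 7)) (grow g F)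
    tie-g 0F = tie-tail g 0F 6F 0F refl refl
    tie-g 1F = tie-node g 1F 1F 3F refl refl
    tie-g 2F = tie-tail g 2F 0F 2F refl refl
    tie-g 3F = tie-node g 3F 3F 5F refl refl
    tie-g 4F = tie-tail g 4F 2F 4F refl refl
    tie-g 5F = tie-node g 5F 5F 7F refl refl
    tie-g 6F = tie-tail g 6F 4F 6F refl refl
    tie-g 7F = tie-node g 7F 7F 1F refl refl

    tie-h : ∀ i → node′ h i ⊟ V (C′ i) ≡ node′ h (i ⊕ 2) ⊞ apply (A (i ⊕ 7)) (grow h F)
    tie-h i = trans (cong (λ c → node′ h i ⊟ V c) (C′≡ i)) (eq i)
      where
      next : Dir → Dir
      next i = i ⊕ by (kind i ↑)
        where
        by : Kind → ℕ
        by u = 1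
        by v = 7
      C′≡ : ∀ i → C′ i ≡ C (next i)
      C′≡ = lem (twist e)
        where
        lem : ∀ b i → connect (not b) i ≡ connect b (next i)
        lem false = ∀₈ refl refl refl refl refl refl refl refl
        lem true  = ∀₈ refl refl refl refl refl refl refl refl
      eq : ∀ i → node′ h i ⊟ V (C (next i)) ≡ node′ h (i ⊕ 2) ⊞ apply (A (i ⊕ 7)) (grow h F)
      eq 0F = tie-node h 0F 7F 1F refl refl
      eq 1F = tie-tail h 1F 0F 2F refl refl
      eq 2F = tie-node h 2F 1F 3F refl refl
      eq 3F = tie-tail h 3F 2F 4F refl refl
      eq 4F = tie-node h 4F 3F 5F refl refl
      eq 5F = tie-tail h 5F 4F 6F refl refl
      eq 6F = tie-node h 6F 5F 7F refl refl
      eq 7F = tie-tail h 7F 6F 0F refl refl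

  invariant-lift : ∀ t {e F a} → Proper F → Invariant e F a → Invariant (t ∷ e) (grow t F) (liftPaths t F a)
  invariant-lift f pr I = record { node = node′ pr I f ; path = path-f pr I ; tie = tie-f pr I }
  invariant-lift g pr I = record { node = node′ pr I g ; path = path-g pr I ; tie = tie-g pr I }
  invariant-lift h pr I = record { node = node′ pr I h ; path = path-h pr I ; tie = tie-h pr I }

  invariant : ∀ e {F a} → Proper F → Invariant [] F a → Invariant e (growAll e F) (liftAllPaths e F a)
  invariant []      pr I = I
  invariant (t ∷ e) pr I = invariant-lift t (proper-growAll e pr) (invariant e pr I)

-- Linear forms, regions and sections

-- (a , b) stands for the linear form a m + b n in the proportions of a frame.
Form : Set
Form = ℤ × ℤ

eval : Form → Proportions → ℤ
eval (a , b) (m , n) = a ℤ.* + m ℤ.+ b ℤ.* + n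

infixl 6 _⊖_ _⊕ᶠ_
_⊖_ _⊕ᶠ_ : Form → Form → Form
(a , b) ⊖ (c , d) = a ℤ.- c , b ℤ.- d
(a , b) ⊕ᶠ (c , d) = a ℤ.+ c , b ℤ.+ d

double : Form → Form
double q = q ⊕ᶠ q

-- A sufficient condition for a form to be nonnegative: a m + b n = (a + b) m + b (n - m).
NonNeg : Form → Set
NonNeg (a , b) = 0ℤ ℤ.≤ a ℤ.+ b × 0ℤ ℤ.≤ b

nonNeg? : ∀ q → Dec (NonNeg q)
nonNeg? (a , b) = (0ℤ ℤₚ.≤? a ℤ.+ b) ×-dec (0ℤ ℤₚ.≤? b)

nonNeg-* : ∀ {a} k → 0ℤ ℤ.≤ a → 0ℤ ℤ.≤ a ℤ.* + k
nonNeg-* {+ a} k _ = subst (0ℤ ℤ.≤_) (ℤₚ.pos-* a k) (ℤ.+≤+ ℕ.z≤n)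

eval-basis : ∀ q {F} → Proper F →
  eval q F ≡ (proj₁ q ℤ.+ proj₂ q) ℤ.* + proj₁ F ℤ.+ proj₂ q ℤ.* + (proj₂ F ℕ.∸ proj₁ F)
eval-basis (a , b) {m , n} (proper _ m<n) = begin
  a ℤ.* + m ℤ.+ b ℤ.* + n                     ≡⟨ lem a b (+ m) (+ n) ⟩
  (a ℤ.+ b) ℤ.* + m ℤ.+ b ℤ.* (+ n ℤ.- + m)   ≡⟨ cong (λ k → (a ℤ.+ b) ℤ.* + m ℤ.+ b ℤ.* k) n∸m ⟨
  (a ℤ.+ b) ℤ.* + m ℤ.+ b ℤ.* + (n ℕ.∸ m)     ∎
  where
  open ≡-Reasoning
  lem : ∀ a b m n → a ℤ.* m ℤ.+ b ℤ.* n ≡ (a ℤ.+ b) ℤ.* m ℤ.+ b ℤ.* (n ℤ.- m)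
  lem = solve-∀
  n∸m : + (n ℕ.∸ m) ≡ + n ℤ.- + m
  n∸m = trans (sym (ℤₚ.⊖-≥ (ℕₚ.<⇒≤ m<n))) (sym (ℤₚ.m-n≡m⊖n n m))

eval-nonNeg : ∀ q {F} → Proper F → NonNeg q → 0ℤ ℤ.≤ eval q F
eval-nonNeg q@(a , b) {F@(m , n)} pr (a+b≥0 , b≥0) = subst (0ℤ ℤ.≤_) (sym (eval-basis q pr))
  (ℤₚ.+-mono-≤ (nonNeg-* m a+b≥0) (nonNeg-* (n ℕ.∸ m) b≥0))

-- An open interval with linear forms as bounds, which are doubled as those of boxes are.
Interval : Set
Interval = Form × Form

InInterval : Proportions → Interval → ℤ → Set
InInterval F (l , r) x = eval l F ℤ.< + 2 ℤ.* x × + 2 ℤ.* x ℤ.< eval r F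

eval-⊖-⊕ : ∀ p o q F → eval (p ⊕ᶠ double o ⊖ q) F ℤ.+ eval q F ≡ eval p F ℤ.+ + 2 ℤ.* eval o F
eval-⊖-⊕ (a , b) (c , d) (e , k) (m , n) = lem a b c d e k (+ m) (+ n)
  where
  lem : ∀ a b c d e k m n → ((a ℤ.+ (c ℤ.+ c) ℤ.- e) ℤ.* m ℤ.+ (b ℤ.+ (d ℤ.+ d) ℤ.- k) ℤ.* n) ℤ.+ (e ℤ.* m ℤ.+ k ℤ.* n)
        ≡ (a ℤ.* m ℤ.+ b ℤ.* n) ℤ.+ + 2 ℤ.* (c ℤ.* m ℤ.+ d ℤ.* n)
  lem = solve-∀

eval-⊖-⊕′ : ∀ p o q F → eval (q ⊖ (p ⊕ᶠ double o)) F ℤ.+ (eval p F ℤ.+ + 2 ℤ.* eval o F) ≡ eval q F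
eval-⊖-⊕′ (a , b) (c , d) (e , k) (m , n) = lem a b c d e k (+ m) (+ n)
  where
  lem : ∀ a b c d e k m n → ((e ℤ.- (a ℤ.+ (c ℤ.+ c))) ℤ.* m ℤ.+ (k ℤ.- (b ℤ.+ (d ℤ.+ d))) ℤ.* n) ℤ.+ ((a ℤ.* m ℤ.+ b ℤ.* n) ℤ.+ + 2 ℤ.* (c ℤ.* m ℤ.+ d ℤ.* n))
        ≡ e ℤ.* m ℤ.+ k ℤ.* n
  lem = solve-∀

-- The interval I translated by the form o is contained in J.
Within : Form → Interval → Interval → Set
Within o (l , r) (l′ , r′) = NonNeg (l ⊕ᶠ double o ⊖ l′) × NonNeg (r′ ⊖ (r ⊕ᶠ double o))

within? : ∀ o I J → Dec (Within o I J)
within? o (l , r) (l′ , r′) = nonNeg? (l ⊕ᶠ double o ⊖ l′) ×-dec nonNeg? (r′ ⊖ (r ⊕ᶠ double o))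

-- The interval I translated by the form o is disjoint from J.
Apart : Form → Interval → Interval → Set
Apart o (l , r) (l′ , r′) = NonNeg (l′ ⊖ (r ⊕ᶠ double o)) ⊎ NonNeg (l ⊕ᶠ double o ⊖ r′)

apart? : ∀ o I J → Dec (Apart o I J)
apart? o (l , r) (l′ , r′) = nonNeg? (l′ ⊖ (r ⊕ᶠ double o)) ⊎-dec nonNeg? (l ⊕ᶠ double o ⊖ r′)

module _ {F : Proportions} (pr : Proper F) where

  eval-≥ : ∀ p o q → NonNeg (p ⊕ᶠ double o ⊖ q) → eval q F ℤ.≤ eval p F ℤ.+ + 2 ℤ.* eval o F
  eval-≥ p o q nn = subst (eval q F ℤ.≤_) (eval-⊖-⊕ p o q F)
    (subst (ℤ._≤ eval (p ⊕ᶠ double o ⊖ q) F ℤ.+ eval q F) (ℤₚ.+-identityˡ (eval q F))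
      (ℤₚ.+-monoˡ-≤ (eval q F) (eval-nonNeg (p ⊕ᶠ double o ⊖ q) pr nn)))

  eval-≤ : ∀ p o q → NonNeg (q ⊖ (p ⊕ᶠ double o)) → eval p F ℤ.+ + 2 ℤ.* eval o F ℤ.≤ eval q F
  eval-≤ p o q nn = subst (k ℤ.≤_) (eval-⊖-⊕′ p o q F)
    (subst (ℤ._≤ eval (q ⊖ (p ⊕ᶠ double o)) F ℤ.+ k) (ℤₚ.+-identityˡ k)
      (ℤₚ.+-monoˡ-≤ k (eval-nonNeg (q ⊖ (p ⊕ᶠ double o)) pr nn)))
    where
    k : ℤ
    k = eval p F ℤ.+ + 2 ℤ.* eval o F

  double-+ : ∀ x y → + 2 ℤ.* (x ℤ.+ y) ≡ + 2 ℤ.* x ℤ.+ + 2 ℤ.* y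
  double-+ = ℤₚ.*-distribˡ-+ (+ 2)

  within : ∀ o I J {x} → Within o I J → InInterval F I x → InInterval F J (x ℤ.+ eval o F)
  within o (l , r) (l′ , r′) {x} (nl , nr) (lx , xr) =
    subst (λ y → eval l′ F ℤ.< y) (sym (double-+ x (eval o F)))
      (ℤₚ.≤-<-trans (eval-≥ l o l′ nl) (ℤₚ.+-monoˡ-< (+ 2 ℤ.* eval o F) lx)) ,
    subst (ℤ._< eval r′ F) (sym (double-+ x (eval o F)))
      (ℤₚ.<-≤-trans (ℤₚ.+-monoˡ-< (+ 2 ℤ.* eval o F) xr) (eval-≤ r o r′ nr))

  apart : ∀ o I J {x} → Apart o I J → InInterval F I x → InInterval F J (x ℤ.+ eval o F) → ⊥
  apart o (l , r) (l′ , r′) {x} (inj₁ p) (lx , xr) (ly , yr) = ℤₚ.<-irrefl refl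
    (ℤₚ.<-trans (subst (eval l′ F ℤ.<_) (double-+ x (eval o F)) ly)
      (ℤₚ.<-≤-trans (ℤₚ.+-monoˡ-< (+ 2 ℤ.* eval o F) xr) (eval-≤ r o l′ p)))
  apart o (l , r) (l′ , r′) {x} (inj₂ p) (lx , xr) (ly , yr) = ℤₚ.<-irrefl refl
    (ℤₚ.<-trans (subst (ℤ._< eval r′ F) (double-+ x (eval o F)) yr)
      (ℤₚ.≤-<-trans (eval-≥ l o r′ p) (ℤₚ.+-monoˡ-< (+ 2 ℤ.* eval o F) lx)))

-- A rectangle with linear forms as bounds.
Region : Set
Region = Interval × Interval

InRegion : Proportions → Region → Pred Square 0ℓ
InRegion F (I , J) (x , y) = InInterval F I x × InInterval F J y

negate : Interval → Interval
negate ((a , b) , (c , d)) = (ℤ.- c , ℤ.- d) , (ℤ.- a , ℤ.- b)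

rotate : Region → Region
rotate (I , J) = negate J , I

-- The counterpart of rotations.
regions : Region → Region → ℕ → Region
regions E NE 0             = E
regions E NE 1             = NE
regions E NE (suc (suc i)) = rotate (regions E NE i)

eval-neg : ∀ a b m n → ℤ.- (a ℤ.* m ℤ.+ b ℤ.* n) ≡ (ℤ.- a) ℤ.* m ℤ.+ (ℤ.- b) ℤ.* n
eval-neg = solve-∀

double-neg : ∀ x → ℤ.- (+ 2 ℤ.* ℤ.- x) ≡ + 2 ℤ.* x
double-neg = solve-∀

interval-negate : ∀ F I {x} → InInterval F I (ℤ.- x) → InInterval F (negate I) x
interval-negate (m , n) ((a , b) , (c , d)) {x} (p , q) =
  subst₂ ℤ._<_ (eval-neg c d (+ m) (+ n)) (double-neg x) (ℤₚ.neg-mono-< q) ,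
  subst₂ ℤ._<_ (double-neg x) (eval-neg a b (+ m) (+ n)) (ℤₚ.neg-mono-< p)

double-neg′ : ∀ x → ℤ.- (+ 2 ℤ.* x) ≡ + 2 ℤ.* ℤ.- x
double-neg′ = solve-∀

neg-eval-neg : ∀ a b m n → ℤ.- ((ℤ.- a) ℤ.* m ℤ.+ (ℤ.- b) ℤ.* n) ≡ a ℤ.* m ℤ.+ b ℤ.* n
neg-eval-neg = solve-∀

interval-unnegate : ∀ F I {x} → InInterval F (negate I) x → InInterval F I (ℤ.- x)
interval-unnegate (m , n) ((a , b) , (c , d)) {x} (p , q) =
  subst₂ ℤ._<_ (neg-eval-neg a b (+ m) (+ n)) (double-neg′ x) (ℤₚ.neg-mono-< q) ,
  subst₂ ℤ._<_ (double-neg′ x) (neg-eval-neg c d (+ m) (+ n)) (ℤₚ.neg-mono-< p)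

module _ (F : Proportions) {P Q : Pred Square 0ℓ} {E NE : Region} where
  rotations⇒ : (∀ {z} → P z → InRegion F E z) → (∀ {z} → Q z → InRegion F NE z) →
               ∀ i {z} → rotations P Q i z → InRegion F (regions E NE i) z
  rotations⇒ pe qe 0 = pe
  rotations⇒ pe qe 1 = qe
  rotations⇒ pe qe (suc (suc i)) s = let p , q = rotations⇒ pe qe i s in interval-negate F (proj₂ (regions E NE i)) q , p

  rotations⇐ : (∀ {z} → InRegion F E z → P z) → (∀ {z} → InRegion F NE z → Q z) →
               ∀ i {z} → InRegion F (regions E NE i) z → rotations P Q i z
  rotations⇐ pe qe 0 = pe
  rotations⇐ pe qe 1 = qe
  rotations⇐ pe qe (suc (suc i)) (q , p) = rotations⇐ pe qe i (p , interval-unnegate F (proj₂ (regions E NE i)) q)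

module _ (F : Proportions) {a b c d : ℤ} (p q r s : Form)
         (a≡ : eval p F ≡ a) (b≡ : eval q F ≡ b) (c≡ : eval r F ≡ c) (d≡ : eval s F ≡ d) where
  box⇒ : ∀ {z} → Box a b c d z → InRegion F ((p , q) , (r , s)) z
  box⇒ ((x , y) , (z , w)) = (subst (ℤ._< _) (sym a≡) x , subst (_ ℤ.<_) (sym b≡) y) ,
                             (subst (ℤ._< _) (sym c≡) z , subst (_ ℤ.<_) (sym d≡) w)

  box⇐ : ∀ {z} → InRegion F ((p , q) , (r , s)) z → Box a b c d z
  box⇐ ((x , y) , (z , w)) = (subst (ℤ._< _) a≡ x , subst (_ ℤ.<_) b≡ y) ,
                             (subst (ℤ._< _) c≡ z , subst (_ ℤ.<_) d≡ w)

-- n - m, n + m and m - n.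
inner outerᶠ -inner : Form
inner  = -1ℤ , 1ℤ
outerᶠ = 1ℤ , 1ℤ
-inner = 1ℤ , -1ℤ

inner≡ : ∀ m n → -1ℤ ℤ.* m ℤ.+ 1ℤ ℤ.* n ≡ n ℤ.- m
inner≡ = solve-∀

outer≡ : ∀ m n → 1ℤ ℤ.* m ℤ.+ 1ℤ ℤ.* n ≡ n ℤ.+ m
outer≡ = solve-∀

-inner≡ : ∀ m n → 1ℤ ℤ.* m ℤ.+ -1ℤ ℤ.* n ≡ ℤ.- (n ℤ.- m)
-inner≡ = solve-∀

section : Dir → Region
section i = regions ((inner , outerᶠ) , (-inner , inner)) ((inner , outerᶠ) , (inner , outerᶠ)) (toℕ i)

section⇒ : ∀ F i {z} → Section F i z → InRegion F (section i) z
section⇒ F@(m , n) i = rotations⇒ F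
  (box⇒ F inner outerᶠ -inner inner (inner≡ (+ m) (+ n)) (outer≡ (+ m) (+ n)) (-inner≡ (+ m) (+ n)) (inner≡ (+ m) (+ n)))
  (box⇒ F inner outerᶠ inner outerᶠ (inner≡ (+ m) (+ n)) (outer≡ (+ m) (+ n)) (inner≡ (+ m) (+ n)) (outer≡ (+ m) (+ n))) (toℕ i)

section⇐ : ∀ F i {z} → InRegion F (section i) z → Section F i z
section⇐ F@(m , n) i = rotations⇐ F
  (box⇐ F inner outerᶠ -inner inner (inner≡ (+ m) (+ n)) (outer≡ (+ m) (+ n)) (-inner≡ (+ m) (+ n)) (inner≡ (+ m) (+ n)))
  (box⇐ F inner outerᶠ inner outerᶠ (inner≡ (+ m) (+ n)) (outer≡ (+ m) (+ n)) (inner≡ (+ m) (+ n)) (outer≡ (+ m) (+ n))) (toℕ i)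

row₁ row₂ : Mat ℤ → Form
row₁ (mat a b c d) = a , b
row₂ (mat a b c d) = c , d

-- The region R translated by the vector of K is contained in R′, or disjoint from it.
WithinR ApartR : Mat ℤ → Region → Region → Set
WithinR K (I , J) (I′ , J′) = Within (row₁ K) I I′ × Within (row₂ K) J J′
ApartR  K (I , J) (I′ , J′) = Apart (row₁ K) I I′ ⊎ Apart (row₂ K) J J′

withinR? : ∀ K R R′ → Dec (WithinR K R R′)
withinR? K (I , J) (I′ , J′) = within? (row₁ K) I I′ ×-dec within? (row₂ K) J J′

apartR? : ∀ K R R′ → Dec (ApartR K R R′)
apartR? K (I , J) (I′ , J′) = apart? (row₁ K) I I′ ⊎-dec apart? (row₂ K) J J′

withinR : ∀ {F} → Proper F → ∀ K R R′ {z} → WithinR K R R′ → InRegion F R z → InRegion F R′ (z ⊞ apply K F)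
withinR pr K@(mat _ _ _ _) (I , J) (I′ , J′) (p , q) (x , y) =
  within pr (row₁ K) I I′ p x , within pr (row₂ K) J J′ q y

apartR : ∀ {F} → Proper F → ∀ K R R′ {z} → ApartR K R R′ → InRegion F R z → InRegion F R′ (z ⊞ apply K F) → ⊥
apartR pr K@(mat _ _ _ _) (I , J) (I′ , J′) (inj₁ p) (x , _) (x′ , _) = apart pr (row₁ K) I I′ p x x′
apartR pr K@(mat _ _ _ _) (I , J) (I′ , J′) (inj₂ q) (_ , y) (_ , y′) = apart pr (row₂ K) J J′ q y y′

-- A form in the proportions of the larger frame as one in those of the smaller frame.
pullForm : Op → Form → Form
pullForm t (a , b) = row₁ (mat a b 0ℤ 0ℤ ∙ᴹ growth t)

eval-pull : ∀ t q {F} → Proper F → eval (pullForm t q) F ≡ eval q (grow t F)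
eval-pull t (a , b) {F} pr = lem (growth t) (sym (cong proj₁ (apply-grow (mat a b 0ℤ 0ℤ) t pr)))
  where
  lem : ∀ G {x} → proj₁ (apply (mat a b 0ℤ 0ℤ ∙ᴹ G) F) ≡ x → eval (row₁ (mat a b 0ℤ 0ℤ ∙ᴹ G)) F ≡ x
  lem (mat _ _ _ _) e = e

pull : Op → Region → Region
pull t ((a , b) , (c , d)) = (pullForm t a , pullForm t b) , (pullForm t c , pullForm t d)

pull⇒ : ∀ t R {F z} → Proper F → InRegion (grow t F) R z → InRegion F (pull t R) z
pull⇒ t ((a , b) , (c , d)) {F} {z} pr ((p , q) , (r , s)) =
  (subst (ℤ._< _) (sym (eval-pull t a pr)) p , subst (_ ℤ.<_) (sym (eval-pull t b pr)) q) ,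
  (subst (ℤ._< _) (sym (eval-pull t c pr)) r , subst (_ ℤ.<_) (sym (eval-pull t d pr)) s)

pull⇐ : ∀ t R {F z} → Proper F → InRegion F (pull t R) z → InRegion (grow t F) R z
pull⇐ t ((a , b) , (c , d)) {F} {z} pr ((p , q) , (r , s)) =
  (subst (ℤ._< _) (eval-pull t a pr) p , subst (_ ℤ.<_) (eval-pull t b pr) q) ,
  (subst (ℤ._< _) (eval-pull t c pr) r , subst (_ ℤ.<_) (eval-pull t d pr) s)

-- The direction of the move labelled c of a cycle within a frame. Consecutive labels
-- belong to directions that are three apart.
moveLabel : Label → Label
moveLabel c = (3 ℕ.* toℕ c ℕ.+ 6) mod 8

-- The section of a square that is entered by a move labelled c and left with the given turn.
site : Label → Turn → Dir
site c ↑ = (3 ℕ.* toℕ c ℕ.+ 6) mod 8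
site c ↓ = (3 ℕ.* toℕ c ℕ.+ 7) mod 8

abstract
  sections-apart : ∀ i j → i ≡ j ⊎ ApartR 0ᴹ (section i) (section j)
  sections-apart i j = from-yes (all? λ i → all? λ j → (i ≟ᶠ j) ⊎-dec apartR? 0ᴹ (section i) (section j)) i j

abstract
  -- From a square in a section, only the move by which a walk turning ↑ would leave it and the
  -- reverse of the move by which that walk would have entered lead to a square in a section.
  degree-two : ∀ c l j → (l ≡ moveLabel (turn ↑ c) ⊎ l ≡ moveLabel (opp c)) ⊎ ApartR (A l) (section (site c ↑)) (section j)
  degree-two c l j = from-yes (all? λ c → all? λ l → all? λ j →
     ((l ≟ᶠ moveLabel (turn ↑ c)) ⊎-dec (l ≟ᶠ moveLabel (opp c))) ⊎-dec apartR? (A l) (section (site c ↑)) (section j)) c l j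

-- Lifting of cycles within a frame

-- A square of a walk, with the label of the move into it and the turn made at it.
Visit : Set
Visit = Label × Turn × Square

siteOf : Visit → Dir
siteOf (c , ε , _) = site c ε

squareOf : Visit → Square
squareOf (_ , _ , z) = z

visits : (Label → Square) → Label → Square → Word → List Visit
visits V c a []      = []
visits V c a (ε ∷ w) = (c , ε , a) ∷ visits V (turn ε c) (a ⊞ V (turn ε c)) w

sites : Label → Word → List Dir
sites c []      = []
sites c (ε ∷ w) = site c ε ∷ sites (turn ε c) w

map-squareOf : ∀ V c a w → map squareOf (visits V c a w) ≡ trace (walk V) c a w
map-squareOf V c a []      = refl
map-squareOf V c a (ε ∷ w) = cong (a ∷_) (map-squareOf V (turn ε c) (a ⊞ V (turn ε c)) w)

map-siteOf : ∀ V c a w → map siteOf (visits V c a w) ≡ sites c w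
map-siteOf V c a []      = refl
map-siteOf V c a (ε ∷ w) = cong (site c ε ∷_) (map-siteOf V (turn ε c) (a ⊞ V (turn ε c)) w)

visits-++ : ∀ V c a w w′ → visits V c a (w ++ w′) ≡ visits V c a w ++ visits V (turns w c) (end (walk V) c a w) w′
visits-++ V c a []      w′ = refl
visits-++ V c a (ε ∷ w) w′ = cong ((c , ε , a) ∷_) (visits-++ V (turn ε c) (a ⊞ V (turn ε c)) w w′)

-- The vectors of the moves labelled c of the leaper of a frame.
moves₁ : Proportions → Label → Square
moves₁ F c = apply (A (moveLabel c)) F

-- Moves in the larger frame, as linear maps of the proportions of the smaller frame.
stepᴹ : Op → Label → Mat ℤ → Mat ℤ
stepᴹ t c K = K +ᴹ (A (moveLabel c) ∙ᴹ growth t)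

-- The square at the end of a move labelled c is copied to one or several sections of the larger
-- frame. This is the section of the copy that comes first, after the new move.
leading : Op → Label → Dir
leading t c = site (relabelEdge t c) (lead t (kind c ↑))
  where
  lead : Op → Kind → Turn
  lead f u = ↑
  lead f v = ↓
  lead g u = ↓
  lead g v = ↑
  lead h u = ↓
  lead h v = ↑

block : Op → Label → Turn → Word
block t c ε = turnsOf (Γ t (kind c ε , ε))

-- The block that replaces a turn leads through the copies of its square, from the leading one for
-- the incoming move to the leading one for the outgoing move.
CopyFacts : Op → Turn → Label → Set
CopyFacts t ε c =
  trace (stepᴹ t) (relabelEdge t c) (shiftMat t (leading t c)) (block t c ε) ≡ map (shiftMat t) (sites (relabelEdge t c) (block t c ε)) ×
  end (stepᴹ t) (relabelEdge t c) (shiftMat t (leading t c)) (block t c ε) ≡ A (moveLabel (turn ε c)) +ᴹ shiftMat t (leading t (turn ε c))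

abstract
  copyFacts : ∀ t ε c → CopyFacts t ε c
  copyFacts f ↑ = ∀₈ (refl , refl) (refl , refl) (refl , refl) (refl , refl) (refl , refl) (refl , refl) (refl , refl) (refl , refl)
  copyFacts f ↓ = ∀₈ (refl , refl) (refl , refl) (refl , refl) (refl , refl) (refl , refl) (refl , refl) (refl , refl) (refl , refl)
  copyFacts g ↑ = ∀₈ (refl , refl) (refl , refl) (refl , refl) (refl , refl) (refl , refl) (refl , refl) (refl , refl) (refl , refl)
  copyFacts g ↓ = ∀₈ (refl , refl) (refl , refl) (refl , refl) (refl , refl) (refl , refl) (refl , refl) (refl , refl) (refl , refl)
  copyFacts h ↑ = ∀₈ (refl , refl) (refl , refl) (refl , refl) (refl , refl) (refl , refl) (refl , refl) (refl , refl) (refl , refl)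
  copyFacts h ↓ = ∀₈ (refl , refl) (refl , refl) (refl , refl) (refl , refl) (refl , refl) (refl , refl) (refl , refl) (refl , refl)

newSites : Op → Label → Turn → List Dir
newSites t c ε = sites (relabelEdge t c) (block t c ε)

-- A square in section site c ε has copies in the sections of directions newSites t c ε of the
-- larger frame, which are different, and in no others.
SiteFacts : Op → Turn → Label → Set
SiteFacts t ε c =
  All (λ i → WithinR (shiftMat t i) (section (site c ε)) (pull t (section i))) (newSites t c ε) ×
  Unique (newSites t c ε) ×
  (∀ i → i ∈ newSites t c ε ⊎ ApartR (shiftMat t i) (section (site c ε)) (pull t (section i)))

siteFacts? : ∀ t ε → Dec (∀ c → SiteFacts t ε c)
siteFacts? t ε = all? λ c →
  All.all? (λ i → withinR? (shiftMat t i) (section (site c ε)) (pull t (section i))) (newSites t c ε) ×-dec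
  unique? (newSites t c ε) ×-dec
  all? λ i → (i ∈? newSites t c ε) ⊎-dec apartR? (shiftMat t i) (section (site c ε)) (pull t (section i))

abstract
  siteFacts : ∀ t ε c → SiteFacts t ε c
  siteFacts f ↑ = from-yes (siteFacts? f ↑)
  siteFacts f ↓ = from-yes (siteFacts? f ↓)
  siteFacts g ↑ = from-yes (siteFacts? g ↑)
  siteFacts g ↓ = from-yes (siteFacts? g ↓)
  siteFacts h ↑ = from-yes (siteFacts? h ↑)
  siteFacts h ↓ = from-yes (siteFacts? h ↓)

InSection : Proportions → Visit → Set
InSection F x = Section F (siteOf x) (squareOf x)

section-unique : ∀ {F} → Proper F → ∀ i j z → Section F i z → Section F j z → i ≡ j
section-unique {F} pr i j z si sj with sections-apart i j
... | inj₁ eq = eq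
... | inj₂ ap = ⊥-elim (apartR pr 0ᴹ (section i) (section j) ap (section⇒ F i si)
    (subst (InRegion F (section j)) (sym (⊞-0 z)) (section⇒ F j sj)))
  where
  ⊞-0 : ∀ z → z ⊞ apply 0ᴹ F ≡ z
  ⊞-0 (x , y) = cong₂ _,_ (ℤₚ.+-identityʳ x) (ℤₚ.+-identityʳ y)

map≡⇒All : ∀ {X Y : Set} {p q : X → Y} xs → map p xs ≡ map q xs → All (λ x → p x ≡ q x) xs
map≡⇒All []       _  = []
map≡⇒All (x ∷ xs) eq = let e , es = ∷-injective eq in e ∷ map≡⇒All xs es

visits-positions : ∀ V (st : Label → Mat ℤ → Mat ℤ) (φ : Mat ℤ → Square) → (∀ c K → φ (st c K) ≡ φ K ⊞ V c) →
  ∀ (position : Dir → Mat ℤ) c K w → trace st c K w ≡ map position (sites c w) →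
  All (λ x → squareOf x ≡ φ (position (siteOf x))) (visits V c (φ K) w)
visits-positions V st φ natural position c K w eq = map≡⇒All (visits V c (φ K) w) (begin
  map squareOf (visits V c (φ K) w)       ≡⟨ map-squareOf V c (φ K) w ⟩
  trace (walk V) c (φ K) w                ≡⟨ trace-map {stepX = st} φ natural c K w ⟩
  map φ (trace st c K w)                  ≡⟨ cong (map φ) eq ⟩
  map φ (map position (sites c w))        ≡⟨ map-∘ (sites c w) ⟨
  map (λ i → φ (position i)) (sites c w)  ≡⟨ cong (map (λ i → φ (position i))) (map-siteOf V c (φ K) w) ⟨
  map (λ i → φ (position i)) (map siteOf (visits V c (φ K) w))
                                          ≡⟨ map-∘ (visits V c (φ K) w) ⟨
  map (λ x → φ (position (siteOf x))) (visits V c (φ K) w) ∎)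
  where open ≡-Reasoning

unique-squares : ∀ {F} → Proper F → ∀ xs → All (InSection F) xs → Unique (map siteOf xs) → Unique (map squareOf xs)
unique-squares pr []       []       []       = []
unique-squares {F} pr (x ∷ xs) (s ∷ ss) (n ∷ ns) = Allₚ.map⁺ (distinct xs ss (Allₚ.map⁻ n)) ∷ unique-squares pr xs ss ns
  where
  distinct : ∀ ys → All (InSection F) ys → All (λ y → siteOf x ≢ siteOf y) ys → All (λ y → squareOf x ≢ squareOf y) ys
  distinct []       []       []       = []
  distinct (y ∷ ys) (s′ ∷ ss) (n ∷ ns) =
    (λ eq → n (section-unique pr (siteOf x) (siteOf y) (squareOf x) s (subst (Section F (siteOf y)) (sym eq) s′))) ∷ distinct ys ss ns

unique-concatMap : ∀ {X Y Z : Set} (p : X → Y) (q : Z → Y) (k : X → List Z) xs → Unique (map p xs) →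
  (∀ {x} → x ∈ xs → Unique (map q (k x))) →
  (∀ {x y z z′} → x ∈ xs → y ∈ xs → z ∈ k x → z′ ∈ k y → q z ≡ q z′ → p x ≡ p y) →
  Unique (map q (concatMap k xs))
unique-concatMap p q k []       _        _  _ = []
unique-concatMap p q k (x ∷ xs) (n ∷ ns) uk inj = subst Unique (sym (map-++ q (k x) (concatMap k xs)))
  (Uniqueₚ.++⁺ (uk (here refl))
    (unique-concatMap p q k xs ns (λ m → uk (there m)) (λ m m′ → inj (there m) (there m′)))
    λ (m , m′) → disjoint m m′)
  where
  disjoint : ∀ {y} → y ∈ map q (k x) → y ∈ map q (concatMap k xs) → ⊥
  disjoint m m′ with ∈-map⁻ q m | ∈-map⁻ q m′
  ... | z , zk , refl | z′ , zk′ , eq with find (∈-concatMap⁻ k {xs = xs} zk′)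
  ...   | x′ , x′∈ , z′∈ = All.lookup (Allₚ.map⁻ n) x′∈ (inj (here refl) (there x′∈) zk z′∈ eq)

-- A cycle over the squares of S within an F-frame, given by its walk from a square a that is
-- entered by a move labelled c.
record FirstCycle (F : Proportions) (S : Pred Square 0ℓ) (c : Label) (a : Square) (w : List Letter) : Set where
  path : List Visit
  path = visits (moves₁ F) c a (turnsOf w)
  field
    fits        : Fits c w
    closedLabel : turns (turnsOf w) c ≡ c
    closed      : end (walk (moves₁ F)) c a (turnsOf w) ≡ a
    inSections  : All (InSection F) path
    unique      : Unique (map squareOf path)
    sound       : ∀ {z} → z ∈ map squareOf path → S z
    complete    : ∀ {z} → S z → z ∈ map squareOf path

module _ (t : Op) {F : Proportions} (pr : Proper F) where
  private
    F′ : Proportions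
    F′ = grow t F
    pr′ : Proper F′
    pr′ = proper-grow t pr
    V′ : Label → Square
    V′ = moves₁ F′

  copy : Visit → List Visit
  copy (c , ε , z) = visits V′ (relabelEdge t c) (z ⊞ shift t F (leading t c)) (block t c ε)

  copy-nat : ∀ z c K → z ⊞ apply (stepᴹ t c K) F ≡ walk V′ c (z ⊞ apply K F)
  copy-nat z c K = begin
    z ⊞ apply (K +ᴹ (A (moveLabel c) ∙ᴹ growth t)) F      ≡⟨ cong (z ⊞_) (apply-+ K (A (moveLabel c) ∙ᴹ growth t) F) ⟨
    z ⊞ (apply K F ⊞ apply (A (moveLabel c) ∙ᴹ growth t) F) ≡⟨ cong (λ v → z ⊞ (apply K F ⊞ v)) (apply-grow (A (moveLabel c)) t pr) ⟨
    z ⊞ (apply K F ⊞ V′ c)                                ≡⟨ ⊞-assoc z (apply K F) (V′ c) ⟨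
    (z ⊞ apply K F) ⊞ V′ c                                ∎
    where open ≡-Reasoning

  start≡ : ∀ z i → z ⊞ apply (shiftMat t i) F ≡ z ⊞ shift t F i
  start≡ z i = cong (z ⊞_) (sym (shift≡ t F i))

  map-siteOf-copy : ∀ x → map siteOf (copy x) ≡ newSites t (proj₁ x) (proj₁ (proj₂ x))
  map-siteOf-copy (c , ε , z) = map-siteOf V′ (relabelEdge t c) (z ⊞ shift t F (leading t c)) (block t c ε)

  copy-shifts : ∀ x → All (λ y → squareOf y ≡ squareOf x ⊞ shift t F (siteOf y)) (copy x)
  copy-shifts x@(c , ε , z) =
    All.map (λ {y} eq → trans eq (start≡ z (siteOf y)))
      (subst (λ a → All (λ y → squareOf y ≡ z ⊞ apply (shiftMat t (siteOf y)) F) (visits V′ (relabelEdge t c) a (block t c ε)))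
        (start≡ z (leading t c))
        (visits-positions V′ (stepᴹ t) (λ K → z ⊞ apply K F) (copy-nat z) (shiftMat t)
          (relabelEdge t c) (shiftMat t (leading t c)) (block t c ε) (proj₁ (copyFacts t ε c))))

  copy-end : ∀ c ε z → end (walk V′) (relabelEdge t c) (z ⊞ shift t F (leading t c)) (block t c ε)
                       ≡ (z ⊞ moves₁ F (turn ε c)) ⊞ shift t F (leading t (turn ε c))
  copy-end c ε z = begin
    end (walk V′) c′ (z ⊞ shift t F (leading t c)) w
      ≡⟨ cong (λ y → end (walk V′) c′ y w) (start≡ z (leading t c)) ⟨
    end (walk V′) c′ (z ⊞ apply (shiftMat t (leading t c)) F) w
      ≡⟨ end-map {stepX = stepᴹ t} (λ K → z ⊞ apply K F) (copy-nat z) c′ (shiftMat t (leading t c)) w ⟩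
    z ⊞ apply (end (stepᴹ t) c′ (shiftMat t (leading t c)) w) F
      ≡⟨ cong (λ K → z ⊞ apply K F) (proj₂ (copyFacts t ε c)) ⟩
    z ⊞ apply (A (moveLabel d) +ᴹ shiftMat t (leading t d)) F
      ≡⟨ cong (z ⊞_) (apply-+ (A (moveLabel d)) (shiftMat t (leading t d)) F) ⟨
    z ⊞ (moves₁ F d ⊞ apply (shiftMat t (leading t d)) F)
      ≡⟨ ⊞-assoc z (moves₁ F d) (apply (shiftMat t (leading t d)) F) ⟨
    (z ⊞ moves₁ F d) ⊞ apply (shiftMat t (leading t d)) F
      ≡⟨ start≡ (z ⊞ moves₁ F d) (leading t d) ⟩
    (z ⊞ moves₁ F d) ⊞ shift t F (leading t d) ∎
    where
    open ≡-Reasoning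
    c′ = relabelEdge t c
    w  = block t c ε
    d  = turn ε c

  visits-lift : ∀ c a w → Fits c w →
    visits V′ (relabelEdge t c) (a ⊞ shift t F (leading t c)) (turnsOf (concatMap (Γ t) w))
      ≡ concatMap copy (visits (moves₁ F) c a (turnsOf w)) ×
    end (walk V′) (relabelEdge t c) (a ⊞ shift t F (leading t c)) (turnsOf (concatMap (Γ t) w))
      ≡ end (walk (moves₁ F)) c a (turnsOf w) ⊞ shift t F (leading t (turns (turnsOf w) c))
  visits-lift c a []            _           = refl , refl
  visits-lift c a ((k , ε) ∷ w) (refl , fw) =
    (begin
      visits V′ c′ a′ (turnsOf (Γ t (k , ε) ++ concatMap (Γ t) w))
        ≡⟨ cong (visits V′ c′ a′) (turnsOf-++ (Γ t (k , ε)) (concatMap (Γ t) w)) ⟩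
      visits V′ c′ a′ (block t c ε ++ rest)
        ≡⟨ visits-++ V′ c′ a′ (block t c ε) rest ⟩
      copy (c , ε , a) ++ visits V′ (turns (block t c ε) c′) (end (walk V′) c′ a′ (block t c ε)) rest
        ≡⟨ cong₂ (λ d b → copy (c , ε , a) ++ visits V′ d b rest) (turns-Γ₁ t ε c) (copy-end c ε a) ⟩
      copy (c , ε , a) ++ visits V′ (relabelEdge t d) (b ⊞ shift t F (leading t d)) rest
        ≡⟨ cong (copy (c , ε , a) ++_) (proj₁ IH) ⟩
      copy (c , ε , a) ++ concatMap copy (visits (moves₁ F) d b (turnsOf w)) ∎) ,
    (begin
      end (walk V′) c′ a′ (turnsOf (Γ t (k , ε) ++ concatMap (Γ t) w))
        ≡⟨ cong (end (walk V′) c′ a′) (turnsOf-++ (Γ t (k , ε)) (concatMap (Γ t) w)) ⟩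
      end (walk V′) c′ a′ (block t c ε ++ rest)
        ≡⟨ end-++ (walk V′) c′ a′ (block t c ε) rest ⟩
      end (walk V′) (turns (block t c ε) c′) (end (walk V′) c′ a′ (block t c ε)) rest
        ≡⟨ cong₂ (λ d b → end (walk V′) d b rest) (turns-Γ₁ t ε c) (copy-end c ε a) ⟩
      end (walk V′) (relabelEdge t d) (b ⊞ shift t F (leading t d)) rest
        ≡⟨ proj₂ IH ⟩
      end (walk (moves₁ F)) d b (turnsOf w) ⊞ shift t F (leading t (turns (turnsOf w) d)) ∎)
    where
    open ≡-Reasoning
    c′ = relabelEdge t c
    a′ = a ⊞ shift t F (leading t c)
    d  = turn ε c
    b  = a ⊞ moves₁ F d
    rest = turnsOf (concatMap (Γ t) w)
    IH = visits-lift d b w fw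

  section-lift⇒ : ∀ i j z → WithinR (shiftMat t j) (section i) (pull t (section j)) → Section F i z → Section F′ j (z ⊞ shift t F j)
  section-lift⇒ i j z wi s = section⇐ F′ j (pull⇐ t (section j) pr
    (subst (InRegion F (pull t (section j))) (start≡ z j)
      (withinR pr (shiftMat t j) (section i) (pull t (section j)) wi (section⇒ F i s))))

  section-apart : ∀ i j z → ApartR (shiftMat t j) (section i) (pull t (section j)) → Section F i z → Section F′ j (z ⊞ shift t F j) → ⊥
  section-apart i j z ap s s′ = apartR pr (shiftMat t j) (section i) (pull t (section j)) ap (section⇒ F i s)
    (subst (InRegion F (pull t (section j))) (sym (start≡ z j)) (pull⇒ t (section j) pr (section⇒ F′ j s′)))

  copy-sections : ∀ x → InSection F x → All (InSection F′) (copy x)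
  copy-sections x@(c , ε , z) s = All.zipWith (λ {y} (wi , eq) →
      subst (Section F′ (siteOf y)) (sym eq) (section-lift⇒ (site c ε) (siteOf y) z wi s))
    (Allₚ.map⁻ (subst (All _) (sym (map-siteOf-copy x)) (proj₁ (siteFacts t ε c))) , copy-shifts x)

  copy-complete : ∀ x i → InSection F x → Section F′ i (squareOf x ⊞ shift t F i) →
                  (squareOf x ⊞ shift t F i) ∈ map squareOf (copy x)
  copy-complete x@(c , ε , z) i s s′ with proj₂ (proj₂ (siteFacts t ε c)) i
  ... | inj₂ ap = ⊥-elim (section-apart (site c ε) i z ap s s′)
  ... | inj₁ i∈ = found (∈-map⁻ siteOf (subst (i ∈_) (sym (map-siteOf-copy x)) i∈))
    where
    found : (∃ λ y → y ∈ copy x × i ≡ siteOf y) → (z ⊞ shift t F i) ∈ map squareOf (copy x)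
    found (y , y∈ , refl) = subst (_∈ map squareOf (copy x)) (All.lookup (copy-shifts x) y∈) (∈-map⁺ squareOf y∈)

  -- Lifting of the squares and lifting of the walk agree.
  liftFirst : ∀ {S c a w} → FirstCycle F S c a w →
    FirstCycle F′ (lift t F S) (relabelEdge t c) (a ⊞ shift t F (leading t c)) (concatMap (Γ t) w)
  liftFirst {S} {c} {a} {w} C = record
    { fits = fits-Γ t c w fits
    ; closedLabel = trans (turns-Γ t c w fits) (cong (relabelEdge t) closedLabel)
    ; closed = trans (proj₂ (visits-lift c a w fits)) (cong₂ (λ b d → b ⊞ shift t F (leading t d)) closed closedLabel)
    ; inSections = subst (All (InSection F′)) (sym path≡) (Allₚ.concat⁺ (Allₚ.map⁺ (All.map (λ {x} → copy-sections x) inSections)))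
    ; unique = subst (λ xs → Unique (map squareOf xs)) (sym path≡)
        (unique-concatMap squareOf squareOf copy path unique uniqueCopy same)
    ; sound = λ z∈ → sound′ (subst (λ xs → _ ∈ map squareOf xs) path≡ z∈)
    ; complete = λ lz → subst (λ xs → _ ∈ map squareOf xs) (sym path≡) (complete′ lz)
    }
    where
    open FirstCycle C
    path≡ = proj₁ (visits-lift c a w fits)
    sec : ∀ {x} → x ∈ path → InSection F x
    sec = All.lookup inSections
    uniqueCopy : ∀ {x} → x ∈ path → Unique (map squareOf (copy x))
    uniqueCopy {x} x∈ = unique-squares pr′ (copy x) (copy-sections x (sec x∈))
      (subst Unique (sym (map-siteOf-copy x)) (proj₁ (proj₂ (siteFacts t (proj₁ (proj₂ x)) (proj₁ x)))))
    ⊞-cancel : ∀ {a b} s → a ⊞ s ≡ b ⊞ s → a ≡ b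
    ⊞-cancel {a} {b} s eq = trans (sym (⊞-⊟ a s)) (trans (cong (_⊟ s) eq) (⊞-⊟ b s))
    same : ∀ {x y z z′} → x ∈ path → y ∈ path → z ∈ copy x → z′ ∈ copy y → squareOf z ≡ squareOf z′ → squareOf x ≡ squareOf y
    same {x} {y} {z} {z′} x∈ y∈ z∈ z′∈ eq = ⊞-cancel (shift t F (siteOf z)) (begin
      squareOf x ⊞ shift t F (siteOf z)     ≡⟨ All.lookup (copy-shifts x) z∈ ⟨
      squareOf z                            ≡⟨ eq ⟩
      squareOf z′                           ≡⟨ All.lookup (copy-shifts y) z′∈ ⟩
      squareOf y ⊞ shift t F (siteOf z′)    ≡⟨ cong (λ i → squareOf y ⊞ shift t F i) site≡ ⟨
      squareOf y ⊞ shift t F (siteOf z)     ∎)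
      where
      open ≡-Reasoning
      site≡ : siteOf z ≡ siteOf z′
      site≡ = section-unique pr′ (siteOf z) (siteOf z′) (squareOf z) (All.lookup (copy-sections x (sec x∈)) z∈)
        (subst (Section F′ (siteOf z′)) (sym eq) (All.lookup (copy-sections y (sec y∈)) z′∈))
    sound′ : ∀ {z} → z ∈ map squareOf (concatMap copy path) → lift t F S z
    sound′ z∈ with ∈-map⁻ squareOf z∈
    ... | y , y∈ , refl with find (∈-concatMap⁻ copy {xs = path} y∈)
    ...   | x , x∈ , y∈′ = siteOf y ,
            subst S (sym (trans (cong (_⊟ shift t F (siteOf y)) (All.lookup (copy-shifts x) y∈′)) (⊞-⊟ (squareOf x) (shift t F (siteOf y)))))
              (sound (∈-map⁺ squareOf x∈)) ,
            All.lookup (copy-sections x (sec x∈)) y∈′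
    complete′ : ∀ {z} → lift t F S z → z ∈ map squareOf (concatMap copy path)
    complete′ {z} (i , sz , s′) with ∈-map⁻ squareOf (complete sz)
    ... | x , x∈ , eq with ∈-map⁻ squareOf (copy-complete x i (sec x∈) (subst (Section F′ i) z≡ s′))
      where
      z≡ : z ≡ squareOf x ⊞ shift t F i
      z≡ = trans (sym (⊟-⊞ z (shift t F i))) (cong (_⊞ shift t F i) eq)
    ...   | y , y∈ , eq′ = subst (_∈ map squareOf (concatMap copy path))
              (trans (sym eq′) (trans (cong (_⊞ shift t F i) (sym eq)) (⊟-⊞ z (shift t F i))))
              (∈-map⁺ squareOf (∈-concatMap⁺ copy (lose x∈ y∈)))

-- The square at which the lifted walk begins.
leadingAll : List Op → Proportions → Label → Square → Square
leadingAll []      F c a = a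
leadingAll (t ∷ e) F c a = leadingAll e F c a ⊞ shift t (growAll e F) (leading t (relabelEdges e c))

liftFirstAll : ∀ e {F} → Proper F → ∀ {S c a w} → FirstCycle F S c a w →
  FirstCycle (growAll e F) (liftAll e F S) (relabelEdges e c) (leadingAll e F c a) (expand e w)
liftFirstAll []      pr C = C
liftFirstAll (t ∷ e) pr C = liftFirst t (proper-growAll e pr) (liftFirstAll e pr C)

-- Cyclic lists and their graphs

-- The pairs of neighbours in the list that consists of x, xs and z.
links : {X : Set} → X → List X → X → List (X × X)
links x xs z = zip (x ∷ xs) (xs ∷ʳ z)

links-++ : ∀ {X : Set} (x : X) xs y ys z → links x (xs ++ y ∷ ys) z ≡ links x xs y ++ links y ys z
links-++ x []        y ys z = refl
links-++ x (x′ ∷ xs) y ys z = cong ((x , x′) ∷_) (links-++ x′ xs y ys z)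

cyclicPairs-rotate : ∀ {X : Set} (xs ys : List X) {p} → p ∈ cyclicPairs (xs ++ ys) → p ∈ cyclicPairs (ys ++ xs)
cyclicPairs-rotate []       ys {p} p∈ = subst (λ zs → p ∈ cyclicPairs zs) (sym (++-identityʳ ys)) p∈
cyclicPairs-rotate (x ∷ xs) [] {p} p∈ = subst (λ zs → p ∈ cyclicPairs zs) (++-identityʳ (x ∷ xs)) p∈
cyclicPairs-rotate (x ∷ xs) (y ∷ ys) {p} p∈ =
  subst (p ∈_) (sym (links-++ y ys x xs y))
    ([ ∈-++⁺ʳ (links y ys x) , ∈-++⁺ˡ ]′ (∈-++⁻ (links x xs y) (subst (p ∈_) (links-++ x xs y ys x) p∈)))

links-map : ∀ {X Y : Set} (k : X → Y) x xs z → links (k x) (map k xs) (k z) ≡ map (Product.map k k) (links x xs z)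
links-map k x []       z = refl
links-map k x (y ∷ xs) z = cong ((k x , k y) ∷_) (links-map k y xs z)

cyclicPairs-map : ∀ {X Y : Set} (k : X → Y) xs → cyclicPairs (map k xs) ≡ map (Product.map k k) (cyclicPairs xs)
cyclicPairs-map k []       = refl
cyclicPairs-map k (x ∷ xs) = links-map k x xs x

∈-links : ∀ {X : Set} {x z : X} xs {a b} → (a , b) ∈ links x xs z → a ∈ x ∷ xs × (b ∈ xs ⊎ b ≡ z)
∈-links []       (here refl) = here refl , inj₂ refl
∈-links (y ∷ xs) (here refl) = here refl , inj₁ (here refl)
∈-links (y ∷ xs) (there m) with ∈-links xs m
... | a∈ , inj₁ b∈ = there a∈ , inj₁ (there b∈)
... | a∈ , inj₂ eq = there a∈ , inj₂ eq

∈-cyclicPairs : ∀ {X : Set} (xs : List X) {a b} → (a , b) ∈ cyclicPairs xs → a ∈ xs × b ∈ xs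
∈-cyclicPairs (x ∷ xs) m with ∈-links xs m
... | a∈ , inj₁ b∈ = a∈ , there b∈
... | a∈ , inj₂ refl = a∈ , here refl

-- Neighbours in a cyclic list.
Near : {X : Set} → List X → X → X → Set
Near xs a b = (a , b) ∈ cyclicPairs xs ⊎ (b , a) ∈ cyclicPairs xs

near-∈ : ∀ {X : Set} {xs : List X} {a b} → Near xs a b → a ∈ xs × b ∈ xs
near-∈ {xs = xs} (inj₁ m) = ∈-cyclicPairs xs m
near-∈ {xs = xs} (inj₂ m) = Product.swap (∈-cyclicPairs xs m)

unique-++-comm : ∀ {X : Set} (xs ys : List X) → Unique (xs ++ ys) → Unique (ys ++ xs)
unique-++-comm xs ys un = let uxs , uys , d = split xs un in Uniqueₚ.++⁺ uys uxs λ (p , q) → d (q , p)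
  where
  split : ∀ us {vs} → Unique (us ++ vs) → Unique us × Unique vs × Disjoint us vs
  split []       un = [] , un , λ { (() , _) }
  split (x ∷ us) (n ∷ un) with split us un
  ... | uus , uvs , d = (Allₚ.++⁻ˡ us n ∷ uus) , uvs ,
    λ { (here refl , m) → All.lookup (Allₚ.++⁻ʳ us n) m refl ; (there m′ , m) → d (m′ , m) }

link-last : ∀ {X : Set} (y : X) ys z → ∃ λ b → b ∈ y ∷ ys × (b , z) ∈ links y ys z
link-last y []        z = y , here refl , here refl
link-last y (y′ ∷ ys) z = let b , b∈ , m = link-last y′ ys z in b , there b∈ , there m

two-neighbours : ∀ {X : Set} (xs : List X) → Unique xs → 3 ℕ.≤ length xs → ∀ {a} → a ∈ xs →
  ∃₂ λ b b′ → b ≢ b′ × (a , b) ∈ cyclicPairs xs × (b′ , a) ∈ cyclicPairs xs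
two-neighbours xs un long {a} a∈ with ∈-∃++ a∈
... | ys , zs , refl = main (zs ++ ys) (unique-++-comm ys (a ∷ zs) un) len
  (λ m → cyclicPairs-rotate (a ∷ zs) ys m)
  where
  len : 2 ℕ.≤ length (zs ++ ys)
  len = ℕₚ.≤-pred (subst (3 ℕ.≤_) eq long)
    where
    eq : length (ys ++ a ∷ zs) ≡ ℕ.suc (length (zs ++ ys))
    eq = trans (length-++ ys) (trans (ℕₚ.+-suc (length ys) (length zs)) (cong ℕ.suc (trans (ℕₚ.+-comm (length ys) (length zs)) (sym (length-++ zs)))))
  main : ∀ r → Unique (a ∷ r) → 2 ℕ.≤ length r → (∀ {p} → p ∈ links a r a → p ∈ cyclicPairs (ys ++ a ∷ zs)) →
    ∃₂ λ b b′ → b ≢ b′ × (a , b) ∈ cyclicPairs (ys ++ a ∷ zs) × (b′ , a) ∈ cyclicPairs (ys ++ a ∷ zs)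
  main (b ∷ [])    _  (s≤s ()) _
  main (b ∷ c ∷ r) (_ ∷ (n ∷ _)) _ back =
    let b′ , b′∈ , m = link-last c r a in
    b , b′ , (λ { refl → All.lookup n b′∈ refl }) , back (here refl) , back (there (there m))

-- If the only candidates for neighbours of a are x and y, then both are neighbours of a, as its two
-- neighbours are different.
both-near : ∀ {X : Set} (xs : List X) → Unique xs → 3 ℕ.≤ length xs → ∀ {a x y} → a ∈ xs →
  (∀ {b} → Near xs a b → b ≡ x ⊎ b ≡ y) → Near xs a x × Near xs a y
both-near xs un long a∈ nbrs with two-neighbours xs un long a∈
... | b , b′ , b≢b′ , ab , b′a with nbrs (inj₁ ab) | nbrs (inj₂ b′a)
...   | inj₁ refl | inj₁ refl = ⊥-elim (b≢b′ refl)
...   | inj₁ refl | inj₂ refl = inj₁ ab , inj₂ b′a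
...   | inj₂ refl | inj₁ refl = inj₂ b′a , inj₁ ab
...   | inj₂ refl | inj₂ refl = ⊥-elim (b≢b′ refl)

module _ {X : Set} (st : Label → X → X) where
  links-trace : ∀ c x w → All (λ (p , q) → ∃ λ d → q ≡ st d p)
                              (links x (trace st c (st c x) w) (end st c (st c x) w))
  links-trace c x []      = (c , refl) ∷ []
  links-trace c x (ε ∷ w) = (c , refl) ∷ links-trace (turn ε c) (st c x) w

  cyclic-trace : ∀ c x w → end st c x w ≡ x → All (λ (p , q) → ∃ λ d → q ≡ st d p) (cyclicPairs (trace st c x w))
  cyclic-trace c x []      _  = []
  cyclic-trace c x (ε ∷ w) eq = subst (λ z → All (λ (p , q) → ∃ λ d → q ≡ st d p) (links x (trace st (turn ε c) (st (turn ε c) x) w) z)) eq (links-trace (turn ε c) x w)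

unique-injective : ∀ {X Y : Set} (k : X → Y) {xs} → Unique (map k xs) → ∀ {x y} → x ∈ xs → y ∈ xs → k x ≡ k y → x ≡ y
unique-injective k (n ∷ un) (here refl) (here refl) _  = refl
unique-injective k (n ∷ un) (here refl) (there m)   eq = ⊥-elim (All.lookup n (∈-map⁺ k m) eq)
unique-injective k (n ∷ un) (there m)   (here refl) eq = ⊥-elim (All.lookup n (∈-map⁺ k m) (sym eq))
unique-injective k (n ∷ un) (there m)   (there m′)  eq = unique-injective k un m m′ eq

near-map⁻ : ∀ {X Y : Set} (k : X → Y) {xs} → Unique (map k xs) → ∀ {p q} → p ∈ xs → q ∈ xs → Near (map k xs) (k p) (k q) → Near xs p q
near-map⁻ k {xs} un {p} {q} p∈ q∈ = Sum.map (back p∈ q∈) (back q∈ p∈)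
  where
  back : ∀ {p q} → p ∈ xs → q ∈ xs → (k p , k q) ∈ cyclicPairs (map k xs) → (p , q) ∈ cyclicPairs xs
  back {p} {q} p∈ q∈ m with ∈-map⁻ (Product.map k k) (subst ((k p , k q) ∈_) (cyclicPairs-map k xs) m)
  ... | (p′ , q′) , m′ , eq =
    let p′∈ , q′∈ = ∈-cyclicPairs xs m′ in
    subst₂ (λ a b → (a , b) ∈ cyclicPairs xs)
      (unique-injective k un p′∈ p∈ (sym (cong proj₁ eq))) (unique-injective k un q′∈ q∈ (sym (cong proj₂ eq))) m′

near-map⁺ : ∀ {X Y : Set} (k : X → Y) xs {p q} → Near xs p q → Near (map k xs) (k p) (k q)
near-map⁺ k xs = Sum.map forth forth
  where
  forth : ∀ {p q} → (p , q) ∈ cyclicPairs xs → (k p , k q) ∈ cyclicPairs (map k xs)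
  forth m = subst (_ ∈_) (sym (cyclicPairs-map k xs)) (∈-map⁺ (Product.map k k) m)

Σ-∈-≡ : ∀ {X : Set} {xs : List X} → Unique xs → {p q : Σ X (_∈ xs)} → proj₁ p ≡ proj₁ q → p ≡ q
Σ-∈-≡ un {x , m} {.x , m′} refl = cong (x ,_) (unique⇒irrelevant un m m′)

-- An isomorphism that changes the labels of arcs by π.
record RelabelIso (π : Permutation′ 8) (Φ Ψ : LabelledDigraph) : Set where
  field
    bijection : Vertex Φ ↔ Vertex Ψ
  open Inverse bijection public
  field
    arcs      : ∀ a i b → Arc Φ a i b ⇔ Arc Ψ (to a) (π ⟨$⟩ʳ i) (to b)

module _ {X Y : Set} (ps : List (X × Y)) (un₁ : Unique (map proj₁ ps)) (un₂ : Unique (map proj₂ ps)) where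
  -- A list of pairs without repetitions on either side relates the two sides one to one.
  cross : Σ X (_∈ map proj₁ ps) ↔ Σ Y (_∈ map proj₂ ps)
  cross = mk↔ₛ′ to from to-from from-to
    where
    to : Σ X (_∈ map proj₁ ps) → Σ Y (_∈ map proj₂ ps)
    to (x , m) = let p , p∈ , _ = ∈-map⁻ proj₁ m in proj₂ p , ∈-map⁺ proj₂ p∈
    from : Σ Y (_∈ map proj₂ ps) → Σ X (_∈ map proj₁ ps)
    from (y , m) = let p , p∈ , _ = ∈-map⁻ proj₂ m in proj₁ p , ∈-map⁺ proj₁ p∈
    to-from : ∀ b → to (from b) ≡ b
    to-from (y , m) with ∈-map⁻ proj₂ m
    ... | p , p∈ , refl with ∈-map⁻ proj₁ (∈-map⁺ proj₁ p∈)
    ...   | q , q∈ , eq = Σ-∈-≡ un₂ (cong proj₂ (unique-injective proj₁ un₁ q∈ p∈ (sym eq)))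
    from-to : ∀ a → from (to a) ≡ a
    from-to (x , m) with ∈-map⁻ proj₁ m
    ... | p , p∈ , refl with ∈-map⁻ proj₂ (∈-map⁺ proj₂ p∈)
    ...   | q , q∈ , eq = Σ-∈-≡ un₁ (cong proj₁ (unique-injective proj₂ un₂ q∈ p∈ (sym eq)))

  cross-∈ : ∀ x → ∃ λ p → p ∈ ps × proj₁ x ≡ proj₁ p × proj₁ (Inverse.to cross x) ≡ proj₂ p
  cross-∈ (x , m) with ∈-map⁻ proj₁ m
  ... | p , p∈ , eq = p , p∈ , eq , refl

-- Directions of moves and neighbouring squares

-- A sufficient condition for a form to be positive.
Pos : Form → Set
Pos (a , b) = (0ℤ ℤ.< a ℤ.+ b × 0ℤ ℤ.≤ b) ⊎ (0ℤ ℤ.≤ a ℤ.+ b × 0ℤ ℤ.< b)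

pos? : ∀ q → Dec (Pos q)
pos? (a , b) = ((0ℤ ℤₚ.<? a ℤ.+ b) ×-dec (0ℤ ℤₚ.≤? b)) ⊎-dec ((0ℤ ℤₚ.≤? a ℤ.+ b) ×-dec (0ℤ ℤₚ.<? b))

pos-* : ∀ {a k} → 0ℤ ℤ.< a → 0 ℕ.< k → 0ℤ ℤ.< a ℤ.* + k
pos-* {+ suc a} {suc k} _ _ = subst (0ℤ ℤ.<_) (ℤₚ.pos-* (suc a) (suc k)) (ℤ.+<+ (ℕ.s≤s ℕ.z≤n))
pos-* {+ 0} (ℤ.+<+ ())

eval-pos : ∀ q {F} → Proper F → Pos q → 0ℤ ℤ.< eval q F
eval-pos q@(a , b) {F@(m , n)} pr@(proper 0<m m<n) p = subst (0ℤ ℤ.<_) (sym (eval-basis q pr)) (sum p)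
  where
  sum : Pos (a , b) → 0ℤ ℤ.< (a ℤ.+ b) ℤ.* + m ℤ.+ b ℤ.* + (n ℕ.∸ m)
  sum (inj₁ (p , q)) = ℤₚ.+-mono-<-≤ (pos-* p 0<m) (nonNeg-* (n ℕ.∸ m) q)
  sum (inj₂ (p , q)) = ℤₚ.+-mono-≤-< (nonNeg-* m p) (pos-* q (ℕₚ.m<n⇒0<n∸m m<n))

-- A sufficient condition for two linear maps to take different values.
Separated : Mat ℤ → Mat ℤ → Set
Separated K L = (Pos (row₁ K ⊖ row₁ L) ⊎ Pos (row₁ L ⊖ row₁ K)) ⊎ (Pos (row₂ K ⊖ row₂ L) ⊎ Pos (row₂ L ⊖ row₂ K))

separated? : ∀ K L → Dec (Separated K L)
separated? K L = (pos? (row₁ K ⊖ row₁ L) ⊎-dec pos? (row₁ L ⊖ row₁ K)) ⊎-dec (pos? (row₂ K ⊖ row₂ L) ⊎-dec pos? (row₂ L ⊖ row₂ K))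

abstract
  directions-separated : ∀ i j → i ≡ j ⊎ Separated (A i) (A j)
  directions-separated = from-yes (all? λ i → all? λ j → (i ≟ᶠ j) ⊎-dec separated? (A i) (A j))

eval-≢ : ∀ p q {F} → Proper F → Pos (p ⊖ q) → eval p F ≢ eval q F
eval-≢ p@(a , b) q@(c , d) {F@(m , n)} pr pos eq = ℤₚ.<-irrefl (sym (begin
  eval (p ⊖ q) F          ≡⟨ lem a b c d (+ m) (+ n) ⟩
  eval p F ℤ.- eval q F   ≡⟨ cong (ℤ._- eval q F) eq ⟩
  eval q F ℤ.- eval q F   ≡⟨ ℤₚ.+-inverseʳ (eval q F) ⟩
  0ℤ                      ∎)) (eval-pos (p ⊖ q) pr pos)
  where
  open ≡-Reasoning
  lem : ∀ a b c d m n → (a ℤ.- c) ℤ.* m ℤ.+ (b ℤ.- d) ℤ.* n ≡ (a ℤ.* m ℤ.+ b ℤ.* n) ℤ.- (c ℤ.* m ℤ.+ d ℤ.* n)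
  lem = solve-∀

apply-rows : ∀ K F → apply K F ≡ (eval (row₁ K) F , eval (row₂ K) F)
apply-rows (mat _ _ _ _) F = refl

direction-unique : ∀ {F} → Proper F → ∀ i j → apply (A i) F ≡ apply (A j) F → i ≡ j
direction-unique {F} pr i j eq with directions-separated i j
... | inj₁ i≡j = i≡j
... | inj₂ s   = ⊥-elim (absurd s)
  where
  rows : (eval (row₁ (A i)) F , eval (row₂ (A i)) F) ≡ (eval (row₁ (A j)) F , eval (row₂ (A j)) F)
  rows = trans (sym (apply-rows (A i) F)) (trans eq (apply-rows (A j) F))
  absurd : Separated (A i) (A j) → ⊥
  absurd (inj₁ (inj₁ p)) = eval-≢ (row₁ (A i)) (row₁ (A j)) pr p (cong proj₁ rows)
  absurd (inj₁ (inj₂ p)) = eval-≢ (row₁ (A j)) (row₁ (A i)) pr p (sym (cong proj₁ rows))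
  absurd (inj₂ (inj₁ p)) = eval-≢ (row₂ (A i)) (row₂ (A j)) pr p (cong proj₂ rows)
  absurd (inj₂ (inj₂ p)) = eval-≢ (row₂ (A j)) (row₂ (A i)) pr p (sym (cong proj₂ rows))

A-opp : ∀ l → A (opp l) +ᴹ A l ≡ 0ᴹ
A-opp = ∀₈ refl refl refl refl refl refl refl refl

apply-opp : ∀ F l a → a ⊞ apply (A (opp l)) F ≡ a ⊟ apply (A l) F
apply-opp F l a = begin
  a ⊞ r                  ≡⟨ lem a s r ⟩
  (a ⊞ (r ⊞ s)) ⊟ s      ≡⟨ cong (λ x → (a ⊞ x) ⊟ s) (trans (apply-+ (A (opp l)) (A l) F) (cong (λ K → apply K F) (A-opp l))) ⟩
  (a ⊞ (0ℤ , 0ℤ)) ⊟ s    ≡⟨ cong (_⊟ s) (cong₂ _,_ (ℤₚ.+-identityʳ (proj₁ a)) (ℤₚ.+-identityʳ (proj₂ a))) ⟩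
  a ⊟ s                  ∎
  where
  open ≡-Reasoning
  s r : Square
  s = apply (A l) F
  r = apply (A (opp l)) F
  eq : ∀ a s r → a ℤ.+ r ≡ (a ℤ.+ (r ℤ.+ s)) ℤ.- s
  eq = solve-∀
  lem : ∀ a s r → a ⊞ r ≡ (a ⊞ (r ⊞ s)) ⊟ s
  lem (a , a′) (s , s′) (r , r′) = cong₂ _,_ (eq a s r) (eq a′ s′ r′)

-- b is a move of the leaper away from a.
Joined : Proportions → Square → Square → Set
Joined F a b = ∃ λ l → b ≡ a ⊞ apply (A l) F

joined-sym : ∀ {F a b} → Joined F a b → Joined F b a
joined-sym {F} {a} (l , refl) = opp l , sym (trans (apply-opp F l (a ⊞ apply (A l) F)) (⊞-⊟ a (apply (A l) F)))

∣∣-cases : ∀ {x k} → ℤ.∣ x ∣ ≡ k → x ≡ + k ⊎ x ≡ ℤ.- + k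
∣∣-cases {+ x}        refl = inj₁ refl
∣∣-cases { ℤ.-[1+ x ]} refl = inj₂ refl

isMove-direction : ∀ {F s} → IsMove F s → ∃ λ l → s ≡ apply (A l) F
isMove-direction {m , n} {x , y} (inj₁ (p , q)) with ∣∣-cases {x} p | ∣∣-cases {y} q
... | inj₁ refl | inj₁ refl = 1F , cong₂ _,_ (form-m (+ m) (+ n)) (form-n (+ m) (+ n))
... | inj₁ refl | inj₂ refl = 6F , cong₂ _,_ (form-m (+ m) (+ n)) (form--n (+ m) (+ n))
... | inj₂ refl | inj₁ refl = 2F , cong₂ _,_ (form--m (+ m) (+ n)) (form-n (+ m) (+ n))
... | inj₂ refl | inj₂ refl = 5F , cong₂ _,_ (form--m (+ m) (+ n)) (form--n (+ m) (+ n))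
isMove-direction {m , n} {x , y} (inj₂ (p , q)) with ∣∣-cases {x} p | ∣∣-cases {y} q
... | inj₁ refl | inj₁ refl = 0F , cong₂ _,_ (form-n (+ m) (+ n)) (form-m (+ m) (+ n))
... | inj₁ refl | inj₂ refl = 7F , cong₂ _,_ (form-n (+ m) (+ n)) (form--m (+ m) (+ n))
... | inj₂ refl | inj₁ refl = 3F , cong₂ _,_ (form--n (+ m) (+ n)) (form-m (+ m) (+ n))
... | inj₂ refl | inj₂ refl = 4F , cong₂ _,_ (form--n (+ m) (+ n)) (form--m (+ m) (+ n))

adjacent-joined : ∀ {F a b} → Adjacent F a b → Joined F a b
adjacent-joined {F} {a} {b} adj = let l , eq = isMove-direction {F} {b ⊟ a} adj in
  l , trans (lem a b) (cong (a ⊞_) eq)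
  where
  eq : ∀ a b → b ≡ a ℤ.+ (b ℤ.- a)
  eq = solve-∀
  lem : ∀ a b → b ≡ a ⊞ (b ⊟ a)
  lem (a , a′) (b , b′) = cong₂ _,_ (eq a b) (eq a′ b′)

near-joined : ∀ {F} zs → All (λ (a , b) → Joined F a b) (cyclicPairs zs) → ∀ {a b} → Near zs a b → Joined F a b
near-joined zs js (inj₁ m) = All.lookup js m
near-joined zs js (inj₂ m) = joined-sym (All.lookup js m)

cycle-joined : ∀ {F B zs} → IsCycle F B zs → All (λ (a , b) → Joined F a b) (cyclicPairs zs)
cycle-joined C = All.map (λ {p} → adjacent-joined {a = proj₁ p} {proj₂ p}) (IsCycle.moves C)

InFrame : Proportions → Square → Set
InFrame F z = ∃ λ i → Section F i z

-- The move by which section i is entered by a walk that turns ↑ there.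
edgeOf : Dir → Label
edgeOf = moveLabel

site-edgeOf : ∀ i → site (edgeOf i) ↑ ≡ i
site-edgeOf = ∀₈ refl refl refl refl refl refl refl refl

next₁ next₂ : Proportions → Dir → Square → Square
next₁ F i z = z ⊞ apply (A (moveLabel (turn ↑ (edgeOf i)))) F
next₂ F i z = z ⊞ apply (A (moveLabel (opp (edgeOf i)))) F

neighbours : ∀ {F} → Proper F → ∀ i {z b} → Section F i z → InFrame F b → Joined F z b → b ≡ next₁ F i z ⊎ b ≡ next₂ F i z
neighbours {F} pr i {z} sz (j , sb) (l , refl) with degree-two (edgeOf i) l j
... | inj₁ (inj₁ refl) = inj₁ refl
... | inj₁ (inj₂ refl) = inj₂ refl
... | inj₂ ap = ⊥-elim (apartR pr (A l) (section (site (edgeOf i) ↑)) (section j) ap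
        (subst (λ k → InRegion F (section k) z) (sym (site-edgeOf i)) (section⇒ F i sz)) (section⇒ F j sb))

-- As a square has only two neighbours, two cycles over the same squares have the same pairs of
-- neighbours.
near-transfer : ∀ {F} → Proper F → ∀ xs ys → Unique ys → 3 ℕ.≤ length ys →
  All (λ (a , b) → Joined F a b) (cyclicPairs xs) → All (λ (a , b) → Joined F a b) (cyclicPairs ys) →
  (∀ {z} → z ∈ xs → z ∈ ys) → (∀ {z} → z ∈ ys → InFrame F z) →
  ∀ {a b} → Near xs a b → Near ys a b
near-transfer {F} pr xs ys un long jx jy xs⊆ys fr {a} {b} nr with near-∈ {xs = xs} nr
... | a∈ , b∈ with fr (xs⊆ys a∈)
...   | i , s with both-near ys un long {x = next₁ F i a} {next₂ F i a} (xs⊆ys a∈)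
                 (λ n → neighbours pr i s (fr (proj₂ (near-∈ {xs = ys} n))) (near-joined ys jy n))
...     | n₁ , n₂ with neighbours pr i s (fr (xs⊆ys b∈)) (near-joined xs jx nr)
...       | inj₁ refl = n₁
...       | inj₂ refl = n₂

-- Shell cycles

centreForm : Parity → ℤ × ℤ
centreForm 0ℙ = -1ℤ , 1ℤ
centreForm 1ℙ = 1ℤ , 0ℤ

-- The centres of the eight subboards of a shell: (n - m) unitVec i for i even, m unitVec i for i
-- odd, whichever of the two descriptions of the shell applies.
centre : Dir → Mat ℤ
centre i = outer (centreForm (parity (toℕ i))) (unitVec (toℕ i))

-- 3m - n and its negative.
kForm -kForm : Form
kForm  = + 3 , -1ℤ
-kForm = ℤ.- + 3 , 1ℤ

square : Form → Form → Region
square a b = (a , b) , (a , b)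

-- Whichever of n - m and 3m - n is the smaller one is the side of the subboards. The square p is
-- in a subboard of that side centred at the origin.
record Central (F : Proportions) (p : Square) : Set where
  field
    inD : InRegion F (square -inner inner) p
    inK : InRegion F (square -kForm kForm) p

-- Mixed bounds: a central square meets all of them.
dd dk kd kk : Interval
dd = -inner , inner
dk = -inner , kForm
kd = -kForm , inner
kk = -kForm , kForm

AnyWithin : Form → Interval → Set
AnyWithin o J = (Within o dd J ⊎ Within o dk J) ⊎ (Within o kd J ⊎ Within o kk J)

anyWithin? : ∀ o J → Dec (AnyWithin o J)
anyWithin? o J = (within? o dd J ⊎-dec within? o dk J) ⊎-dec (within? o kd J ⊎-dec within? o kk J)

anyWithin : ∀ {F} → Proper F → ∀ o J {x} → AnyWithin o J → InInterval F dd x → InInterval F kk x → InInterval F J (x ℤ.+ eval o F)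
anyWithin pr o J (inj₁ (inj₁ wi)) d k = within pr o dd J wi d
anyWithin pr o J (inj₁ (inj₂ wi)) d k = within pr o dk J wi (proj₁ d , proj₂ k)
anyWithin pr o J (inj₂ (inj₁ wi)) d k = within pr o kd J wi (proj₁ k , proj₂ d)
anyWithin pr o J (inj₂ (inj₂ wi)) d k = within pr o kk J wi k

abstract
  centre-within : ∀ i → AnyWithin (row₁ (centre i)) (proj₁ (section i)) × AnyWithin (row₂ (centre i)) (proj₂ (section i))
  centre-within = from-yes (all? λ i → anyWithin? (row₁ (centre i)) (proj₁ (section i)) ×-dec anyWithin? (row₂ (centre i)) (proj₂ (section i)))

⊞-apply : ∀ z K F → z ⊞ apply K F ≡ (proj₁ z ℤ.+ eval (row₁ K) F , proj₂ z ℤ.+ eval (row₂ K) F)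
⊞-apply z K F = cong (z ⊞_) (apply-rows K F)

central-section : ∀ {F p} → Proper F → Central F p → ∀ i → Section F i (p ⊞ apply (centre i) F)
central-section {F} {p} pr C i = section⇐ F i (subst (InRegion F (section i)) (sym (⊞-apply p (centre i) F))
  (anyWithin pr (row₁ (centre i)) (proj₁ (section i)) (proj₁ (centre-within i)) (proj₁ inD) (proj₁ inK) ,
   anyWithin pr (row₂ (centre i)) (proj₂ (section i)) (proj₂ (centre-within i)) (proj₂ inD) (proj₂ inK)))
  where open Central C

-- The subboards for n at most 2m, and those for n at least 2m.
sub₁ sub₂ : Dir → Region
sub₁ i = regions ((inner , (ℤ.- + 3 , + 3)) , (-inner , inner)) (square (+ 3 , -1ℤ) outerᶠ) (toℕ i)
sub₂ i = regions (((ℤ.- + 5 , + 3) , outerᶠ) , (-kForm , kForm)) (square inner (+ 5 , -1ℤ)) (toℕ i)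

-centre : Dir → Mat ℤ
-centre i = mapMat ℤ.-_ (centre i)

abstract
  sub₁-centre : ∀ i → WithinR (-centre i) (sub₁ i) (square -inner inner)
  sub₁-centre = from-yes (all? λ i → withinR? (-centre i) (sub₁ i) (square -inner inner))
  sub₂-centre : ∀ i → WithinR (-centre i) (sub₂ i) (square -kForm kForm)
  sub₂-centre = from-yes (all? λ i → withinR? (-centre i) (sub₂ i) (square -kForm kForm))

square-mono : ∀ F a b c d {z} → eval c F ℤ.≤ eval a F → eval b F ℤ.≤ eval d F → InRegion F (square a b) z → InRegion F (square c d) z
square-mono F a b c d lo hi ((p , q) , (r , s)) =
  (ℤₚ.≤-<-trans lo p , ℤₚ.<-≤-trans q hi) , (ℤₚ.≤-<-trans lo r , ℤₚ.<-≤-trans s hi)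

k-d : ∀ m n → ((+ 3 ℤ.* m ℤ.+ -1ℤ ℤ.* n) ℤ.- (-1ℤ ℤ.* m ℤ.+ 1ℤ ℤ.* n)) ≡ + 2 ℤ.* (+ 2 ℤ.* m ℤ.- n)
k-d = solve-∀

d-k : ∀ m n → ((-1ℤ ℤ.* m ℤ.+ 1ℤ ℤ.* n) ℤ.- (+ 3 ℤ.* m ℤ.+ -1ℤ ℤ.* n)) ≡ + 2 ℤ.* (n ℤ.- + 2 ℤ.* m)
d-k = solve-∀

neg-d : ∀ m n → ℤ.- (-1ℤ ℤ.* m ℤ.+ 1ℤ ℤ.* n) ≡ 1ℤ ℤ.* m ℤ.+ -1ℤ ℤ.* n
neg-d = solve-∀

neg-k : ∀ m n → ℤ.- (+ 3 ℤ.* m ℤ.+ -1ℤ ℤ.* n) ≡ ℤ.- + 3 ℤ.* m ℤ.+ 1ℤ ℤ.* n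
neg-k = solve-∀

d≤k : ∀ m n → n ℕ.≤ 2 ℕ.* m → eval inner (m , n) ℤ.≤ eval kForm (m , n)
d≤k m n n≤2m = ℤₚ.0≤i-j⇒j≤i (subst (0ℤ ℤ.≤_) (sym (k-d (+ m) (+ n)))
  (ℤₚ.*-monoˡ-≤-nonNeg (+ 2) (ℤₚ.i≤j⇒0≤j-i (subst (+ n ℤ.≤_) (ℤₚ.pos-* 2 m) (ℤ.+≤+ n≤2m)))))

k≤d : ∀ m n → 2 ℕ.* m ℕ.≤ n → eval kForm (m , n) ℤ.≤ eval inner (m , n)
k≤d m n 2m≤n = ℤₚ.0≤i-j⇒j≤i (subst (0ℤ ℤ.≤_) (sym (d-k (+ m) (+ n)))
  (ℤₚ.*-monoˡ-≤-nonNeg (+ 2) (ℤₚ.i≤j⇒0≤j-i (subst (ℤ._≤ + n) (ℤₚ.pos-* 2 m) (ℤ.+≤+ 2m≤n)))))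

apply-- : ∀ K F z → z ⊞ apply (mapMat ℤ.-_ K) F ≡ z ⊟ apply K F
apply-- (mat a b c d) (m , n) (x , y) = cong₂ _,_ (lem a b x (+ m) (+ n)) (lem c d y (+ m) (+ n))
  where
  lem : ∀ a b x m n → x ℤ.+ (ℤ.- a ℤ.* m ℤ.+ ℤ.- b ℤ.* n) ≡ x ℤ.- (a ℤ.* m ℤ.+ b ℤ.* n)
  lem = solve-∀

shell-central : ∀ {F} → Proper F → ∀ {z} → Shell F z → ∃ λ i → Central F (z ⊟ apply (centre i) F)
shell-central {F@(m , n)} pr {z} (inj₁ (n≤2m , i , s)) = i , record { inD = inD ; inK = square-mono F -inner inner -kForm kForm
    (subst₂ ℤ._≤_ (neg-k (+ m) (+ n)) (neg-d (+ m) (+ n)) (ℤₚ.neg-mono-≤ (d≤k m n n≤2m))) (d≤k m n n≤2m) inD }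
  where
  three : ∀ m n → ℤ.- + 3 ℤ.* m ℤ.+ + 3 ℤ.* n ≡ (n ℤ.- m) ℤ.+ + 2 ℤ.* (n ℤ.- m)
  three = solve-∀
  corner : ∀ m n → + 3 ℤ.* m ℤ.+ -1ℤ ℤ.* n ≡ (n ℤ.+ m) ℤ.- + 2 ℤ.* (n ℤ.- m)
  corner = solve-∀
  inSub : InRegion F (sub₁ i) z
  inSub = rotations⇒ F
    (box⇒ F inner (ℤ.- + 3 , + 3) -inner inner (inner≡ (+ m) (+ n)) (three (+ m) (+ n)) (-inner≡ (+ m) (+ n)) (inner≡ (+ m) (+ n)))
    (box⇒ F (+ 3 , -1ℤ) outerᶠ (+ 3 , -1ℤ) outerᶠ (corner (+ m) (+ n)) (outer≡ (+ m) (+ n)) (corner (+ m) (+ n)) (outer≡ (+ m) (+ n)))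
    (toℕ i) s
  inD : InRegion F (square -inner inner) (z ⊟ apply (centre i) F)
  inD = subst (InRegion F (square -inner inner)) (apply-- (centre i) F z)
    (withinR pr (-centre i) (sub₁ i) (square -inner inner) (sub₁-centre i) inSub)
shell-central {F@(m , n)} pr {z} (inj₂ (2m≤n , _ , i , s)) = i , record { inK = inK ; inD = square-mono F -kForm kForm -inner inner
    (subst₂ ℤ._≤_ (neg-d (+ m) (+ n)) (neg-k (+ m) (+ n)) (ℤₚ.neg-mono-≤ (k≤d m n 2m≤n))) (k≤d m n 2m≤n) inK }
  where
  +3* : + (3 ℕ.* m) ≡ + 3 ℤ.* + m
  +3* = ℤₚ.pos-* 3 m
  k≡ : ∀ m n → + 3 ℤ.* m ℤ.+ -1ℤ ℤ.* n ≡ + 3 ℤ.* m ℤ.- n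
  k≡ = solve-∀
  side : ∀ m n → ℤ.- + 5 ℤ.* m ℤ.+ + 3 ℤ.* n ≡ (n ℤ.+ m) ℤ.- + 2 ℤ.* (+ 3 ℤ.* m ℤ.- n)
  side = solve-∀
  corner : ∀ m n → + 5 ℤ.* m ℤ.+ -1ℤ ℤ.* n ≡ (n ℤ.- m) ℤ.+ + 2 ℤ.* (+ 3 ℤ.* m ℤ.- n)
  corner = solve-∀
  -k≡ : ∀ m n → ℤ.- + 3 ℤ.* m ℤ.+ 1ℤ ℤ.* n ≡ ℤ.- (+ 3 ℤ.* m ℤ.- n)
  -k≡ = solve-∀
  with3 : ∀ {x : ℤ} (e : ℤ → ℤ) → x ≡ e (+ 3 ℤ.* + m) → x ≡ e (+ (3 ℕ.* m))
  with3 {x} e = subst (λ y → x ≡ e y) (sym +3*)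
  inSub : InRegion F (sub₂ i) z
  inSub = rotations⇒ F
    (box⇒ F (ℤ.- + 5 , + 3) outerᶠ -kForm kForm
      (with3 (λ y → (+ n ℤ.+ + m) ℤ.- + 2 ℤ.* (y ℤ.- + n)) (side (+ m) (+ n))) (outer≡ (+ m) (+ n))
      (with3 (λ y → ℤ.- (y ℤ.- + n)) (-k≡ (+ m) (+ n))) (with3 (ℤ._- + n) (k≡ (+ m) (+ n))))
    (box⇒ F inner (+ 5 , -1ℤ) inner (+ 5 , -1ℤ)
      (inner≡ (+ m) (+ n)) (with3 (λ y → (+ n ℤ.- + m) ℤ.+ + 2 ℤ.* (y ℤ.- + n)) (corner (+ m) (+ n)))
      (inner≡ (+ m) (+ n)) (with3 (λ y → (+ n ℤ.- + m) ℤ.+ + 2 ℤ.* (y ℤ.- + n)) (corner (+ m) (+ n))))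
    (toℕ i) s
  inK : InRegion F (square -kForm kForm) (z ⊟ apply (centre i) F)
  inK = subst (InRegion F (square -kForm kForm)) (apply-- (centre i) F z)
    (withinR pr (-centre i) (sub₂ i) (square -kForm kForm) (sub₂-centre i) inSub)

-- The squares of a shell cycle: one and the same place in all eight subboards.
record Octagon (F : Proportions) (zs : List Square) : Set where
  field
    middle   : Square
    central  : Central F middle
  corner : Dir → Square
  corner i = middle ⊞ apply (centre i) F
  field
    complete : ∀ i → corner i ∈ zs
    sound    : ∀ {z} → z ∈ zs → ∃ λ i → z ≡ corner i

all-linked : ∀ {X : Set} (Q : X → Set) x xs z → (∀ {a b} → (a , b) ∈ links x xs z → Q a → Q b) → Q x → All Q (x ∷ xs)
all-linked Q x []       z step q = q ∷ []
all-linked Q x (y ∷ xs) z step q = q ∷ all-linked Q y xs z (λ m → step (there m)) (step (here refl) q)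

corner-next₁ : ∀ i → centre i +ᴹ A (moveLabel (turn ↑ (edgeOf i))) ≡ centre (i ⊕ 3)
corner-next₁ = ∀₈ refl refl refl refl refl refl refl refl

corner-next₂ : ∀ i → centre i +ᴹ A (moveLabel (opp (edgeOf i))) ≡ centre (i ⊕ 5)
corner-next₂ = ∀₈ refl refl refl refl refl refl refl refl

-- Adding 3 repeatedly leads from any direction to all of them.
orbit : ∀ (R : Dir → Set) → (∀ i → R i → R (i ⊕ 3)) → ∀ i → R i → ∀ j → R j
orbit R next i r = from-0 (∀₈ {λ i → R i → R 0F} (λ r → r) s₁ s₂ s₃ s₄ s₅ s₆ s₇ i r)
  where
  s₅ = next 5F
  s₂ = λ r → s₅ (next 2F r)
  s₇ = λ r → s₂ (next 7F r)
  s₄ = λ r → s₇ (next 4F r)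
  s₁ = λ r → s₄ (next 1F r)
  s₆ = λ r → s₁ (next 6F r)
  s₃ = λ r → s₆ (next 3F r)
  from-0 : R 0F → ∀ j → R j
  from-0 r₀ = ∀₈ r₀ r₁ r₂ r₃ r₄ r₅ r₆ r₇
    where
    r₃ = next 0F r₀
    r₆ = next 3F r₃
    r₁ = next 6F r₆
    r₄ = next 1F r₁
    r₇ = next 4F r₄
    r₂ = next 7F r₇
    r₅ = next 2F r₂

-- From a corner the cycle can only continue to the corners 3 and 5 directions further on, so that
-- it consists of corners, and as it does continue to both of them, it has all corners.
shell-octagon : ∀ {F zs} → Proper F → IsShellCycle F zs → Octagon F zs
shell-octagon {F} {zs = []} pr S with IsCycle.long (IsShellCycle.isCycle S)
... | ()
shell-octagon {F} {zs@(z₀ ∷ zs′)} pr S = record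
  { middle = p ; central = cen ; complete = orbit (λ i → corner i ∈ zs) next i₀ (subst (_∈ zs) z₀≡ (here refl)) ; sound = λ m → All.lookup sound m }
  where
  open IsShellCycle S
  open IsCycle isCycle
  first : ∃ λ i → Central F (z₀ ⊟ apply (centre i) F)
  first = shell-central pr (All.lookup inShell (here refl))
  i₀ : Dir
  i₀ = proj₁ first
  p : Square
  p = z₀ ⊟ apply (centre i₀) F
  cen : Central F p
  cen = proj₂ first
  corner : Dir → Square
  corner i = p ⊞ apply (centre i) F
  z₀≡ : z₀ ≡ corner i₀
  z₀≡ = sym (⊟-⊞ z₀ (apply (centre i₀) F))
  joins : All (λ (a , b) → Joined F a b) (cyclicPairs zs)
  joins = cycle-joined isCycle
  frame : ∀ {z} → z ∈ zs → InFrame F z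
  frame {z} m = let i , c = shell-central pr (All.lookup inShell m) in
    i , subst (Section F i) (⊟-⊞ z (apply (centre i) F)) (central-section pr c i)
  move≡ : ∀ i K j → centre i +ᴹ K ≡ centre j → corner i ⊞ apply K F ≡ corner j
  move≡ i K j eq = trans (⊞-assoc p (apply (centre i) F) (apply K F))
    (cong (p ⊞_) (trans (apply-+ (centre i) K F) (cong (λ M → apply M F) eq)))
  around : ∀ i {b} → Near zs (corner i) b → b ≡ corner (i ⊕ 3) ⊎ b ≡ corner (i ⊕ 5)
  around i {b} nr = Sum.map
    (λ eq → trans eq (move≡ i (A (moveLabel (turn ↑ (edgeOf i)))) (i ⊕ 3) (corner-next₁ i)))
    (λ eq → trans eq (move≡ i (A (moveLabel (opp (edgeOf i)))) (i ⊕ 5) (corner-next₂ i)))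
    (neighbours pr i (central-section pr cen i) (frame (proj₂ (near-∈ {xs = zs} nr))) (near-joined zs joins nr))
  sound : All (λ z → ∃ λ i → z ≡ corner i) zs
  sound = all-linked (λ z → ∃ λ i → z ≡ corner i) z₀ zs′ z₀ step (i₀ , z₀≡)
    where
    step : ∀ {a b} → (a , b) ∈ cyclicPairs zs → (∃ λ i → a ≡ corner i) → ∃ λ i → b ≡ corner i
    step m (i , refl) = [ (λ eq → i ⊕ 3 , eq) , (λ eq → i ⊕ 5 , eq) ]′ (around i (inj₁ m))
  next : ∀ i → corner i ∈ zs → corner (i ⊕ 3) ∈ zs
  next i m = proj₂ (near-∈ {xs = zs} (proj₁ (both-near zs simple long {y = corner (i ⊕ 5)} m (around i))))

-- The walks of a shell cycle and of its second leaper cycle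

-- The walk of a shell cycle turns ↑ at all eight squares.
oct : List Letter
oct = (u , ↑) ∷ (v , ↑) ∷ (u , ↑) ∷ (v , ↑) ∷ (u , ↑) ∷ (v , ↑) ∷ (u , ↑) ∷ (v , ↑) ∷ []

octᵗ : Word
octᵗ = turnsOf oct

octSites : List Dir
octSites = sites 7F octᵗ

stepᶜ : Label → Mat ℤ → Mat ℤ
stepᶜ c K = K +ᴹ A (moveLabel c)

oct-trace : trace stepᶜ 7F (centre 3F) octᵗ ≡ map centre octSites
oct-trace = refl

oct-end : end stepᶜ 7F (centre 3F) octᵗ ≡ centre 3F
oct-end = refl

abstract
  octSites-unique : Unique octSites
  octSites-unique = from-yes (unique? octSites)
  octSites-all : ∀ i → i ∈ octSites
  octSites-all = from-yes (all? λ i → i ∈? octSites)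

first-octagon : ∀ {F zs} → Proper F → (O : Octagon F zs) → FirstCycle F (_∈ zs) 7F (Octagon.corner O 3F) oct
first-octagon {F} {zs} pr O = record
  { fits = refl , refl , refl , refl , refl , refl , refl , refl , tt
  ; closedLabel = refl
  ; closed = trans (end-map {stepX = stepᶜ} {stepY = walk (moves₁ F)} (λ K → middle ⊞ apply K F) nat 7F (centre 3F) octᵗ) (cong (λ K → middle ⊞ apply K F) oct-end)
  ; inSections = sections
  ; unique = unique-squares pr vs sections (subst Unique (sym sites≡) octSites-unique)
  ; sound = snd
  ; complete = cmp
  }
  where
  open Octagon O
  vs : List Visit
  vs = visits (moves₁ F) 7F (corner 3F) octᵗ
  nat : ∀ c K → middle ⊞ apply (stepᶜ c K) F ≡ walk (moves₁ F) c (middle ⊞ apply K F)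
  nat c K = trans (cong (middle ⊞_) (sym (apply-+ K (A (moveLabel c)) F)))
                  (sym (⊞-assoc middle (apply K F) (moves₁ F c)))
  sites≡ : map siteOf vs ≡ octSites
  sites≡ = map-siteOf (moves₁ F) 7F (corner 3F) octᵗ
  corners : All (λ x → squareOf x ≡ corner (siteOf x)) vs
  corners = visits-positions (moves₁ F) stepᶜ (λ K → middle ⊞ apply K F) nat centre 7F (centre 3F) octᵗ oct-trace
  sections : All (InSection F) vs
  sections = All.map (λ {x} eq → subst (Section F (siteOf x)) (sym eq) (central-section pr central (siteOf x))) corners
  snd : ∀ {z} → z ∈ map squareOf vs → z ∈ zs
  snd m with ∈-map⁻ squareOf m
  ... | x , x∈ , refl = subst (_∈ zs) (sym (All.lookup corners x∈)) (Octagon.complete O (siteOf x))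
  cmp : ∀ {z} → z ∈ zs → z ∈ map squareOf vs
  cmp m with Octagon.sound O m
  ... | i , refl with ∈-map⁻ siteOf (subst (i ∈_) (sym sites≡) (octSites-all i))
  ...   | x , x∈ , refl = subst (_∈ map squareOf vs) (All.lookup corners x∈) (∈-map⁺ squareOf x∈)

-- The two possible origins of a second leaper cycle.
data Origin : Op → Set where
  isG : Origin g
  isH : Origin h

-- The direction of the move labelled c of a second leaper cycle, according to its origin.
secondLabel : ∀ {o} → Origin o → Label → Label
secondLabel isG c = c ⊕ amount (kind c ↑)
  where
  amount : Kind → ℕ
  amount u = 3
  amount v = 1
secondLabel isH c = c ⊕ 2

moves₂ : ∀ {o} → Origin o → Proportions → Label → Square
moves₂ o M c = apply (A (secondLabel o c)) M

moves₂-opp : ∀ {o} (w : Origin o) M c a → a ⊞ moves₂ w M (opp c) ≡ a ⊟ moves₂ w M c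
moves₂-opp w M c a = trans (cong (λ l → a ⊞ apply (A l) M) (lem w c)) (apply-opp M (secondLabel w c) a)
  where
  lem : ∀ {o} (w : Origin o) c → secondLabel w (opp c) ≡ opp (secondLabel w c)
  lem isG = ∀₈ refl refl refl refl refl refl refl refl
  lem isH = ∀₈ refl refl refl refl refl refl refl refl

moves₁-opp : ∀ F c a → a ⊞ moves₁ F (opp c) ≡ a ⊟ moves₁ F c
moves₁-opp F c a = trans (cong (λ l → a ⊞ apply (A l) F) (lem c)) (apply-opp F (moveLabel c) a)
  where
  lem : ∀ c → moveLabel (opp c) ≡ opp (moveLabel c)
  lem = ∀₈ refl refl refl refl refl refl refl refl

centre-step : ∀ {o} (w : Origin o) i → (centre i ∙ᴹ growth o) +ᴹ A (secondLabel w i) ≡ centre (i ⊕ 1) ∙ᴹ growth o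
centre-step isG = ∀₈ refl refl refl refl refl refl refl refl
centre-step isH = ∀₈ refl refl refl refl refl refl refl refl

centre-tie : ∀ i → centre (i ⊕ 3) +ᴹ A (i ⊕ 7) ≡ centre i
centre-tie = ∀₈ refl refl refl refl refl refl refl refl

i⊕7⊕1 : ∀ i → i ⊕ 7 ⊕ 1 ≡ i
i⊕7⊕1 = ∀₈ refl refl refl refl refl refl refl refl

i⊕2⊕1 : ∀ i → i ⊕ 2 ⊕ 1 ≡ i ⊕ 3
i⊕2⊕1 = ∀₈ refl refl refl refl refl refl refl refl

module SecondBase {o : Op} (w : Origin o) (M : Proportions) (pr : Proper M) where
  F : Proportions
  F = grow o M
  prF : Proper F
  prF = proper-grow o pr

  open SecondLift (moves₂ w M) (moves₂-opp w M)
  open Walks (moves₂ w M) (moves₂-opp w M)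

  module _ {zs : List Square} (O : Octagon F zs) where
    open Octagon O

    corner-step : ∀ i → corner i ⊞ moves₂ w M i ≡ corner (i ⊕ 1)
    corner-step i = begin
      (middle ⊞ apply (centre i) F) ⊞ moves₂ w M i       ≡⟨ ⊞-assoc middle (apply (centre i) F) (moves₂ w M i) ⟩
      middle ⊞ (apply (centre i) F ⊞ moves₂ w M i)       ≡⟨ cong (λ x → middle ⊞ (x ⊞ moves₂ w M i)) (apply-grow (centre i) o pr) ⟩
      middle ⊞ (apply (centre i ∙ᴹ growth o) M ⊞ moves₂ w M i)
                                                         ≡⟨ cong (middle ⊞_) (apply-+ (centre i ∙ᴹ growth o) (A (secondLabel w i)) M) ⟩
      middle ⊞ apply ((centre i ∙ᴹ growth o) +ᴹ A (secondLabel w i)) M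
                                                         ≡⟨ cong (λ K → middle ⊞ apply K M) (centre-step w i) ⟩
      middle ⊞ apply (centre (i ⊕ 1) ∙ᴹ growth o) M      ≡⟨ cong (middle ⊞_) (apply-grow (centre (i ⊕ 1)) o pr) ⟨
      corner (i ⊕ 1)                                     ∎
      where open ≡-Reasoning

    base-invariant : ∀ {base : Dir → Square} → (∀ i → base i ≡ corner i) → Invariant [] F (λ i → [ base i ])
    base-invariant {base} base≡ = record { node = λ i → corner (i ⊕ 1) ; path = path ; tie = tie }
      where
      par-U : ∀ p → U [] p ≡ [ ↑ ]
      par-U 0ℙ = refl
      par-U 1ℙ = refl
      path : ∀ i → Seg (i ⊕ 7) (corner (i ⊕ 7 ⊕ 1)) [ base i ] (U [] (parity (toℕ i))) i (corner (i ⊕ 1))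
      path i = seg-cast refl (cong corner (sym (i⊕7⊕1 i))) (sym (par-U (parity (toℕ i)))) refl refl
        (seg (cong [_] (sym (base≡ i))) (i⊕7⊕1 i)
          (trans (cong (λ c → corner i ⊞ moves₂ w M c) (i⊕7⊕1 i)) (corner-step i)))
      tie : ∀ i → corner (i ⊕ 1) ⊟ moves₂ w M i ≡ corner (i ⊕ 2 ⊕ 1) ⊞ apply (A (i ⊕ 7)) F
      tie i = begin
        corner (i ⊕ 1) ⊟ moves₂ w M i                    ≡⟨ cong (_⊟ moves₂ w M i) (corner-step i) ⟨
        (corner i ⊞ moves₂ w M i) ⊟ moves₂ w M i         ≡⟨ ⊞-⊟ (corner i) (moves₂ w M i) ⟩
        middle ⊞ apply (centre i) F                      ≡⟨ cong (λ K → middle ⊞ apply K F) (centre-tie i) ⟨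
        middle ⊞ apply (centre (i ⊕ 3) +ᴹ A (i ⊕ 7)) F   ≡⟨ cong (middle ⊞_) (apply-+ (centre (i ⊕ 3)) (A (i ⊕ 7)) F) ⟨
        middle ⊞ (apply (centre (i ⊕ 3)) F ⊞ apply (A (i ⊕ 7)) F)
                                                         ≡⟨ ⊞-assoc middle (apply (centre (i ⊕ 3)) F) (apply (A (i ⊕ 7)) F) ⟨
        corner (i ⊕ 3) ⊞ apply (A (i ⊕ 7)) F             ≡⟨ cong (λ j → corner j ⊞ apply (A (i ⊕ 7)) F) (i⊕2⊕1 i) ⟨
        corner (i ⊕ 2 ⊕ 1) ⊞ apply (A (i ⊕ 7)) F         ∎
        where open ≡-Reasoning

    base-corner : ∀ {base : Dir → Square} → (∀ i → base i ∈ zs) → (∀ i → Section F i (base i)) → ∀ i → base i ≡ corner i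
    base-corner {base} mem sec i with sound (mem i)
    ... | j , eq = trans eq (cong corner (section-unique prF j i (base i)
            (subst (Section F j) (sym eq) (central-section prF central j)) (sec i)))

-- Aligning the two walks

-- The word (XY)⁴.
octo : Word → Word → Word
octo X Y = X ++ Y ++ X ++ Y ++ X ++ Y ++ X ++ Y

-- The list path is the closed walk of word w whose first square is entered by a move labelled c.
record SecondTrace (V : Label → Square) (c : Label) (w : Word) (path : List Square) : Set where
  field
    start  : Square
    traced : trace (walk V) c start w ≡ path
    closed : end (walk V) c start w ≡ start

proper-12 : Proper (1 , 2)
proper-12 = proper (ℕ.s≤s ℕ.z≤n) (ℕ.s≤s (ℕ.s≤s ℕ.z≤n))

secondTrace : ∀ {o} (w : Origin o) t rest → rest ≡ o ∷ t → ∀ {core} → IsShellCycle (proportions rest) core →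
  ∀ (base : Dir → Square) → (∀ i → base i ∈ core) → (∀ i → Section (proportions rest) i (base i)) → ∀ e →
  Connected e ×
  SecondTrace (moves₂ w (proportions t)) (connect (twist e) 7F) (octo (U₀ e) (U₁ e))
    (concat (tabulate (liftAllPaths e (proportions rest) (λ i → [ base i ]))))
secondTrace {o} w t _ refl S base mem sec e = (λ i → Seg.label≡ (path i)) , record
  { start = node 7F ; traced = Seg.squares≡ around ; closed = Seg.end≡ around }
  where
  M : Proportions
  M = proportions t
  pr : Proper M
  pr = proper-growAll t proper-12
  open SecondBase w M pr
  open SecondLift (moves₂ w M) (moves₂-opp w M)
  open Walks (moves₂ w M) (moves₂-opp w M)
  O : Octagon F _
  O = shell-octagon prF S
  open Invariant (invariant e prF (base-invariant O (base-corner O mem sec)))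
  around : Seg (C 7F) (node 7F) _ (octo (U₀ e) (U₁ e)) (C 7F) (node 7F)
  around = seg-++ (path 0F) (seg-++ (path 1F) (seg-++ (path 2F) (seg-++ (path 3F)
    (seg-++ (path 4F) (seg-++ (path 5F) (seg-++ (path 6F) (seg-[] (path 7F))))))))

-- The squares zs are those of a closed walk of word w from a square entered by a move labelled c.
record FirstTrace (F : Proportions) (zs : List Square) (c : Label) (w : Word) : Set where
  field
    start       : Square
    closedLabel : turns w c ≡ c
    closed      : end (walk (moves₁ F)) c start w ≡ start
    unique      : Unique (trace (walk (moves₁ F)) c start w)
    sound       : ∀ {z} → z ∈ trace (walk (moves₁ F)) c start w → z ∈ zs
    complete    : ∀ {z} → z ∈ zs → z ∈ trace (walk (moves₁ F)) c start w

rotateTrace : ∀ {F zs c w} x y → w ≡ x ++ y → FirstTrace F zs c w → FirstTrace F zs (turns x c) (y ++ x)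
rotateTrace {F} {zs} {c} x y refl T = record
  { start = b
  ; closedLabel = trans (turns-++ y x d) (cong (turns x) back)
  ; closed = trans (end-++ st d b y x) (cong₂ (λ c a → end st c a x) back back′)
  ; unique = subst Unique (sym trace≡) (unique-++-comm tx ty (subst Unique (trace-++ st c start x y) unique))
  ; sound = λ m → sound (swap∈ m)
  ; complete = λ m → subst (_ ∈_) (sym trace≡) (flip∈ tx ty (subst (_ ∈_) (trace-++ st c start x y) (complete m)))
  }
  where
  open FirstTrace T
  st : Label → Square → Square
  st = walk (moves₁ F)
  d : Label
  d = turns x c
  b : Square
  b = end st c start x
  back : turns y d ≡ c
  back = trans (sym (turns-++ x y c)) closedLabel
  back′ : end st d b y ≡ start
  back′ = trans (sym (end-++ st c start x y)) closed
  tx ty : List Square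
  tx = trace st c start x
  ty = trace st d b y
  trace≡ : trace st d b (y ++ x) ≡ ty ++ tx
  trace≡ = trans (trace-++ st d b y x) (cong₂ (λ c a → ty ++ trace st c a x) back back′)
  flip∈ : ∀ us vs {z : Square} → z ∈ us ++ vs → z ∈ vs ++ us
  flip∈ us vs m = [ ∈-++⁺ʳ vs , ∈-++⁺ˡ ]′ (∈-++⁻ us m)
  swap∈ : ∀ {z} → z ∈ trace st d b (y ++ x) → z ∈ trace st c start (x ++ y)
  swap∈ {z} m = subst (z ∈_) (sym (trace-++ st c start x y)) (flip∈ ty tx (subst (z ∈_) trace≡ m))

leaper-growAll : ∀ {e} (C : CycleOfDescent e) → growAll e (proportions (CycleOfDescent.rest C)) ≡ CycleOfDescent.leaper C
leaper-growAll {e} C = trans (sym (foldr-++ grow (1 , 2) e (CycleOfDescent.rest C))) (CycleOfDescent.descent C)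

firstTrace : ∀ {e} (C : CycleOfDescent e) →
  FirstTrace (growAll e (proportions (CycleOfDescent.rest C))) (CycleOfDescent.squares C) (relabelEdges e 7F) (images e oct) ×
  (∀ {z} → z ∈ CycleOfDescent.squares C → InFrame (growAll e (proportions (CycleOfDescent.rest C))) z)
firstTrace {e} C = record
  { start = _
  ; closedLabel = FC.closedLabel
  ; closed = FC.closed
  ; unique = subst Unique trace≡ FC.unique
  ; sound = λ m → proj₂ lifted (FC.sound (subst (_ ∈_) (sym trace≡) m))
  ; complete = λ m → subst (_ ∈_) trace≡ (FC.complete (proj₁ lifted m))
  } , frame
  where
  open CycleOfDescent C
  pr : Proper (proportions rest)
  pr = proper-growAll rest proper-12
  FC₀ = liftFirstAll e pr (first-octagon pr (shell-octagon pr isShell))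
  module FC = FirstCycle FC₀
  trace≡ = map-squareOf (moves₁ (growAll e (proportions rest))) (relabelEdges e 7F)
             (leadingAll e (proportions rest) 7F (Octagon.corner (shell-octagon pr isShell) 3F)) (images e oct)
  frame : ∀ {z} → z ∈ squares → InFrame (growAll e (proportions rest)) z
  frame m with ∈-map⁻ squareOf (FC.complete (proj₁ lifted m))
  ... | x , x∈ , refl = siteOf x , All.lookup FC.inSections x∈

images-oct : ∀ e → images e oct ≡ octo (image e (u , ↑)) (image e (v , ↑))
images-oct e =
  then (u , ↑) (then (v , ↑) (then (u , ↑) (then (v , ↑) (then (u , ↑) (then (v , ↑) (then (u , ↑) refl))))))
  where
  then : ∀ x {y ys w} → images e (y ∷ ys) ≡ w → images e (x ∷ y ∷ ys) ≡ image e x ++ w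
  then x {y} {ys} eq = trans (images-∷ e x (y ∷ ys)) (cong (image e x ++_) eq)

turns-then : ∀ x y c d {d′} → turns x c ≡ d → turns y d ≡ d′ → turns (x ++ y) c ≡ d′
turns-then x y c _ refl refl = turns-++ x y c

module Align {F : Proportions} {zs : List Square} (e : List Op) (con : ∀ e → Connected e) where
  private
    X Y : Word
    X = U₀ e
    Y = U₁ e
    b : Bool
    b = twist e
    M = ++-monoid Turn

  -- (u v)⁴ and (U₀ U₁)⁴ are rotations of each other: by y if u = y U₀ ỹ and U₁ = ỹ v y, and by ỹ in
  -- the opposite direction if v = y U₁ ỹ and U₀ = ỹ u y.
  to-target : FirstTrace F zs (edges e 7F) (octo (uʷ e) (vʷ e)) → FirstTrace F zs (target b 7F) (octo X Y)
  to-target T = from (aligned con e)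
    where
    lem₀ : ∀ y X z b → octo (y ++ X ++ z) b ≡
           y ++ (X ++ z ++ b ++ (y ++ X ++ z) ++ b ++ (y ++ X ++ z) ++ b ++ (y ++ X ++ z) ++ b)
    lem₀ y X z b = solve M
    lem₀′ : ∀ y X z b → (X ++ z ++ b ++ (y ++ X ++ z) ++ b ++ (y ++ X ++ z) ++ b ++ (y ++ X ++ z) ++ b) ++ y
            ≡ octo X (z ++ b ++ y)
    lem₀′ y X z b = solve M
    lem₁ : ∀ y X z b → octo b (y ++ X ++ z) ≡
           (b ++ y ++ X ++ (z ++ b ++ y) ++ X ++ (z ++ b ++ y) ++ X ++ (z ++ b ++ y) ++ X) ++ z
    lem₁ y X z b = solve M
    lem₁′ : ∀ y X z b → z ++ (b ++ y ++ X ++ (z ++ b ++ y) ++ X ++ (z ++ b ++ y) ++ X ++ (z ++ b ++ y) ++ X)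
            ≡ octo (z ++ b ++ y) X
    lem₁′ y X z b = solve M
    from : Aligned e → FirstTrace F zs (target b 7F) (octo X Y)
    from (case₀ refl refl R lab) = subst₂ (FirstTrace F zs) (lab 7F refl)
      (trans (lem₀′ y X z (vʷ e)) (cong (octo X) (sym Y≡)))
      (rotateTrace y _ (trans (cong (λ a → octo a (vʷ e)) a≡) (lem₀ y X z (vʷ e))) T)
      where
      open Conjugated R using (y; a≡; Y≡)
      z = reverse y
    from (case₁ refl refl R lab) = subst₂ (FirstTrace F zs) label
      (trans (lem₁′ y Y z (uʷ e)) (cong (λ W → octo W Y) (sym Y≡)))
      (rotateTrace P z (trans (cong (octo (uʷ e)) a≡) (lem₁ y Y z (uʷ e))) T)
      where
      open Conjugated R using (y; a≡; Y≡)
      z = reverse y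
      P = uʷ e ++ y ++ Y ++ (z ++ uʷ e ++ y) ++ Y ++ (z ++ uʷ e ++ y) ++ Y ++ (z ++ uʷ e ++ y) ++ Y
      even : ∀ c → kind c ↑ ≡ u → turns (z ++ uʷ e ++ y) (target b c) ≡ target b (turn ↑ c)
      even c odd = trans (cong (λ W → turns W (target b c)) (sym Y≡)) (turns-target₀ e (con e) c odd)
      label : turns P (edges e 7F) ≡ target b 7F
      label =
        turns-then (uʷ e) _ (edges e 7F) (edges e 0F) (turns-u e 7F refl) (
        turns-then y _ (edges e 0F) (target b 0F) (lab 0F refl) (
        turns-then Y _ (target b 0F) (target b 1F) (turns-target₁ e (con e) 0F refl) (
        turns-then (z ++ uʷ e ++ y) _ (target b 1F) (target b 2F) (even 1F refl) (
        turns-then Y _ (target b 2F) (target b 3F) (turns-target₁ e (con e) 2F refl) (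
        turns-then (z ++ uʷ e ++ y) _ (target b 3F) (target b 4F) (even 3F refl) (
        turns-then Y _ (target b 4F) (target b 5F) (turns-target₁ e (con e) 4F refl) (
        turns-then (z ++ uʷ e ++ y) _ (target b 5F) (target b 6F) (even 5F refl)
          (turns-target₁ e (con e) 6F refl))))))))

  -- If the labels are opposite to those of the second cycle, rotating by half of the word makes them
  -- equal.
  to-connect : FirstTrace F zs (target b 7F) (octo X Y) → FirstTrace F zs (connect b 7F) (octo X Y)
  to-connect T = by b refl
    where
    half : ∀ X Y → octo X Y ≡ (X ++ Y ++ X ++ Y) ++ (X ++ Y ++ X ++ Y)
    half X Y = solve M
    label : turns (X ++ Y ++ X ++ Y) (target b 7F) ≡ target b 3F
    label =
      turns-then X _ (target b 7F) (target b 0F) (turns-target₀ e (con e) 7F refl) (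
      turns-then Y _ (target b 0F) (target b 1F) (turns-target₁ e (con e) 0F refl) (
      turns-then X _ (target b 1F) (target b 2F) (turns-target₀ e (con e) 1F refl)
        (turns-target₁ e (con e) 2F refl)))
    by : ∀ b′ → b ≡ b′ → FirstTrace F zs (connect b 7F) (octo X Y)
    by false eq = subst (λ c → FirstTrace F zs c (octo X Y)) (trans (cong (λ b → target b 7F) eq) (sym (cong (λ b → connect b 7F) eq))) T
    by true  eq = subst₂ (FirstTrace F zs)
      (trans label (trans (cong (λ b → target b 3F) eq) (sym (cong (λ b → connect b 7F) eq)))) (sym (half X Y))
      (rotateTrace (X ++ Y ++ X ++ Y) (X ++ Y ++ X ++ Y) (half X Y) T)

-- Isomorphism and equivalence of the direction graphs

-- The change of directions from the first leaper's to the second leaper's, label by label.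
secondPerm : ∀ {o} → Origin o → Permutation′ 8
secondPerm w = permutation (λ l → secondLabel w (moveLabel l)) (λ l → moveLabel (back w l)) (to-from w) (from-to w)
  where
  back : ∀ {o} → Origin o → Label → Label
  back isG l = l ⊕ amount (kind l ↑)
    where
    amount : Kind → ℕ
    amount u = 7
    amount v = 5
  back isH l = l ⊕ 6
  to-from : ∀ {o} (w : Origin o) l → secondLabel w (moveLabel (moveLabel (back w l))) ≡ l
  to-from isG = ∀₈ refl refl refl refl refl refl refl refl
  to-from isH = ∀₈ refl refl refl refl refl refl refl refl
  from-to : ∀ {o} (w : Origin o) l → moveLabel (back w (secondLabel w (moveLabel l))) ≡ l
  from-to isG = ∀₈ refl refl refl refl refl refl refl refl
  from-to isH = ∀₈ refl refl refl refl refl refl refl refl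

secondPerm-move : ∀ {o} (w : Origin o) c → secondPerm w ⟨$⟩ʳ moveLabel c ≡ secondLabel w c
secondPerm-move isG = ∀₈ refl refl refl refl refl refl refl refl
secondPerm-move isH = ∀₈ refl refl refl refl refl refl refl refl

∈-↔ : ∀ {X : Set} {xs ys : List X} → Unique xs → Unique ys → (∀ {z} → z ∈ xs → z ∈ ys) → (∀ {z} → z ∈ ys → z ∈ xs) →
      Σ X (_∈ xs) ↔ Σ X (_∈ ys)
∈-↔ uxs uys to from = mk↔ₛ′ (λ (z , m) → z , to m) (λ (z , m) → z , from m)
  (λ _ → Σ-∈-≡ uys refl) (λ _ → Σ-∈-≡ uxs refl)

-- An F-cycle zs and an M-cycle path that have walks of the same word from the same label. Moves
-- labelled c are the corresponding arcs.
module Assemble {F M : Proportions} (prF : Proper F) (prM : Proper M) {o} (w : Origin o) {B B′ : Pred Square _}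
  {zs path : List Square} (Z : IsCycle F B zs) (frame : ∀ {z} → z ∈ zs → InFrame F z) (D : IsCycle M B′ path)
  {c : Label} {W : Word} (T : FirstTrace F zs c W) (S : SecondTrace (moves₂ w M) c W path) where

  V₁ V₂ : Label → Square
  V₁ = moves₁ F
  V₂ = moves₂ w M

  module T = FirstTrace T
  module S = SecondTrace S
  module Z = IsCycle Z
  module D = IsCycle D

  step : Label → Square × Square → Square × Square
  step d (p , q) = p ⊞ V₁ d , q ⊞ V₂ d

  -- The two walks run in parallel.
  ps : List (Square × Square)
  ps = trace step c (T.start , S.start) W

  ps₁ : map proj₁ ps ≡ trace (walk V₁) c T.start W
  ps₁ = sym (trace-map {stepX = step} proj₁ (λ _ _ → refl) c (T.start , S.start) W)

  ps₂ : map proj₂ ps ≡ path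
  ps₂ = trans (sym (trace-map {stepX = step} proj₂ (λ _ _ → refl) c (T.start , S.start) W)) S.traced

  closed : end step c (T.start , S.start) W ≡ (T.start , S.start)
  closed = cong₂ _,_
    (trans (sym (end-map {stepX = step} proj₁ (λ _ _ → refl) c (T.start , S.start) W)) T.closed)
    (trans (sym (end-map {stepX = step} proj₂ (λ _ _ → refl) c (T.start , S.start) W)) S.closed)

  Link : Square × Square → Square × Square → Set
  Link p q = ∃ λ d → q ≡ step d p

  near-link : ∀ {p q} → Near ps p q → Link p q
  near-link (inj₁ m) = All.lookup (cyclic-trace step c (T.start , S.start) W closed) m
  near-link {p} {q} (inj₂ m) with All.lookup (cyclic-trace step c (T.start , S.start) W closed) m
  ... | d , refl = opp d , cong₂ _,_
    (sym (trans (moves₁-opp F d (proj₁ q ⊞ V₁ d)) (⊞-⊟ (proj₁ q) (V₁ d))))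
    (sym (trans (moves₂-opp w M d (proj₂ q ⊞ V₂ d)) (⊞-⊟ (proj₂ q) (V₂ d))))

  ⊞-⊟ˡ : ∀ a b → (a ⊞ b) ⊟ a ≡ b
  ⊞-⊟ˡ (a , a′) (b , b′) = cong₂ _,_ (lem a b) (lem a′ b′)
    where
    lem : ∀ a b → (a ℤ.+ b) ℤ.- a ≡ b
    lem = solve-∀

  direction⇒ : ∀ {p q} i → Link p q → HasDirection F (proj₁ q ⊟ proj₁ p) i → HasDirection M (proj₂ q ⊟ proj₂ p) (secondPerm w ⟨$⟩ʳ i)
  direction⇒ {p₁ , p₂} i (d , refl) hd = trans (⊞-⊟ˡ p₂ (V₂ d)) (cong (λ l → apply (A l) M) (sym (begin
    secondPerm w ⟨$⟩ʳ i              ≡⟨ cong (secondPerm w ⟨$⟩ʳ_) (direction-unique prF i (moveLabel d) (trans (sym hd) (⊞-⊟ˡ p₁ (V₁ d)))) ⟩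
    secondPerm w ⟨$⟩ʳ moveLabel d    ≡⟨ secondPerm-move w d ⟩
    secondLabel w d                  ∎)))
    where open ≡-Reasoning

  direction⇐ : ∀ {p q} i → Link p q → HasDirection M (proj₂ q ⊟ proj₂ p) (secondPerm w ⟨$⟩ʳ i) → HasDirection F (proj₁ q ⊟ proj₁ p) i
  direction⇐ {p₁ , p₂} i (d , refl) hd = trans (⊞-⊟ˡ p₁ (V₁ d)) (cong (λ l → apply (A l) F) (begin
    moveLabel d                                        ≡⟨ inverseˡ (secondPerm w) ⟨
    secondPerm w ⟨$⟩ˡ (secondPerm w ⟨$⟩ʳ moveLabel d)  ≡⟨ cong (secondPerm w ⟨$⟩ˡ_) (secondPerm-move w d) ⟩
    secondPerm w ⟨$⟩ˡ secondLabel w d                  ≡⟨ cong (secondPerm w ⟨$⟩ˡ_)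
      (direction-unique prM (secondPerm w ⟨$⟩ʳ i) (secondLabel w d) (trans (sym hd) (⊞-⊟ˡ p₂ (V₂ d)))) ⟨
    secondPerm w ⟨$⟩ˡ (secondPerm w ⟨$⟩ʳ i)            ≡⟨ inverseˡ (secondPerm w) ⟩
    i                                                  ∎))
    where open ≡-Reasoning

  un₁ : Unique (map proj₁ ps)
  un₁ = subst Unique (sym ps₁) T.unique
  un₂ : Unique (map proj₂ ps)
  un₂ = subst Unique (sym ps₂) D.simple

  into : ∀ {z} → z ∈ zs → z ∈ map proj₁ ps
  into m = subst (_ ∈_) (sym ps₁) (T.complete m)
  outof : ∀ {z} → z ∈ map proj₁ ps → z ∈ zs
  outof m = T.sound (subst (_ ∈_) ps₁ m)

  joined-ps : All (λ (a , b) → Joined F a b) (cyclicPairs (map proj₁ ps))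
  joined-ps = subst (All _) (sym (cyclicPairs-map proj₁ ps))
    (Allₚ.map⁺ (All.map (λ { (d , refl) → moveLabel d , refl }) (cyclic-trace step c (T.start , S.start) W closed)))

  long-ps : 3 ℕ.≤ length (map proj₁ ps)
  long-ps = subst (3 ℕ.≤_) (trans (cong length (sym ps₂)) (trans (length-map proj₂ ps) (sym (length-map proj₁ ps)))) D.long

  near⇒ : ∀ {a b} → Near zs a b → Near (map proj₁ ps) a b
  near⇒ = near-transfer prF zs (map proj₁ ps) un₁ long-ps (cycle-joined Z) joined-ps into (λ m → frame (outof m))

  near⇐ : ∀ {a b} → Near (map proj₁ ps) a b → Near zs a b
  near⇐ = near-transfer prF (map proj₁ ps) zs Z.simple Z.long joined-ps (cycle-joined Z) outof frame

  iso₁ : RelabelIso (secondPerm w) (extract F zs) (extract M (map proj₂ ps))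
  iso₁ = record { bijection = bij ; arcs = arcs }
    where
    χ = cross ps un₁ un₂
    bij : Σ Square (_∈ zs) ↔ Σ Square (_∈ map proj₂ ps)
    bij = χ ↔-∘ ∈-↔ Z.simple un₁ into outof
    open Inverse bij using (to)
    arcs : ∀ a i b → Arc (extract F zs) a i b ⇔ Arc (extract M (map proj₂ ps)) (to a) (secondPerm w ⟨$⟩ʳ i) (to b)
    arcs (a , a∈) i (b , b∈) with cross-∈ ps un₁ un₂ (a , into a∈) | cross-∈ ps un₁ un₂ (b , into b∈)
    ... | p , p∈ , refl , eqp | q , q∈ , refl , eqq = mk⇔
      (λ (nr , hd) →
        let n = near-map⁻ proj₁ un₁ p∈ q∈ (near⇒ nr) in
        subst₂ (Near (map proj₂ ps)) (sym eqp) (sym eqq) (near-map⁺ proj₂ ps n) ,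
        subst₂ (λ x y → HasDirection M (y ⊟ x) (secondPerm w ⟨$⟩ʳ i)) (sym eqp) (sym eqq) (direction⇒ i (near-link n) hd))
      (λ (nr , hd) →
        let n = near-map⁻ proj₂ un₂ p∈ q∈ (subst₂ (Near (map proj₂ ps)) eqp eqq nr) in
        near⇐ (near-map⁺ proj₁ ps n) ,
        direction⇐ i (near-link n) (subst₂ (λ x y → HasDirection M (y ⊟ x) (secondPerm w ⟨$⟩ʳ i)) eqp eqq hd))

  iso : RelabelIso (secondPerm w) (extract F zs) (extract M path)
  iso = subst (λ xs → RelabelIso (secondPerm w) (extract F zs) (extract M xs)) ps₂ iso₁

main-iso : ∀ {o} (w : Origin o) {e′ e″} → e″ ≡ flipString e′ → (C : CycleOfDescent e′) (D : CycleOfDescent e″) (E : CanonicalSecondCycle D) →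
  (t : List Op) → CycleOfDescent.rest D ≡ o ∷ t →
  RelabelIso (secondPerm w) (extract (CycleOfDescent.leaper C) (CycleOfDescent.squares C)) (extract (CanonicalSecondCycle.second E) (CanonicalSecondCycle.path E))
main-iso w {e′} {e″} flipped C D E t rest≡ =
  subst₂ (λ L M → RelabelIso (secondPerm w) (extract L C.squares) (extract M E.path)) (leaper-growAll C) (sym second≡)
    (Assemble.iso prF prM w (subst (λ L → IsCycle L (Board C.leaper) C.squares) (sym (leaper-growAll C)) C.isCycle) frame
      (subst (λ M → IsCycle M (_∈ D.squares) E.path) second≡ E.isCycle)
      (Align.to-connect e″ connected (Align.to-target e″ connected aligned-trace)) (proj₂ (second e″)))
  where
  module C = CycleOfDescent C
  module D = CycleOfDescent D
  module E = CanonicalSecondCycle E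
  F : Proportions
  F = growAll e′ (proportions C.rest)
  prF : Proper F
  prF = proper-growAll e′ (proper-growAll C.rest proper-12)
  prM : Proper (proportions t)
  prM = proper-growAll t proper-12
  second≡ : E.second ≡ proportions t
  second≡ = cong secondLeaper rest≡
  second = secondTrace w t D.rest rest≡ D.isShell E.base E.base∈core E.inSection
  connected : ∀ e → Connected e
  connected e = proj₁ (second e)
  frame = proj₂ (firstTrace C)
  e′≡ : e′ ≡ flipString e″
  e′≡ = trans (sym (flipString-involutive e′)) (cong flipString (sym flipped))
  aligned-trace : FirstTrace F C.squares (edges e″ 7F) (octo (uʷ e″) (vʷ e″))
  aligned-trace = subst₂ (FirstTrace F C.squares) (cong (λ e → relabelEdges e 7F) e′≡)
    (trans (images-oct e′) (cong (λ e → octo (image e (u , ↑)) (image e (v , ↑))) e′≡)) (proj₁ (firstTrace C))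

≅-sym : ∀ {Φ Ψ} → Φ ≅ Ψ → Ψ ≅ Φ
≅-sym {Φ} {Ψ} I = record
  { bijection = ↔-sym bijection
  ; arcs = λ a i b → mk⇔
      (λ x → Equivalence.from (arcs (from a) i (from b)) (subst₂ (λ a b → Arc Ψ a i b) (sym (strictlyInverseˡ a)) (sym (strictlyInverseˡ b)) x))
      (λ x → subst₂ (λ a b → Arc Ψ a i b) (strictlyInverseˡ a) (strictlyInverseˡ b) (Equivalence.to (arcs (from a) i (from b)) x))
  }
  where
  open _≅_ I
  open Inverse bijection using (from; strictlyInverseˡ)

conjugate : ∀ {π Φ Φ′ Ψ Ψ′} → Φ ≅ Φ′ → RelabelIso π Φ′ Ψ′ → Ψ ≅ Ψ′ → RelabelIso π Φ Ψ
conjugate {π} {Φ} {Φ′} {Ψ} {Ψ′} I R J = record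
  { bijection = ↔-sym J.bijection ↔-∘ (R.bijection ↔-∘ I.bijection)
  ; arcs = λ a i b → mk⇔
      (λ x → Equivalence.to (J′.arcs _ _ _) (Equivalence.to (R.arcs _ i _) (Equivalence.to (I.arcs a i b) x)))
      (λ x → Equivalence.from (I.arcs a i b) (Equivalence.from (R.arcs _ i _) (Equivalence.from (J′.arcs _ _ _) x)))
  }
  where
  module I = _≅_ I
  module J = _≅_ J
  module R = RelabelIso R
  module J′ = _≅_ (≅-sym J)

between : ∀ {π ρ Φ Ψ₁ Ψ₂} → RelabelIso π Φ Ψ₁ → RelabelIso ρ Φ Ψ₂ → RelabelIso (flip π ∘ₚ ρ) Ψ₁ Ψ₂
between {π} {ρ} {Φ} {Ψ₁} {Ψ₂} R S = record
  { bijection = S.bijection ↔-∘ ↔-sym R.bijection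
  ; arcs = λ a i b → mk⇔
      (λ x → Equivalence.to (S.arcs (R.from a) (π ⟨$⟩ˡ i) (R.from b)) (Equivalence.from (R.arcs _ _ _) (there′ a i b x)))
      (λ x → back′ a i b (Equivalence.to (R.arcs _ _ _) (Equivalence.from (S.arcs (R.from a) (π ⟨$⟩ˡ i) (R.from b)) x)))
  }
  where
  module R = RelabelIso R
  module S = RelabelIso S
  eq : ∀ a i b → Arc Ψ₁ (R.to (R.from a)) (π ⟨$⟩ʳ (π ⟨$⟩ˡ i)) (R.to (R.from b)) ≡ Arc Ψ₁ a i b
  eq a i b = trans (cong₂ (λ a b → Arc Ψ₁ a (π ⟨$⟩ʳ (π ⟨$⟩ˡ i)) b) (R.strictlyInverseˡ a) (R.strictlyInverseˡ b))
                   (cong (λ i → Arc Ψ₁ a i b) (inverseʳ π))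
  there′ : ∀ a i b → Arc Ψ₁ a i b → Arc Ψ₁ (R.to (R.from a)) (π ⟨$⟩ʳ (π ⟨$⟩ˡ i)) (R.to (R.from b))
  there′ a i b = subst (λ X → X) (sym (eq a i b))
  back′ : ∀ a i b → Arc Ψ₁ (R.to (R.from a)) (π ⟨$⟩ʳ (π ⟨$⟩ˡ i)) (R.to (R.from b)) → Arc Ψ₁ a i b
  back′ a i b = subst (λ X → X) (eq a i b)

equivalent : ∀ {π Φ Ψ} → IsEquivalencePermutation π → RelabelIso π Φ Ψ → Equivalent Φ Ψ
equivalent {π} {Φ} {Ψ} isEq R = π , isEq , record
  { bijection = R.bijection
  ; arcs = λ a j b → mk⇔
      (λ { (i , refl , x) → Equivalence.to (R.arcs a i b) x })
      (λ x → π ⟨$⟩ˡ j , inverseʳ π , Equivalence.from (R.arcs a (π ⟨$⟩ˡ j) b) (subst (λ k → Arc Ψ (R.to a) k (R.to b)) (sym (inverseʳ π)) x))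
  }
  where module R = RelabelIso R

Pointwise : Mat ℝ → Mat ℝ → Set
Pointwise X Y = ∀ k → mapMat (λ x → seq x k) X ≡ mapMat (λ x → seq x k) Y

≈ᴿ-pointwise : ∀ x y → (∀ k → seq x k ≡ seq y k) → x ≈ᴿ y
≈ᴿ-pointwise x y eq ε = 0 , λ {k} _ →
  subst (λ q → ℚ.∣ seq x k ℚ.- q ∣ ℚ.< ε) (eq k)
    (subst (ℚ._< ε) (sym (cong ℚ.∣_∣ (ℚₚ.+-inverseʳ (seq x k)))) (ℚₚ.positive⁻¹ ε))

pointwise : ∀ X Y → Pointwise X Y → X ≈ᴹ Y
pointwise (mat a b c d) (mat a′ b′ c′ d′) eq =
  ≈ᴿ-pointwise a a′ (λ k → cong Mat.e₁₁ (eq k)) , ≈ᴿ-pointwise b b′ (λ k → cong Mat.e₁₂ (eq k)) ,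
  ≈ᴿ-pointwise c c′ (λ k → cong Mat.e₂₁ (eq k)) , ≈ᴿ-pointwise d d′ (λ k → cong Mat.e₂₂ (eq k))

const : Mat ℚ → Mat ℝ
const = mapMat fromℚ

equivalence-permutation : ∀ π P Q →
  (∀ i → Pointwise (Aᴿ (π ⟨$⟩ʳ i)) (const P *ᴹ Aᴿ i *ᴹ const Q)) → IsEquivalencePermutation π
equivalence-permutation π P Q eq = const P , const Q , λ i →
  pointwise (Aᴿ (π ⟨$⟩ʳ i)) (const P *ᴹ Aᴿ i *ᴹ const Q) (eq i)

-- Multiplying by the first matrix from the left and by one of the others from the right takes the
-- direction matrices of the first leaper to those of the second one. Up to scale, the first matrix is
-- that of a reflection that takes the axes to the diagonals.
P₁ Qᵍ Qʰ : Mat ℚ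
P₁ = mat 1ℚ (ℚ.- 1ℚ) (ℚ.- 1ℚ) (ℚ.- 1ℚ)
Qᵍ = mat ½ (ℚ.- ½) ½ ½
Qʰ = mat (ℚ.- ½) (ℚ.- ½) (ℚ.- ½) ½

isEquivalence-g : IsEquivalencePermutation (secondPerm isG)
isEquivalence-g = equivalence-permutation (secondPerm isG) P₁ Qᵍ
  (∀₈ (λ _ → refl) (λ _ → refl) (λ _ → refl) (λ _ → refl)
      (λ _ → refl) (λ _ → refl) (λ _ → refl) (λ _ → refl))

isEquivalence-h : IsEquivalencePermutation (secondPerm isH)
isEquivalence-h = equivalence-permutation (secondPerm isH) P₁ Qʰ
  (∀₈ (λ _ → refl) (λ _ → refl) (λ _ → refl) (λ _ → refl)
      (λ _ → refl) (λ _ → refl) (λ _ → refl) (λ _ → refl))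

-- The vectors of the two second leaper cycles differ by the sign of the smaller proportion.
isEquivalence-gh : IsEquivalencePermutation (flip (secondPerm isG) ∘ₚ secondPerm isH)
isEquivalence-gh = equivalence-permutation (flip (secondPerm isG) ∘ₚ secondPerm isH) (mat 1ℚ 0ℚ 0ℚ 1ℚ) (mat (ℚ.- 1ℚ) 0ℚ 0ℚ 1ℚ)
  (∀₈ (λ _ → refl) (λ _ → refl) (λ _ → refl) (λ _ → refl)
      (λ _ → refl) (λ _ → refl) (λ _ → refl) (λ _ → refl))

second-iso : ∀ {o} (w : Origin o) {e′ e″ Φ Ψ} → e″ ≡ flipString e′ → IsFundamental e′ Φ → IsSecondFundamental o e″ Ψ → RelabelIso (secondPerm w) Φ Ψ
second-iso w flipped I S = conjugate (IsFundamental.extracted I)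
  (main-iso w flipped (IsFundamental.cycle I) (IsSecondFundamental.cycle S) (IsSecondFundamental.secondCycle S) (IsSecondFundamental.t S) (IsSecondFundamental.origin S))
  (IsSecondFundamental.extracted S)

theorem12 : ∀ (e′ e″ : List Op) → e″ ≡ flipString e′ →
    ∀ (Φ Φg Φh : LabelledDigraph) →
    IsFundamental e′ Φ → IsSecondFundamental g e″ Φg → IsSecondFundamental h e″ Φh →
    Equivalent Φ Φg × Equivalent Φ Φh × Equivalent Φg Φh
theorem12 e′ e″ flipped Φ Φg Φh I Ig Ih =
  equivalent isEquivalence-g isoᵍ , equivalent isEquivalence-h isoʰ , equivalent isEquivalence-gh (between isoᵍ isoʰ)
  where
  isoᵍ : RelabelIso (secondPerm isG) Φ Φg
  isoᵍ = second-iso isG flipped I Ig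
  isoʰ : RelabelIso (secondPerm isH) Φ Φh
  isoʰ = second-iso isH flipped I Ih
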